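{- Let $d \geq 2$ and $1 \leq k \leq d-1$ be integers. Then $$\underline{sa}_d^s(d+k) \geq 3(d-1).$$ In particular, $$\underline{sa}_d^s(2d-1) = 3(d-1).$$
   Context: Let $X=\{x_1,\dots,x_n\}\subset\mathbb{R}^d$ be a finite set (with $x_i\neq x_j$ for $i\ne j$) whose affine hull is $\mathbb{R}^d$, and let $P=\operatorname{conv}X$. Two distinct points $x_i,x_j\in X$ are strictly antipodal (in $X$) if there are different parallel supporting hyperplanes $H',H''$ of $P$ with $X\cap H'=\{x_i\}$ and $X\cap H''=\{x_j\}$. $sa(X)$ is the number of (unordered) strictly antipodal pairs of $X$. $X$ is in strictly convex position if $X=\operatorname{vert}P$ (the vertex set of $P$). $\mathcal{C}_d^s(n)$ is the family of all $X\subset\mathbb{R}^d$ with $|X|=n$, $\operatorname{aff}X=\mathbb{R}^d$, $X$ in strictly convex position, and $\underline{sa}_d^s(n):=\min\{sa(X)\mid X\in\mathcal{C}_d^s(n)\}$. -}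

module Defs where

open import Algebra.Bundles using (CommutativeRing)
open import Algebra.Structures using (IsCommutativeRing)
import Algebra.Properties.Monoid.Sum as MonoidSum
open import Axiom.ExcludedMiddle using (ExcludedMiddle)
open import Data.Fin.Base as Fin using (Fin)
open import Data.List.Base using (allFin; cartesianProduct; filter; length)
open import Data.Nat.Base as ℕ using (ℕ)
open import Data.Product using (∃-syntax; _×_; _,_)
open import Data.Sum.Base using (_⊎_)
open import Data.Vec.Functional using (Vector)
import Data.Vec.Functional.Relation.Binary.Equality.Setoid as VectorEquality
open import Level using (0ℓ) renaming (suc to lsuc)
open import Relation.Binary.Core using (Rel)
open import Relation.Binary.PropositionalEquality.Core using (_≡_)
open import Relation.Binary.Structures using (IsTotalOrder)
open import Relation.Nullary using (¬_)
open import Relation.Unary using (Pred; _∈_; _∩_; _≐_; Satisfiable; Universal)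

-- The real numbers, given axiomatically as a Dedekind-complete ordered field
-- up to a setoid equality.  Classically these axioms have exactly one model up
-- to isomorphism.
record Reals : Set (lsuc 0ℓ) where
  infix  4 _≈_ _≤_
  infixl 6 _+_
  infixl 7 _*_
  infix  8 -_
  field
    Carrier : Set
    _≈_ _≤_ : Rel Carrier 0ℓ
    _+_ _*_ : Carrier → Carrier → Carrier
    -_      : Carrier → Carrier
    0# 1#   : Carrier

    isCommutativeRing : IsCommutativeRing _≈_ _+_ _*_ -_ 0# 1#
    0≉1               : ¬ (0# ≈ 1#)
    inverse           : ∀ x → ¬ (x ≈ 0#) → ∃[ y ] (x * y ≈ 1#)

    isTotalOrder      : IsTotalOrder _≈_ _≤_
    +-monoˡ-≤         : ∀ z {x y} → x ≤ y → x + z ≤ y + z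
    *-nonNegative     : ∀ {x y} → 0# ≤ x → 0# ≤ y → 0# ≤ x * y

  UpperBound : Pred Carrier 0ℓ → Pred Carrier 0ℓ
  UpperBound S b = ∀ {x} → x ∈ S → x ≤ b

  field
    supremum : (S : Pred Carrier 0ℓ) → Satisfiable S → Satisfiable (UpperBound S) →
               ∃[ s ] (s ∈ UpperBound S × (∀ {b} → b ∈ UpperBound S → s ≤ b))

  commutativeRing : CommutativeRing 0ℓ 0ℓ
  commutativeRing = record { isCommutativeRing = isCommutativeRing }

  open CommutativeRing commutativeRing public using (setoid; +-monoid)


module Geometry (ℝ : Reals) where

  open Reals ℝ
  open MonoidSum +-monoid using (sum)
  open VectorEquality setoid using (_≋_)

  Point : ℕ → Set
  Point d = Vector Carrier d

  ⟨_,_⟩ : ∀ {d} → Point d → Point d → Carrier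
  ⟨ a , y ⟩ = sum (λ c → a c * y c)

  𝟎 : ∀ {d} → Point d
  𝟎 _ = 0#

  combination : ∀ {d n} → Vector Carrier n → Vector (Point d) n → Point d
  combination w x c = sum (λ i → w i * x i c)

  -- A finite set {x₁, …, xₙ} ⊂ ℝᵈ is given by an enumeration x of its points;
  -- membership in 𝒞ˢ below includes that the xᵢ are pairwise distinct, so that
  -- the set has exactly n elements.
  pts : ∀ {d n} → Vector (Point d) n → Pred (Point d) 0ℓ
  pts x y = ∃[ i ] (y ≋ x i)

  aff : ∀ {d n} → Vector (Point d) n → Pred (Point d) 0ℓ
  aff x y = ∃[ w ] (sum w ≈ 1# × y ≋ combination w x)

  conv : ∀ {d n} → Vector (Point d) n → Pred (Point d) 0ℓ
  conv x y = ∃[ w ] ((∀ i → 0# ≤ w i) × sum w ≈ 1# × y ≋ combination w x)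

  -- ｛ y ｝ in Relation.Unary uses _≡_; points are compared by _≋_ instead.
  singleton : ∀ {d} → Point d → Pred (Point d) 0ℓ
  singleton p y = y ≋ p

  record Hyperplane (d : ℕ) : Set where
    field
      normal   : Point d
      offset   : Carrier
      normal≉𝟎 : ¬ (normal ≋ 𝟎)

  open Hyperplane

  ⟦_⟧ : ∀ {d} → Hyperplane d → Pred (Point d) 0ℓ
  ⟦ H ⟧ y = ⟨ normal H , y ⟩ ≈ offset H

  Parallel : ∀ {d} → Rel (Hyperplane d) 0ℓ
  Parallel H′ H″ = ∃[ t ] (normal H″ ≋ λ c → t * normal H′ c)

  -- One hyperplane has many (normal, offset) representations, so different
  -- means different as point sets.
  Different : ∀ {d} → Rel (Hyperplane d) 0ℓ
  Different H′ H″ = ¬ (⟦ H′ ⟧ ≐ ⟦ H″ ⟧)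

  -- H meets P, and P lies in one of the two closed half-spaces bounded by H.
  Supporting : ∀ {d} → Hyperplane d → Pred (Point d) 0ℓ → Set
  Supporting H P =
    Satisfiable (P ∩ ⟦ H ⟧) ×
    ((∀ {y} → y ∈ P → ⟨ normal H , y ⟩ ≤ offset H) ⊎
     (∀ {y} → y ∈ P → offset H ≤ ⟨ normal H , y ⟩))

  -- The vertices of a polytope P of positive dimension: its 0-dimensional
  -- faces, cut out by supporting hyperplanes.
  vert : ∀ {d} → Pred (Point d) 0ℓ → Pred (Point d) 0ℓ
  vert P v = ∃[ H ] (Supporting H P × (P ∩ ⟦ H ⟧) ≐ singleton v)

  StrictlyConvexPosition : ∀ {d n} → Pred (Vector (Point d) n) 0ℓ
  StrictlyConvexPosition x = pts x ≐ vert (conv x)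

  𝒞ˢ : (d n : ℕ) → Pred (Vector (Point d) n) 0ℓ
  𝒞ˢ d n x =
    (∀ {i j} → x i ≋ x j → i ≡ j) ×
    Universal (aff x) ×
    StrictlyConvexPosition x

  StrictlyAntipodal : ∀ {d n} → Vector (Point d) n → Fin n → Fin n → Set
  StrictlyAntipodal x i j =
    ¬ (x i ≋ x j) ×
    ∃[ H′ ] ∃[ H″ ]
      ( Different H′ H″ × Parallel H′ H″
      × Supporting H′ (conv x) × Supporting H″ (conv x)
      × (pts x ∩ ⟦ H′ ⟧) ≐ singleton (x i)
      × (pts x ∩ ⟦ H″ ⟧) ≐ singleton (x j))

  -- Strict antipodality over ℝ is not constructively decidable, so counting
  -- pairs and taking minima uses excluded middle.
  module Counting (em : ExcludedMiddle 0ℓ) where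

    -- Each unordered pair {i , j} with i ≠ j is represented once, by i < j.
    UnorderedStrictlyAntipodal : ∀ {d n} → Vector (Point d) n → Pred (Fin n × Fin n) 0ℓ
    UnorderedStrictlyAntipodal x (i , j) = i Fin.< j × StrictlyAntipodal x i j

    sa : ∀ {d n} → Vector (Point d) n → ℕ
    sa {n = n} x =
      length (filter (λ p → em {P = UnorderedStrictlyAntipodal x p})
                     (cartesianProduct (allFin n) (allFin n)))

    -- m is the minimum of sa over 𝒞ˢ d n; in particular the minimum is attained.
    IsMinSa : (d n m : ℕ) → Set
    IsMinSa d n m =
      (∃[ x ] (x ∈ 𝒞ˢ d n × sa x ≡ m)) ×
      (∀ x → x ∈ 𝒞ˢ d n → m ℕ.≤ sa x)

-- Let W be the space of functionals on the points, seen as functions of the index, and let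
-- d be its rank modulo constants; i and j are partners if some f ∈ W has its strict maximum
-- at i and its strict minimum at j.  If there are n ≤ 2d - 1 points, then every set E of
-- ordered pairs that contains an (argmax, argmin) pair of each nonconstant f ∈ W has at least
-- 6(d - 1) elements, by induction on d.  Passing to {f ∈ W | f a = f b} is the projection along
-- ab, and it lowers the rank by one.
--
-- * If ab is not an edge of the hull, then the image of a and b is not a vertex of the projection,
--   so a and b can be dropped together with all pairs meeting them.  At least six ordered pairs
--   do if every point has two partners.  If the only partner of some a is b, then ab is not an
--   edge, and b has three partners: otherwise d - 1 independent lines parallel to ab would each
--   contain two further points, and n ≥ 2d.
-- * If all pairs are edges, then any two points have a common partner.  For n = 2d - 1, a graph
--   with this property has at least 3(n - 1)/2 edges.  For smaller n take mutual partners a, b, y.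
--   If they lie in a proper face, then a and b have a second common partner, and identifying a
--   with b loses three unordered pairs.  Otherwise project along a, b, y, which loses at least
--   six of them and lowers the rank by two.
--
-- Equality holds for the pyramid over a (d - 1)-dimensional cross-polytope.

module Submission where

open import Defs
open import Algebra.Bundles using (CommutativeRing)
import Algebra.Properties.Ring as RingProperties
import Algebra.Properties.Semiring.Mult.TCOptimised as Mult
import Algebra.Properties.Semiring.Sum as SemiringSum
import Algebra.Solver.Ring as RingSolver
open import Algebra.Solver.Ring.AlmostCommutativeRing using (fromCommutativeRing; _-Raw-AlmostCommutative⟶_)
open import Axiom.ExcludedMiddle using (ExcludedMiddle)
open import Data.Fin.Base as Fin using (Fin; zero; suc; _↑ˡ_; _↑ʳ_; splitAt; inject≤; fromℕ; lower₁)
import Data.Fin.Properties as Finₚ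
open import Data.Integer.Base as ℤ using (ℤ; +_; -[1+_])
import Data.Integer.Properties as ℤₚ
open import Data.List.Base using (List; []; _∷_; _++_; length; map; filter; allFin; cartesianProduct)
open import Data.List.Membership.Propositional using (_∈_; _∉_)
open import Data.List.Membership.Propositional.Properties
  using (∈-map⁺; ∈-map⁻; ∈-++⁺ˡ; ∈-++⁺ʳ; ∈-++⁻; ∈-∃++; ∈-filter⁺; ∈-filter⁻; ∈-cartesianProduct⁺; ∈-allFin)
import Data.List.Properties as Listₚ
open import Data.List.Relation.Binary.Subset.Propositional using (_⊆_)
open import Data.List.Relation.Unary.All as All using (All; []; _∷_)
open import Data.List.Relation.Unary.AllPairs using ([]; _∷_)
open import Data.List.Relation.Unary.Any using (here; there)
open import Data.List.Relation.Unary.Unique.Propositional using (Unique)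
import Data.List.Relation.Unary.Unique.Propositional.Properties as Uniqueₚ
open import Data.Maybe.Base using (Maybe; just; nothing)
open import Data.Nat.Base as ℕ using (ℕ; zero; suc; z≤n; s≤s)
import Data.Nat.Properties as ℕₚ
open import Data.Product using (∃-syntax; _×_; _,_; proj₁; proj₂; swap)
open import Data.Sum.Base using (_⊎_; inj₁; inj₂; [_,_]′)
open import Data.Vec.Functional using (Vector)
import Data.Vec.Functional.Relation.Binary.Equality.Setoid as VectorEquality
open import Function.Base using (_∘_)
open import Level using (0ℓ)
open import Relation.Binary.Definitions using (tri<; tri≈; tri>)
open import Relation.Binary.PropositionalEquality as ≡ using (_≡_; _≢_)
import Relation.Binary.Reasoning.Setoid as SetoidReasoning
open import Relation.Binary.Structures using (IsTotalOrder)
open import Relation.Nullary using (¬_; yes; no; contradiction)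

-- Strictly convex position does not survive a projection: points may coincide or stop being
-- vertices. The induction is therefore about a set `E` that only has to contain some pair of
-- extreme points for each functional, a property that every subspace of functionals inherits.
-- Points that are not exposed are discarded first, without loss of rank and without enlarging `E`.
-- Once all points are exposed, a small perturbation makes extremes strict, and a strict pair is
-- forced into `E`, so pairs can be counted there.
--
-- The constants come from a budget: to lose two points and six ordered pairs per rank keeps n ≤ 2d
-- - 1 and 6(d - 1) in step. Identifying two points costs only one point, and collapsing three
-- points costs only three for two ranks, so both moves need n ≤ 2d - 2. For n = 2d - 1 the graph
-- count 3(n - 1) = 6(d - 1) is exact.
--
-- General position is obtained throughout from functionals that avoid the zero sets of finitely
-- many linear forms, with no appeal to dimension or measure.

-- Ring identities with integer coefficients

module IntegerSolver {c ℓ} (R : CommutativeRing c ℓ) where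
  open CommutativeRing R
  open RingProperties ring
  open Mult semiring renaming (_×_ to infixr 8 _⋆_)
  open SetoidReasoning setoid

  private
    ⟦_⟧ : ℤ → Carrier
    ⟦ + n ⟧ = n ⋆ 1#
    ⟦ -[1+ n ] ⟧ = - (suc n ⋆ 1#)

    cancel-suc : ∀ x y → (1# + x) - (1# + y) ≈ x - y
    cancel-suc x y = begin
      (1# + x) - (1# + y)    ≈⟨ +-congˡ (-‿+-comm 1# y) ⟨
      (1# + x) + (- 1# - y)  ≈⟨ +-congʳ (+-comm 1# x) ⟩
      (x + 1#) + (- 1# - y)  ≈⟨ +-assoc x 1# _ ⟩
      x + (1# + (- 1# - y))  ≈⟨ +-congˡ (+-assoc 1# _ _) ⟨
      x + ((1# - 1#) - y)    ≈⟨ +-congˡ (+-congʳ (-‿inverseʳ 1#)) ⟩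
      x + (0# - y)           ≈⟨ +-congˡ (+-identityˡ _) ⟩
      x - y                  ∎

    ⊖-homo : ∀ m n → ⟦ m ℤ.⊖ n ⟧ ≈ (m ⋆ 1#) - (n ⋆ 1#)
    ⊖-homo m zero = begin
      m ⋆ 1#         ≈⟨ +-identityʳ _ ⟨
      m ⋆ 1# + 0#    ≈⟨ +-congˡ -0#≈0# ⟨
      m ⋆ 1# - 0#    ∎
    ⊖-homo zero (suc n) = sym (+-identityˡ _)
    ⊖-homo (suc m) (suc n) = begin
      ⟦ suc m ℤ.⊖ suc n ⟧              ≡⟨ ≡.cong ⟦_⟧ (ℤₚ.[1+m]⊖[1+n]≡m⊖n m n) ⟩
      ⟦ m ℤ.⊖ n ⟧                      ≈⟨ ⊖-homo m n ⟩
      m ⋆ 1# - n ⋆ 1#                  ≈⟨ cancel-suc _ _ ⟨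
      (1# + m ⋆ 1#) - (1# + n ⋆ 1#)    ≈⟨ +-cong (1+× m 1#) (-‿cong (1+× n 1#)) ⟨
      suc m ⋆ 1# - suc n ⋆ 1#          ∎

    neg-homo : ∀ x → ⟦ ℤ.- x ⟧ ≈ - ⟦ x ⟧
    neg-homo (+ zero) = sym -0#≈0#
    neg-homo (+ suc n) = refl
    neg-homo -[1+ n ] = sym (-‿involutive _)

    +-homo : ∀ x y → ⟦ x ℤ.+ y ⟧ ≈ ⟦ x ⟧ + ⟦ y ⟧
    +-homo (+ m) (+ n) = ×-homo-+ 1# m n
    +-homo (+ m) -[1+ n ] = ⊖-homo m (suc n)
    +-homo -[1+ m ] (+ n) = trans (⊖-homo n (suc m)) (+-comm _ _)
    +-homo -[1+ m ] -[1+ n ] = begin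
      - (suc (suc (m ℕ.+ n)) ⋆ 1#)        ≡⟨ ≡.cong (λ k → - (suc k ⋆ 1#)) (≡.sym (ℕₚ.+-suc m n)) ⟩
      - ((suc m ℕ.+ suc n) ⋆ 1#)          ≈⟨ -‿cong (×-homo-+ 1# (suc m) (suc n)) ⟩
      - (suc m ⋆ 1# + suc n ⋆ 1#)         ≈⟨ -‿+-comm _ _ ⟨
      - (suc m ⋆ 1#) - (suc n ⋆ 1#)       ∎

    *-homo⁺ : ∀ m n → ⟦ + m ℤ.* + n ⟧ ≈ (m ⋆ 1#) * (n ⋆ 1#)
    *-homo⁺ m n = trans (reflexive (≡.cong ⟦_⟧ (≡.sym (ℤₚ.pos-* m n)))) (×1-homo-* m n)

    *-homo : ∀ x y → ⟦ x ℤ.* y ⟧ ≈ ⟦ x ⟧ * ⟦ y ⟧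
    *-homo (+ m) (+ n) = *-homo⁺ m n
    *-homo (+ m) -[1+ n ] = begin
      ⟦ + m ℤ.* (ℤ.- + suc n) ⟧        ≡⟨ ≡.cong ⟦_⟧ (≡.sym (ℤₚ.neg-distribʳ-* (+ m) (+ suc n))) ⟩
      ⟦ ℤ.- (+ m ℤ.* + suc n) ⟧        ≈⟨ neg-homo (+ m ℤ.* + suc n) ⟩
      - ⟦ + m ℤ.* + suc n ⟧            ≈⟨ -‿cong (*-homo⁺ m (suc n)) ⟩
      - ((m ⋆ 1#) * (suc n ⋆ 1#))      ≈⟨ -‿distribʳ-* _ _ ⟩
      (m ⋆ 1#) * - (suc n ⋆ 1#)        ∎
    *-homo -[1+ m ] (+ n) = begin
      ⟦ (ℤ.- + suc m) ℤ.* + n ⟧        ≡⟨ ≡.cong ⟦_⟧ (≡.sym (ℤₚ.neg-distribˡ-* (+ suc m) (+ n))) ⟩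
      ⟦ ℤ.- (+ suc m ℤ.* + n) ⟧        ≈⟨ neg-homo (+ suc m ℤ.* + n) ⟩
      - ⟦ + suc m ℤ.* + n ⟧            ≈⟨ -‿cong (*-homo⁺ (suc m) n) ⟩
      - ((suc m ⋆ 1#) * (n ⋆ 1#))      ≈⟨ -‿distribˡ-* _ _ ⟩
      - (suc m ⋆ 1#) * (n ⋆ 1#)        ∎
    *-homo -[1+ m ] -[1+ n ] = begin
      (suc m ℕ.* suc n) ⋆ 1#               ≈⟨ ×1-homo-* (suc m) (suc n) ⟩
      (suc m ⋆ 1#) * (suc n ⋆ 1#)          ≈⟨ -‿involutive _ ⟨
      - - ((suc m ⋆ 1#) * (suc n ⋆ 1#))    ≈⟨ -‿cong (-‿distribʳ-* _ _) ⟩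
      - ((suc m ⋆ 1#) * - (suc n ⋆ 1#))    ≈⟨ -‿distribˡ-* _ _ ⟩
      - (suc m ⋆ 1#) * - (suc n ⋆ 1#)      ∎

    morphism : ℤ.+-*-rawRing -Raw-AlmostCommutative⟶ fromCommutativeRing R
    morphism = record
      { ⟦_⟧ = ⟦_⟧ ; +-homo = +-homo ; *-homo = *-homo ; -‿homo = neg-homo
      ; 0-homo = refl ; 1-homo = refl }

    -- Distinct integers may still agree in `R`, so their comparison is left open.
    coefficient≟ : ∀ x y → Maybe (⟦ x ⟧ ≈ ⟦ y ⟧)
    coefficient≟ x y with x ℤₚ.≟ y
    ... | yes ≡.refl = just refl
    ... | no _ = nothing

  open RingSolver ℤ.+-*-rawRing (fromCommutativeRing R) morphism coefficient≟ public
    using (solve; _:=_; _:+_; _:*_; _:-_; :-_; con)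

-- Order and arithmetic of the reals

module OrderedField (em : ExcludedMiddle 0ℓ) (ℝ : Reals) where
  open Reals ℝ public
  open CommutativeRing commutativeRing public
    using (_-_; refl; sym; trans; reflexive; +-cong; +-congˡ; +-congʳ; *-cong; *-congˡ; *-congʳ; -‿cong;
           +-identityˡ; +-identityʳ; +-comm; +-assoc; *-comm; *-assoc; *-identityˡ; *-identityʳ;
           zeroˡ; zeroʳ; -‿inverseʳ; semiring; ring)
  open IntegerSolver commutativeRing public
  open IsTotalOrder isTotalOrder public
    using (antisym; total; ≤-respˡ-≈; ≤-respʳ-≈) renaming (refl to ≤-refl; trans to ≤-trans; reflexive to ≈⇒≤)

  infix 4 _<_
  _<_ : Carrier → Carrier → Set
  x < y = ¬ (y ≤ x)

  private variable a b c x y z : Carrier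

  <⇒≤ : x < y → x ≤ y
  <⇒≤ {x} {y} x<y with total x y
  ... | inj₁ x≤y = x≤y
  ... | inj₂ y≤x = contradiction y≤x x<y

  <⇒≉ : x < y → ¬ (x ≈ y)
  <⇒≉ x<y x≈y = x<y (≈⇒≤ (sym x≈y))

  <⇒≉′ : x < y → ¬ (y ≈ x)
  <⇒≉′ x<y y≈x = x<y (≈⇒≤ y≈x)

  <-≤-trans : x < y → y ≤ z → x < z
  <-≤-trans x<y y≤z z≤x = x<y (≤-trans y≤z z≤x)

  ≤-<-trans : x ≤ y → y < z → x < z
  ≤-<-trans x≤y y<z z≤x = y<z (≤-trans z≤x x≤y)

  <-trans : x < y → y < z → x < z
  <-trans x<y = ≤-<-trans (<⇒≤ x<y)

  <-respʳ-≈ : y ≈ z → x < y → x < z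
  <-respʳ-≈ y≈z x<y = <-≤-trans x<y (≈⇒≤ y≈z)

  <-respˡ-≈ : x ≈ y → x < z → y < z
  <-respˡ-≈ x≈y x<z = ≤-<-trans (≈⇒≤ (sym x≈y)) x<z

  ≤-cases : x ≤ y → x < y ⊎ x ≈ y
  ≤-cases {x} {y} x≤y with em {P = y ≤ x}
  ... | yes y≤x = inj₂ (antisym x≤y y≤x)
  ... | no y≰x = inj₁ y≰x

  ≤-or-> : ∀ x y → x ≤ y ⊎ y < x
  ≤-or-> x y with em {P = x ≤ y}
  ... | yes x≤y = inj₁ x≤y
  ... | no x≰y = inj₂ x≰y

  ≉-cases : ¬ (x ≈ y) → x < y ⊎ y < x
  ≉-cases {x} {y} x≉y with total x y
  ... | inj₁ x≤y = inj₁ λ y≤x → x≉y (antisym x≤y y≤x)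
  ... | inj₂ y≤x = inj₂ λ x≤y → x≉y (antisym x≤y y≤x)

  +-monoʳ-≤ : ∀ z → x ≤ y → z + x ≤ z + y
  +-monoʳ-≤ z x≤y = ≤-respˡ-≈ (+-comm _ z) (≤-respʳ-≈ (+-comm _ z) (+-monoˡ-≤ z x≤y))

  +-mono-≤ : x ≤ y → a ≤ b → x + a ≤ y + b
  +-mono-≤ {a = a} x≤y a≤b = ≤-trans (+-monoˡ-≤ a x≤y) (+-monoʳ-≤ _ a≤b)

  x≤y⇒0≤y-x : x ≤ y → 0# ≤ y - x
  x≤y⇒0≤y-x {x} x≤y = ≤-respˡ-≈ (-‿inverseʳ x) (+-monoˡ-≤ (- x) x≤y)

  0≤y-x⇒x≤y : 0# ≤ y - x → x ≤ y
  0≤y-x⇒x≤y {y} {x} p = ≤-respˡ-≈ (+-identityˡ x)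
    (≤-respʳ-≈ (solve 2 (λ y x → y :- x :+ x := y) refl y x) (+-monoˡ-≤ x p))

  x<y⇒0<y-x : x < y → 0# < y - x
  x<y⇒0<y-x {x} {y} x<y p = x<y (0≤y-x⇒x≤y (≤-respʳ-≈ (solve 2 (λ y x → con (+ 0) :- (y :- x) := x :- y) refl y x) (x≤y⇒0≤y-x p)))

  0<y-x⇒x<y : 0# < y - x → x < y
  0<y-x⇒x<y {y} {x} p y≤x = p (0≤y-x⇒x≤y (≤-respʳ-≈ (solve 2 (λ y x → x :- y := con (+ 0) :- (y :- x)) refl y x) (x≤y⇒0≤y-x y≤x)))

  x-y≈0⇒x≈y : x - y ≈ 0# → x ≈ y
  x-y≈0⇒x≈y {x} {y} p = trans (solve 2 (λ x y → x := x :- y :+ y) refl x y) (trans (+-congʳ p) (+-identityˡ y))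

  x≈y⇒x-y≈0 : x ≈ y → x - y ≈ 0#
  x≈y⇒x-y≈0 {x} {y} p = trans (+-congʳ p) (-‿inverseʳ y)

  0<+ˡ : 0# < x → 0# ≤ y → 0# < x + y
  0<+ˡ {x} 0<x 0≤y = <-≤-trans 0<x (≤-respˡ-≈ (+-identityʳ x) (+-monoʳ-≤ x 0≤y))

  *-monoʳ-≤ : 0# ≤ c → x ≤ y → c * x ≤ c * y
  *-monoʳ-≤ {c} {x} {y} 0≤c x≤y = 0≤y-x⇒x≤y (≤-respʳ-≈
    (solve 3 (λ c x y → c :* (y :- x) := c :* y :- c :* x) refl c x y)
    (*-nonNegative 0≤c (x≤y⇒0≤y-x x≤y)))

  *-zero-cancel : ¬ (x ≈ 0#) → x * y ≈ 0# → y ≈ 0#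
  *-zero-cancel {x} {y} x≉0 xy≈0 = let (w , xw≈1) = inverse x x≉0 in
    trans (sym (*-identityˡ y)) (trans (*-congʳ (sym xw≈1))
      (trans (solve 3 (λ x w y → x :* w :* y := w :* (x :* y)) refl x w y) (trans (*-congˡ xy≈0) (zeroʳ w))))

  *-positive : 0# < x → 0# < y → 0# < x * y
  *-positive 0<x 0<y with ≤-cases (*-nonNegative (<⇒≤ 0<x) (<⇒≤ 0<y))
  ... | inj₁ 0<xy = 0<xy
  ... | inj₂ 0≈xy = contradiction (*-zero-cancel (<⇒≉′ 0<x) (sym 0≈xy)) (<⇒≉′ 0<y)

  *-monoʳ-< : 0# < c → x < y → c * x < c * y
  *-monoʳ-< {c} {x} {y} 0<c x<y = 0<y-x⇒x<y (<-respʳ-≈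
    (solve 3 (λ c x y → c :* (y :- x) := c :* y :- c :* x) refl c x y)
    (*-positive 0<c (x<y⇒0<y-x x<y)))

  *-monoʳ-≤-nonPos : c ≤ 0# → x ≤ y → c * y ≤ c * x
  *-monoʳ-≤-nonPos {c} {x} {y} c≤0 x≤y = 0≤y-x⇒x≤y (≤-respʳ-≈
    (solve 3 (λ c x y → (con (+ 0) :- c) :* (y :- x) := c :* x :- c :* y) refl c x y)
    (*-nonNegative (x≤y⇒0≤y-x c≤0) (x≤y⇒0≤y-x x≤y)))

  neg-mono-≤ : x ≤ y → - y ≤ - x
  neg-mono-≤ {x} {y} x≤y = 0≤y-x⇒x≤y (≤-respʳ-≈ (solve 2 (λ x y → y :- x := :- x :- :- y) refl x y) (x≤y⇒0≤y-x x≤y))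

  neg-cancel-≤ : - y ≤ - x → x ≤ y
  neg-cancel-≤ {y} {x} p = 0≤y-x⇒x≤y (≤-respʳ-≈ (solve 2 (λ x y → :- x :- :- y := y :- x) refl x y) (x≤y⇒0≤y-x p))

  neg-mono-< : x < y → - y < - x
  neg-mono-< x<y -x≤-y = x<y (neg-cancel-≤ -x≤-y)

  0<1 : 0# < 1#
  0<1 1≤0 = 0≉1 (antisym (≤-respʳ-≈ (solve 0 ((:- con (+ 1)) :* (:- con (+ 1)) := con (+ 1)) refl) (*-nonNegative 0≤-1 0≤-1)) 1≤0)
    where
    0≤-1 : 0# ≤ - 1#
    0≤-1 = ≤-respʳ-≈ (+-identityˡ _) (x≤y⇒0≤y-x 1≤0)

  positive-inverse : 0# < x → ∃[ y ] (0# < y × x * y ≈ 1#)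
  positive-inverse {x} 0<x with inverse x (<⇒≉′ 0<x)
  ... | y , xy≈1 = y , (λ y≤0 → 0<1 (≤-respˡ-≈ xy≈1 (≤-respʳ-≈ (zeroʳ x) (*-monoʳ-≤ (<⇒≤ 0<x) y≤0)))) , xy≈1

  -- Junk value 0# at 0#.
  reciprocal : Carrier → Carrier
  reciprocal x with em {P = x ≈ 0#}
  ... | yes _ = 0#
  ... | no x≉0 = proj₁ (inverse x x≉0)

  *-reciprocal : 0# < x → x * reciprocal x ≈ 1#
  *-reciprocal {x} 0<x with em {P = x ≈ 0#}
  ... | yes x≈0 = contradiction x≈0 (<⇒≉′ 0<x)
  ... | no x≉0 = proj₂ (inverse x x≉0)

  private
    perturb₁ : ∀ a b → ∃[ ε ] (0# < ε × (∀ {δ} → 0# < δ → δ ≤ ε → 0# < a → 0# < a + δ * b))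
    perturb₁ a b with ≤-or-> 0# b | ≤-or-> a 0#
    ... | inj₁ 0≤b | _ = 1# , 0<1 , λ 0<δ _ 0<a → 0<+ˡ 0<a (*-nonNegative (<⇒≤ 0<δ) 0≤b)
    ... | inj₂ b<0 | inj₁ a≤0 = 1# , 0<1 , λ _ _ 0<a → contradiction a≤0 0<a
    -- With `r` = 1/(a - b), the bound a·r stays below the critical value a/(-b): a + δb is the
    -- positive number a·(a·r) plus the nonnegative number (a·r - δ)(-b).
    ... | inj₂ b<0 | inj₂ 0<a = a * r , *-positive 0<a 0<r , λ {δ} _ δ≤ε _ →
        <-respʳ-≈ (trans
          (solve 4 (λ a b y δ → a :* (a :* y) :+ (a :* y :- δ) :* (con (+ 0) :- b)
                              := a :* ((a :- b) :* y) :+ δ :* b) refl a b r δ)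
          (+-congʳ (trans (*-congˡ cr≈1) (*-identityʳ a))))
        (0<+ˡ (*-positive 0<a (*-positive 0<a 0<r))
              (*-nonNegative (x≤y⇒0≤y-x δ≤ε) (x≤y⇒0≤y-x (<⇒≤ b<0))))
      where
      inv = positive-inverse (x<y⇒0<y-x (<-trans b<0 0<a))
      r = proj₁ inv
      0<r = proj₁ (proj₂ inv)
      cr≈1 = proj₂ (proj₂ inv)

  perturbation : (ps : List (Carrier × Carrier)) →
    ∃[ ε ] (0# < ε × (∀ {δ} → 0# < δ → δ ≤ ε → ∀ {a b} → (a , b) ∈ ps → 0# < a → 0# < a + δ * b))
  perturbation [] = 1# , 0<1 , λ _ _ ()
  perturbation ((a , b) ∷ ps) with perturb₁ a b | perturbation ps
  ... | ε , 0<ε , good | ε′ , 0<ε′ , good′ with total ε ε′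
  ...   | inj₁ ε≤ε′ = ε , 0<ε , λ where
          0<δ δ≤ε (here ≡.refl) → good 0<δ δ≤ε
          0<δ δ≤ε (there p) → good′ 0<δ (≤-trans δ≤ε ε≤ε′) p
  ...   | inj₂ ε′≤ε = ε′ , 0<ε′ , λ where
          0<δ δ≤ε (here ≡.refl) → good 0<δ (≤-trans δ≤ε ε′≤ε)
          0<δ δ≤ε (there p) → good′ 0<δ δ≤ε p

-- Counting in finite lists, and a bound for graphs with common neighbours

module FiniteLists (em : ExcludedMiddle 0ℓ) where

  private variable
    A B : Set

  select : (A → Set) → List A → List A
  select P = filter (λ x → em {P = P x})

  ∈-select⁺ : ∀ (P : A → Set) {x xs} → x ∈ xs → P x → x ∈ select P xs
  ∈-select⁺ P = ∈-filter⁺ (λ x → em {P = P x})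

  ∈-select⁻ : ∀ (P : A → Set) xs {x} → x ∈ select P xs → x ∈ xs × P x
  ∈-select⁻ P xs = ∈-filter⁻ (λ x → em {P = P x}) {xs = xs}

  select-unique : ∀ (P : A → Set) {xs} → Unique xs → Unique (select P xs)
  select-unique P = Uniqueₚ.filter⁺ (λ x → em {P = P x})

  infixl 6 _∖_
  _∖_ : List A → List A → List A
  xs ∖ ys = select (_∉ ys) xs

  length-⊆ : {xs ys : List A} → Unique xs → xs ⊆ ys → length xs ℕ.≤ length ys
  length-⊆ {xs = []} _ _ = z≤n
  length-⊆ {xs = x ∷ xs} (x∉xs ∷ uxs) sub with ∈-∃++ (sub (here ≡.refl))
  ... | as , bs , ≡.refl = ≡.subst (suc (length xs) ℕ.≤_) (≡.sym (≡.trans (Listₚ.length-++ as)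
        (≡.trans (ℕₚ.+-suc _ _) (≡.cong suc (≡.sym (Listₚ.length-++ as)))))) (s≤s (length-⊆ uxs sub′))
    where
    sub′ : xs ⊆ as ++ bs
    sub′ y∈xs with ∈-++⁻ as (sub (there y∈xs))
    ... | inj₁ y∈as = ∈-++⁺ˡ y∈as
    ... | inj₂ (here y≡x) = contradiction (≡.sym y≡x) (All.lookup x∉xs y∈xs)
    ... | inj₂ (there y∈bs) = ∈-++⁺ʳ as y∈bs

  length-select-complement : ∀ (P : A → Set) xs → length (select P xs) ℕ.+ length (select (¬_ ∘ P) xs) ≡ length xs
  length-select-complement P [] = ≡.refl
  length-select-complement P (x ∷ xs) with em {P = P x} | em {P = ¬ P x}
  ... | yes p | yes ¬p = contradiction p ¬p
  ... | yes p | no _ = ≡.cong suc (length-select-complement P xs)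
  ... | no _ | yes _ = ≡.trans (ℕₚ.+-suc _ _) (≡.cong suc (length-select-complement P xs))
  ... | no ¬p | no ¬¬p = contradiction ¬p ¬¬p

  length-select+ : ∀ (P : A → Set) {xs ys} → Unique ys → ys ⊆ xs → (∀ {y} → y ∈ ys → ¬ P y) →
                   length (select P xs) ℕ.+ length ys ℕ.≤ length xs
  length-select+ P {xs} {ys} uys ys⊆xs ¬Pys = ≡.subst (length (select P xs) ℕ.+ length ys ℕ.≤_)
    (length-select-complement P xs)
    (ℕₚ.+-monoʳ-≤ (length (select P xs))
      (length-⊆ uys λ y∈ys → ∈-select⁺ (¬_ ∘ P) (ys⊆xs y∈ys) (¬Pys y∈ys)))

  length-∖ : ∀ {xs ys : List A} → Unique ys → ys ⊆ xs → length (xs ∖ ys) ℕ.+ length ys ℕ.≤ length xs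
  length-∖ {ys = ys} uys ys⊆xs = length-select+ (_∉ ys) uys ys⊆xs λ y∈ys y∉ys → y∉ys y∈ys

  length-∖-lower : ∀ {xs : List A} ys → Unique xs → length xs ℕ.≤ length (xs ∖ ys) ℕ.+ length ys
  length-∖-lower {xs = xs} ys uxs = ≡.subst (ℕ._≤ length (xs ∖ ys) ℕ.+ length ys)
    (length-select-complement (_∉ ys) xs)
    (ℕₚ.+-monoʳ-≤ (length (xs ∖ ys)) (length-⊆ (select-unique (λ x → ¬ (x ∉ ys)) uxs)
      λ x∈ → stable (proj₂ (∈-select⁻ (λ x → ¬ (x ∉ ys)) xs x∈))))
    where
    stable : {P : Set} → ¬ ¬ P → P
    stable {P} ¬¬p with em {P = P}
    ... | yes p = p
    ... | no ¬p = contradiction ¬p ¬¬p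

  escape : (P : A → Set) (xs : List A) → (∀ {x} → P x → x ∈ xs) ⊎ ∃[ x ] (P x × x ∉ xs)
  escape P xs with em {P = ∃[ x ] (P x × x ∉ xs)}
  ... | yes p = inj₂ p
  ... | no ¬p = inj₁ λ {x} Px → inside Px
    where
    inside : ∀ {x} → P x → x ∈ xs
    inside {x} Px with em {P = x ∈ xs}
    ... | yes x∈xs = x∈xs
    ... | no x∉xs = contradiction (x , Px , x∉xs) ¬p

  all-or-some : {P Q : A → Set} (xs : List A) → (∀ {x} → x ∈ xs → P x ⊎ Q x) →
                (∀ {x} → x ∈ xs → P x) ⊎ ∃[ x ] (x ∈ xs × Q x)
  all-or-some [] f = inj₁ λ ()
  all-or-some (x ∷ xs) f with f (here ≡.refl) | all-or-some xs (f ∘ there)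
  ... | inj₂ q | _ = inj₂ (x , here ≡.refl , q)
  ... | inj₁ _ | inj₂ (y , y∈xs , q) = inj₂ (y , there y∈xs , q)
  ... | inj₁ p | inj₁ ps = inj₁ λ where
        (here ≡.refl) → p
        (there y∈xs) → ps y∈xs

  ≢-first : ∀ {a c : A} {b d : B} → a ≢ c → (a , b) ≢ (c , d)
  ≢-first a≢c eq = a≢c (≡.cong proj₁ eq)

  ≢-second : ∀ {a c : A} {b d : B} → b ≢ d → (a , b) ≢ (c , d)
  ≢-second b≢d eq = b≢d (≡.cong proj₂ eq)

  pair≢ : ∀ {a b : A} → a ≢ b → Unique (a ∷ b ∷ [])
  pair≢ a≢b = (a≢b ∷ []) ∷ [] ∷ []

  -- Counting by charging: a pair determines its owner, so the blocks charged to different owners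
  -- are disjoint and their sizes add up.
  owned : ∀ {P : B → Set} (owner : B → A) k {ws} → Unique ws →
    (∀ {w} → w ∈ ws → ∃[ es ] (Unique es × length es ≡ k × (∀ {e} → e ∈ es → P e) × (∀ {e} → e ∈ es → owner e ≡ w))) →
    ∃[ es ] (Unique es × length es ≡ k ℕ.* length ws × (∀ {e} → e ∈ es → P e) × (∀ {e} → e ∈ es → owner e ∈ ws))
  owned owner k {[]} _ _ = [] , [] , ≡.sym (ℕₚ.*-zeroʳ k) , (λ ()) , λ ()
  owned owner k {w ∷ ws} (w∉ws ∷ uws) f with f (here ≡.refl) | owned owner k uws (f ∘ there)
  ... | es , ues , len , sub , own | es′ , ues′ , len′ , sub′ , own′ =
    es ++ es′ , Uniqueₚ.++⁺ ues ues′ disjoint ,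
    ≡.trans (Listₚ.length-++ es) (≡.trans (≡.cong₂ ℕ._+_ len len′) (≡.sym (ℕₚ.*-suc k (length ws)))) ,
    ([ sub , sub′ ]′ ∘ ∈-++⁻ es) ,
    ([ here ∘ own , there ∘ own′ ]′ ∘ ∈-++⁻ es)
    where
    disjoint : ∀ {e} → ¬ (e ∈ es × e ∈ es′)
    disjoint (e∈es , e∈es′) = All.lookup w∉ws (own′ e∈es′) (≡.sym (own e∈es))

  triangle : A → A → A → List (A × A)
  triangle p q r = (p , q) ∷ (q , p) ∷ (p , r) ∷ (r , p) ∷ (q , r) ∷ (r , q) ∷ []

  triangle-unique : ∀ {p q r : A} → p ≢ q → p ≢ r → q ≢ r → Unique (triangle p q r)
  triangle-unique p≢q p≢r q≢r =
    (≢-first p≢q ∷ ≢-second q≢r ∷ ≢-first p≢r ∷ ≢-first p≢q ∷ ≢-first p≢r ∷ []) ∷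
    (≢-first q≢p ∷ ≢-first q≢r ∷ ≢-second p≢r ∷ ≢-first q≢r ∷ []) ∷
    (≢-first p≢r ∷ ≢-first p≢q ∷ ≢-first p≢r ∷ []) ∷
    (≢-first r≢q ∷ ≢-second p≢q ∷ []) ∷
    (≢-first q≢r ∷ []) ∷ [] ∷ []
    where
    q≢p = p≢q ∘ ≡.sym
    r≢q = q≢r ∘ ≡.sym

  triangle-elim : ∀ {p q r : A} {P : A × A → Set} → P (p , q) → P (q , p) → P (p , r) → P (r , p) → P (q , r) → P (r , q) →
                  ∀ {e} → e ∈ triangle p q r → P e
  triangle-elim a b c d e f (here ≡.refl) = a
  triangle-elim a b c d e f (there (here ≡.refl)) = b
  triangle-elim a b c d e f (there (there (here ≡.refl))) = c
  triangle-elim a b c d e f (there (there (there (here ≡.refl)))) = d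
  triangle-elim a b c d e f (there (there (there (there (here ≡.refl))))) = e
  triangle-elim a b c d e f (there (there (there (there (there (here ≡.refl)))))) = f

  star : A → A → A → A → List (A × A)
  star c p q r = (c , p) ∷ (p , c) ∷ (c , q) ∷ (q , c) ∷ (c , r) ∷ (r , c) ∷ []

  star-unique : ∀ {c p q r : A} → c ≢ p → c ≢ q → c ≢ r → p ≢ q → p ≢ r → q ≢ r → Unique (star c p q r)
  star-unique c≢p c≢q c≢r p≢q p≢r q≢r =
    (≢-first c≢p ∷ ≢-second p≢q ∷ ≢-first c≢q ∷ ≢-second p≢r ∷ ≢-first c≢r ∷ []) ∷
    (≢-first p≢c ∷ ≢-first p≢q ∷ ≢-first p≢c ∷ ≢-first p≢r ∷ []) ∷
    (≢-first c≢q ∷ ≢-second q≢r ∷ ≢-first c≢r ∷ []) ∷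
    (≢-first q≢c ∷ ≢-first q≢r ∷ []) ∷
    (≢-first c≢r ∷ []) ∷ [] ∷ []
    where
    p≢c = c≢p ∘ ≡.sym
    q≢c = c≢q ∘ ≡.sym

  star-elim : ∀ {c p q r : A} {P : A × A → Set} → P (c , p) → P (p , c) → P (c , q) → P (q , c) → P (c , r) → P (r , c) →
              ∀ {e} → e ∈ star c p q r → P e
  star-elim a b c d e f (here ≡.refl) = a
  star-elim a b c d e f (there (here ≡.refl)) = b
  star-elim a b c d e f (there (there (here ≡.refl))) = c
  star-elim a b c d e f (there (there (there (here ≡.refl)))) = d
  star-elim a b c d e f (there (there (there (there (here ≡.refl))))) = e
  star-elim a b c d e f (there (there (there (there (there (here ≡.refl)))))) = f

  -- E lists both orientations of every edge.
  record Graph (I : List A) (E : List (A × A)) : Set₁ where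
    field
      Adj : A → A → Set
      adj-sym : ∀ {u v} → Adj u v → Adj v u
      adj-irrefl : ∀ {u v} → Adj u v → u ≢ v
      adj-∈ : ∀ {u v} → Adj u v → u ∈ I
      adj-edge : ∀ {u v} → Adj u v → (u , v) ∈ E

    adj-∈′ : ∀ {u v} → Adj u v → v ∈ I
    adj-∈′ = adj-∈ ∘ adj-sym

    AdjacentWithin : A → A → A → Set
    AdjacentWithin v p q = Adj v p × Adj v q × Adj p q × (∀ {w} → Adj v w → w ∈ p ∷ q ∷ [])

    ThreeNeighbours : A → Set
    ThreeNeighbours v = ∃[ p ] ∃[ q ] ∃[ r ] (Adj v p × Adj v q × Adj v r × p ≢ q × p ≢ r × q ≢ r)

    CommonNeighbours : Set
    CommonNeighbours = ∀ {u v} → u ∈ I → v ∈ I → u ≢ v → ∃[ w ] (Adj u w × Adj v w)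

    module DegreeTwo (common : CommonNeighbours) {v p q} (vI : v ∈ I) (within : AdjacentWithin v p q) where
      private
        v~p = proj₁ within
        v~q = proj₁ (proj₂ within)
        p~q = proj₁ (proj₂ (proj₂ within))
        nbrs = proj₂ (proj₂ (proj₂ within))

      spoke : ∀ {w} → w ∈ I ∖ (v ∷ p ∷ q ∷ []) → ∃[ s ] (s ∈ p ∷ q ∷ [] × Adj w s)
      spoke {w} w∈ with ∈-select⁻ (_∉ v ∷ p ∷ q ∷ []) I w∈
      ... | wI , w∉ with common wI vI (λ w≡v → w∉ (here w≡v))
      ... | s , w~s , v~s = s , nbrs v~s , w~s

    -- If all degrees are at least three, the pairs starting at each vertex suffice. Otherwise some
    -- `v` has exactly the neighbours `p` and `q`. Any other vertex `w` has a common neighbour with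
    -- `v`, hence is joined to `p` or `q` by a spoke, and it pays for both orientations of the spoke
    -- and one of a second edge. With the six pairs of the triangle this makes 6 + 3(n - 3) = 3(n -
    -- 1).
    friendship : Unique I → CommonNeighbours → 3 ℕ.* (length I ℕ.∸ 1) ℕ.≤ length E
    friendship uI common with small? I
      where
      small? : ∀ xs → length xs ℕ.≤ 1 ⊎ 2 ℕ.≤ length xs
      small? [] = inj₁ z≤n
      small? (_ ∷ []) = inj₁ (s≤s z≤n)
      small? (_ ∷ _ ∷ _) = inj₂ (s≤s (s≤s z≤n))
    ... | inj₁ len≤1 = ≡.subst (ℕ._≤ length E) (≡.sym (≡.cong (3 ℕ.*_) (ℕₚ.m≤n⇒m∸n≡0 len≤1))) z≤n
    ... | inj₂ 2≤len with all-or-some I classify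
      where
      other : ∀ {xs : List A} → Unique xs → 2 ℕ.≤ length xs → ∀ v → ∃[ w ] (w ∈ xs × v ≢ w)
      other {x ∷ []} _ (s≤s ()) v
      other {x ∷ y ∷ xs} ((x≢y ∷ _) ∷ _) _ v with em {P = v ≡ x}
      ... | yes ≡.refl = y , there (here ≡.refl) , x≢y
      ... | no v≢x = x , here ≡.refl , v≢x
      classify : ∀ {v} → v ∈ I → ThreeNeighbours v ⊎ ∃[ p ] ∃[ q ] AdjacentWithin v p q
      classify {v} vI with other uI 2≤len v
      ... | w , wI , v≢w with common vI wI v≢w
      ... | p , v~p , _ with common vI (adj-∈′ v~p) (adj-irrefl v~p)
      ... | q , v~q , p~q with escape (Adj v) (p ∷ q ∷ [])
      ... | inj₁ within = inj₂ (p , q , v~p , v~q , p~q , within)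
      ... | inj₂ (r , v~r , r∉) = inj₁ (p , q , r , v~p , v~q , v~r , adj-irrefl p~q ,
              (λ p≡r → r∉ (here (≡.sym p≡r))) , λ q≡r → r∉ (there (here (≡.sym q≡r))))
    ... | inj₁ three = ℕₚ.≤-trans (ℕₚ.*-monoʳ-≤ 3 (ℕₚ.m∸n≤m (length I) 1))
            (ℕₚ.≤-trans (ℕₚ.≤-reflexive (≡.sym (proj₁ (proj₂ (proj₂ list)))))
              (length-⊆ (proj₁ (proj₂ list)) (proj₁ (proj₂ (proj₂ (proj₂ list))))))
      where
      list = owned {P = _∈ E} proj₁ 3 uI λ {v} vI → let (p , q , r , v~p , v~q , v~r , p≢q , p≢r , q≢r) = three vI in
        (v , p) ∷ (v , q) ∷ (v , r) ∷ [] ,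
        (≢-second p≢q ∷ ≢-second p≢r ∷ []) ∷ (≢-second q≢r ∷ []) ∷ [] ∷ [] , ≡.refl ,
        (λ { (here ≡.refl) → adj-edge v~p ; (there (here ≡.refl)) → adj-edge v~q
           ; (there (there (here ≡.refl))) → adj-edge v~r }) ,
        λ { (here ≡.refl) → ≡.refl ; (there (here ≡.refl)) → ≡.refl ; (there (there (here ≡.refl))) → ≡.refl }
    ... | inj₂ (v , vI , p , q , within@(v~p , v~q , p~q , _)) = ℕₚ.≤-trans bound
            (ℕₚ.≤-trans (ℕₚ.≤-reflexive (≡.sym (≡.cong (6 ℕ.+_) (proj₁ (proj₂ (proj₂ list))))))
              (length-⊆ all-unique all-⊆))
      where
      open DegreeTwo common vI within
      S = v ∷ p ∷ q ∷ []
      -- A spoke is charged in both orientations to its end outside `p`, `q`. A pair between two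
      -- outer vertices is charged to its first entry, so the reverse pair stays available to the
      -- other end.
      owner : A × A → A
      owner (x , y) with em {P = x ∈ p ∷ q ∷ []}
      ... | yes _ = y
      ... | no _ = x
      owner-in : ∀ {x y} → x ∈ p ∷ q ∷ [] → owner (x , y) ≡ y
      owner-in {x} x∈ with em {P = x ∈ p ∷ q ∷ []}
      ... | yes _ = ≡.refl
      ... | no x∉ = contradiction x∈ x∉
      owner-out : ∀ {x y} → x ∉ p ∷ q ∷ [] → owner (x , y) ≡ x
      owner-out {x} x∉ with em {P = x ∈ p ∷ q ∷ []}
      ... | yes x∈ = contradiction x∈ x∉
      ... | no _ = ≡.refl
      list = owned {P = _∈ E} owner 3 (select-unique (_∉ S) uI) edges
        where
        edges : ∀ {w} → w ∈ I ∖ S → ∃[ es ] (Unique es × length es ≡ 3 × es ⊆ E × (∀ {e} → e ∈ es → owner e ≡ w))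
        edges {w} w∈ with spoke w∈
        ... | s , s∈ , w~s with common (adj-∈ w~s) (adj-∈′ w~s) (adj-irrefl w~s)
        ... | t , w~t , s~t =
          (w , s) ∷ (s , w) ∷ (w , t) ∷ [] ,
          (≢-first (adj-irrefl w~s) ∷ ≢-second (adj-irrefl s~t) ∷ []) ∷
            (≢-first (adj-irrefl (adj-sym w~s)) ∷ []) ∷ [] ∷ [] ,
          ≡.refl ,
          (λ { (here ≡.refl) → adj-edge w~s ; (there (here ≡.refl)) → adj-edge (adj-sym w~s)
             ; (there (there (here ≡.refl))) → adj-edge w~t }) ,
          λ { (here ≡.refl) → owner-out w∉ ; (there (here ≡.refl)) → owner-in s∈
            ; (there (there (here ≡.refl))) → owner-out w∉ }
          where
          w∉ : w ∉ p ∷ q ∷ []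
          w∉ = proj₂ (∈-select⁻ (_∉ S) I w∈) ∘ there
      T = triangle v p q
      owner-S : ∀ {e} → e ∈ T → owner e ∈ S
      owner-S = triangle-elim {P = λ e → owner e ∈ S}
        (own (here ≡.refl) (there (here ≡.refl))) (own (there (here ≡.refl)) (here ≡.refl))
        (own (here ≡.refl) (there (there (here ≡.refl)))) (own (there (there (here ≡.refl))) (here ≡.refl))
        (own (there (here ≡.refl)) (there (there (here ≡.refl)))) (own (there (there (here ≡.refl))) (there (here ≡.refl)))
        where
        own : ∀ {x y} → x ∈ S → y ∈ S → owner (x , y) ∈ S
        own {x} x∈ y∈ with em {P = x ∈ p ∷ q ∷ []}
        ... | yes _ = y∈
        ... | no _ = x∈
      all-unique : Unique (T ++ proj₁ list)
      all-unique = Uniqueₚ.++⁺ (triangle-unique (adj-irrefl v~p) (adj-irrefl v~q) (adj-irrefl p~q)) (proj₁ (proj₂ list))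
        λ (e∈T , e∈list) → proj₂ (∈-select⁻ (_∉ S) I (proj₂ (proj₂ (proj₂ (proj₂ list))) e∈list)) (owner-S e∈T)
      all-⊆ : T ++ proj₁ list ⊆ E
      all-⊆ = [ triangle-elim {P = _∈ E} (adj-edge v~p) (adj-edge (adj-sym v~p)) (adj-edge v~q) (adj-edge (adj-sym v~q))
                  (adj-edge p~q) (adj-edge (adj-sym p~q)) , proj₁ (proj₂ (proj₂ (proj₂ list))) ]′ ∘ ∈-++⁻ T
      bound : 3 ℕ.* (length I ℕ.∸ 1) ℕ.≤ 6 ℕ.+ 3 ℕ.* length (I ∖ S)
      bound = ℕₚ.≤-trans (ℕₚ.*-monoʳ-≤ 3 (ℕₚ.∸-monoˡ-≤ 1 (≡.subst (length I ℕ.≤_) (ℕₚ.+-comm _ 3) (length-∖-lower S uI))))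
        (ℕₚ.≤-reflexive (ℕₚ.*-distribˡ-+ 3 2 (length (I ∖ S))))

-- Functionals as functions of the index, their perturbation and general position

module Values (em : ExcludedMiddle 0ℓ) (ℝ : Reals) (A : Set) where
  open OrderedField em ℝ
  open FiniteLists em

  Fn : Set
  Fn = A → Carrier

  comb : Carrier → Fn → Carrier → Fn → Fn
  comb s f t g i = s * f i + t * g i

  record Subspace : Set₁ where
    field
      _∋_ : Fn → Set
      combine : ∀ {f g} s t → _∋_ f → _∋_ g → _∋_ (comb s f t g)
  open Subspace public

  private variable
    f g f′ : Fn
    i j : A
    I : List A

  abstract
    comb-cong : ∀ {a b} s t → f a ≈ f b → g a ≈ g b → comb s f t g a ≈ comb s f t g b
    comb-cong s t p q = +-cong (*-congˡ p) (*-congˡ q)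

  restrict : Subspace → A → A → Subspace
  restrict W a b ._∋_ f = W ∋ f × f a ≈ f b
  restrict W a b .combine {f} {g} s t (Wf , p) (Wg , q) = W .combine s t Wf Wg , comb-cong {f} {g} s t p q

  -- Written as a combination of two terms so that `combine` yields membership directly; `_∋_` is
  -- not assumed to respect pointwise equality.
  opposite : Fn → Fn
  opposite f = comb (- 1#) f 0# f

  opposite≈ : ∀ f i → opposite f i ≈ - f i
  opposite≈ f i = solve 1 (λ x → (:- con (+ 1)) :* x :+ con (+ 0) :* x := :- x) refl (f i)

  opposite-∈ : ∀ W → W ∋ f → W ∋ opposite f
  opposite-∈ W Wf = W .combine _ _ Wf Wf

  opposite-≤ : f i ≤ f j → opposite f j ≤ opposite f i
  opposite-≤ {f} p = ≤-respˡ-≈ (sym (opposite≈ f _)) (≤-respʳ-≈ (sym (opposite≈ f _)) (neg-mono-≤ p))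

  opposite-≤⁻ : opposite f j ≤ opposite f i → f i ≤ f j
  opposite-≤⁻ {f} p = neg-cancel-≤ (≤-respˡ-≈ (opposite≈ f _) (≤-respʳ-≈ (opposite≈ f _) p))

  opposite-< : f i < f j → opposite f j < opposite f i
  opposite-< {f} p q = p (opposite-≤⁻ {f} q)

  opposite-≈ : f i ≈ f j → opposite f i ≈ opposite f j
  opposite-≈ p = +-cong (*-congˡ p) (*-congˡ p)

  opposite-≈⁻ : opposite f i ≈ opposite f j → f i ≈ f j
  opposite-≈⁻ {f} p = antisym (opposite-≤⁻ {f} (≈⇒≤ (sym p))) (opposite-≤⁻ {f} (≈⇒≤ p))

  NonConstant : List A → Fn → Set
  NonConstant I f = ∃[ i ] ∃[ j ] (i ∈ I × j ∈ I × f i < f j)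

  opposite-nonConstant : NonConstant I f → NonConstant I (opposite f)
  opposite-nonConstant {f = f} (i , j , iI , jI , p) = j , i , jI , iI , opposite-< {f} p

  IsMax IsMin StrictMax StrictMin : List A → Fn → A → Set
  IsMax I f i = ∀ {l} → l ∈ I → f l ≤ f i
  IsMin I f i = ∀ {l} → l ∈ I → f i ≤ f l
  StrictMax I f i = ∀ {l} → l ∈ I → l ≢ i → f l < f i
  StrictMin I f i = ∀ {l} → l ∈ I → l ≢ i → f i < f l

  opposite-strictMin : ∀ f → StrictMin I f i → StrictMax I (opposite f) i
  opposite-strictMin f smin lI l≢i = opposite-< {f} (smin lI l≢i)

  opposite-strictMax : ∀ f → StrictMax I f i → StrictMin I (opposite f) i
  opposite-strictMax f smax lI l≢i = opposite-< {f} (smax lI l≢i)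

  constant-extreme : IsMax I f i → IsMin I f j → f i ≤ f j → ¬ NonConstant I f
  constant-extreme max min fi≤fj (_ , _ , pI , qI , p<q) = p<q (≤-trans (max qI) (≤-trans fi≤fj (min pI)))

  strict⇒max : StrictMax I f i → IsMax I f i
  strict⇒max {i = i} smax {l} lI with em {P = l ≡ i}
  ... | yes ≡.refl = ≤-refl
  ... | no l≢i = <⇒≤ (smax lI l≢i)

  strict⇒min : StrictMin I f i → IsMin I f i
  strict⇒min {i = i} smin {l} lI with em {P = l ≡ i}
  ... | yes ≡.refl = ≤-refl
  ... | no l≢i = <⇒≤ (smin lI l≢i)

  maximum : ∀ f → i ∈ I → ∃[ m ] (m ∈ I × IsMax I f m)
  maximum {I = x ∷ []} f _ = x , here ≡.refl , λ { (here ≡.refl) → ≤-refl }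
  maximum {I = x ∷ I@(_ ∷ _)} f _ with maximum {I = I} f (here ≡.refl)
  ... | m , mI , max with total (f x) (f m)
  ...   | inj₁ x≤m = m , there mI , λ { (here ≡.refl) → x≤m ; (there lI) → max lI }
  ...   | inj₂ m≤x = x , here ≡.refl , λ { (here ≡.refl) → ≤-refl ; (there lI) → ≤-trans (max lI) m≤x }

  minimum : ∀ f → i ∈ I → ∃[ m ] (m ∈ I × IsMin I f m)
  minimum f iI with maximum (opposite f) iI
  ... | m , mI , max = m , mI , λ lI → opposite-≤⁻ {f} (max lI)

  record LinearForm : Set where
    field
      app : Fn → Carrier
      linear : ∀ s f t g → app (comb s f t g) ≈ s * app f + t * app g
  open LinearForm public

  abstract
    difference-linear : ∀ i j s f t g →
      comb s f t g j - comb s f t g i ≈ s * (f j - f i) + t * (g j - g i)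
    difference-linear i j s f t g = solve 6 (λ s fi fj t gi gj → s :* fj :+ t :* gj :- (s :* fi :+ t :* gi) := s :* (fj :- fi) :+ t :* (gj :- gi))
      refl s (f i) (f j) t (g i) (g j)

  difference : A → A → LinearForm
  difference i j .app f = f j - f i
  difference i j .linear = difference-linear i j

  SignPreserved : List LinearForm → Fn → Fn → Set
  SignPreserved Φ f f′ = ∀ {φ} → φ ∈ Φ → (0# < app φ f → 0# < app φ f′) × (app φ f < 0# → app φ f′ < 0#)

  abstract
    -- A negative value is a positive value of the negated form, so both kinds of sign are instances
    -- of `perturbation`.
    nudge : ∀ Φ f g → ∃[ ε ] (0# < ε × SignPreserved Φ f (comb 1# f ε g))
    nudge Φ f g with perturbation (map (λ φ → app φ f , app φ g) Φ ++ map (λ φ → - app φ f , - app φ g) Φ)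
    ... | ε , 0<ε , good = ε , 0<ε , λ {φ} φ∈ →
        (λ 0<φf → <-respʳ-≈ (trans (+-congʳ (sym (*-identityˡ _))) (sym (linear φ 1# f ε g)))
                    (good 0<ε ≤-refl (∈-++⁺ˡ (∈-map⁺ _ φ∈)) 0<φf)) ,
        λ φf<0 → λ 0≤φ → good 0<ε ≤-refl (∈-++⁺ʳ (map (λ φ → app φ f , app φ g) Φ) (∈-map⁺ (λ φ → - app φ f , - app φ g) φ∈))
            (<-respˡ-≈ -0≈0 (neg-mono-< φf<0))
            (≤-respˡ-≈ (trans (-‿cong (linear φ 1# f ε g))
               (solve 3 (λ x ε y → :- (con (+ 1) :* x :+ ε :* y) := :- x :+ ε :* :- y) refl (app φ f) ε (app φ g)))
              (≤-respʳ-≈ -0≈0 (neg-mono-≤ 0≤φ)))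
      where
      -0≈0 : - 0# ≈ 0#
      -0≈0 = solve 0 (:- con (+ 0) := con (+ 0)) refl

  Refines : List A → Fn → Fn → Set
  Refines I f f′ = ∀ {i j} → i ∈ I → j ∈ I → f i < f j → f′ i < f′ j

  differences : List A → List LinearForm
  differences I = map (λ (i , j) → difference i j) (cartesianProduct I I)

  difference-∈ : i ∈ I → j ∈ I → difference i j ∈ differences I
  difference-∈ iI jI = ∈-map⁺ _ (∈-cartesianProduct⁺ iI jI)

  signs⇒refines : ∀ {Φ} → differences I ⊆ Φ → SignPreserved Φ f f′ → Refines I f f′
  signs⇒refines sub signs iI jI fi<fj = 0<y-x⇒x<y (proj₁ (signs (sub (difference-∈ iI jI))) (x<y⇒0<y-x fi<fj))

  refines-≤ : Refines I f f′ → i ∈ I → j ∈ I → f′ i ≤ f′ j → f i ≤ f j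
  refines-≤ {f = f} {i = i} {j = j} ref iI jI p with ≤-or-> (f i) (f j)
  ... | inj₁ fi≤fj = fi≤fj
  ... | inj₂ fj<fi = contradiction p (ref jI iI fj<fi)

  refines-nonConstant : Refines I f f′ → NonConstant I f → NonConstant I f′
  refines-nonConstant ref (p , q , pI , qI , p<q) = p , q , pI , qI , ref pI qI p<q

  -- The order by `f`, with ties decided by `g`; it is realised by f + εg for small ε.
  record Lexicographic (I : List A) (f g f′ : Fn) : Set where
    field
      refines : Refines I f f′
      breaksTies : i ∈ I → j ∈ I → f i ≤ f j → g i < g j → f′ i < f′ j
      keepsTies : f i ≈ f j → g i ≈ g j → f′ i ≈ f′ j
  open Lexicographic public

  abstract
    lexicographic : ∀ I W → W ∋ f → W ∋ g → ∃[ f′ ] (W ∋ f′ × Lexicographic I f g f′)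
    lexicographic {f} {g} I W Wf Wg = let (ε , 0<ε , signs) = nudge (differences I) f g
                                          ref = signs⇒refines (λ x → x) signs in
      comb 1# f ε g , W .combine 1# ε Wf Wg , record
        { refines = ref
        ; breaksTies = λ iI jI p q → [ ref iI jI , tie ε 0<ε q ]′ (≤-cases p)
        ; keepsTies = λ p q → +-cong (*-congˡ p) (*-congˡ q) }
      where
      tie : ∀ ε → 0# < ε → g i < g j → f i ≈ f j → comb 1# f ε g i < comb 1# f ε g j
      tie {i} {j} ε 0<ε gi<gj fi≈fj q = *-monoʳ-< 0<ε gi<gj (0≤y-x⇒x≤y (≤-respʳ-≈
        (trans (solve 5 (λ x y ε u v → con (+ 1) :* x :+ ε :* u :- (con (+ 1) :* y :+ ε :* v) := ε :* u :- ε :* v :+ (x :- y))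
                  refl (f i) (f j) ε (g i) (g j))
               (trans (+-congˡ (x≈y⇒x-y≈0 fi≈fj)) (+-identityʳ _)))
        (x≤y⇒0≤y-x q)))

  VanishesOn : Subspace → LinearForm → Set
  VanishesOn W φ = ∀ {g} → W ∋ g → app φ g ≈ 0#

  -- `f` avoids every hyperplane that a form of `Φ` cuts out in `W`; a form that vanishes on all of
  -- `W` cuts out none.
  Generic : List LinearForm → Subspace → Fn → Set
  Generic Φ W f = ∀ {φ} → φ ∈ Φ → app φ f ≈ 0# → VanishesOn W φ

  sign-zero : ∀ {Φ φ} → SignPreserved Φ f f′ → φ ∈ Φ → app φ f′ ≈ 0# → app φ f ≈ 0#
  sign-zero {f = f} {φ = φ} signs φ∈ φf′≈0 with em {P = app φ f ≈ 0#}
  ... | yes p = p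
  ... | no p = contradiction φf′≈0 ([ <⇒≉ ∘ proj₂ (signs φ∈) , <⇒≉′ ∘ proj₁ (signs φ∈) ]′ (≉-cases p))

  abstract
    nudge-off : ∀ {Φ ψ} W → ψ ∈ Φ → ¬ VanishesOn W ψ → W ∋ f →
                ∃[ f′ ] (W ∋ f′ × SignPreserved Φ f f′ × ¬ (app ψ f′ ≈ 0#))
    nudge-off {f} {Φ} {ψ} W ψ∈ ¬van Wf with em {P = ∃[ g ] (W ∋ g × ¬ (app ψ g ≈ 0#))}
    ... | no none = contradiction (λ {g} Wg → [ (λ p → p) , (λ p → contradiction (g , Wg , p) none) ]′ (decide g)) ¬van
      where
      decide : ∀ g → app ψ g ≈ 0# ⊎ ¬ (app ψ g ≈ 0#)
      decide g with em {P = app ψ g ≈ 0#}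
      ... | yes p = inj₁ p
      ... | no p = inj₂ p
    ... | yes (g , Wg , ψg≉0) = let (ε , 0<ε , signs) = nudge Φ f g in
      comb 1# f ε g , W .combine 1# ε Wf Wg , signs , λ ψf′≈0 → ψg≉0 (*-zero-cancel (<⇒≉′ 0<ε)
        (trans (sym (trans (linear ψ 1# f ε g)
          (trans (+-congʳ (trans (*-congˡ (sign-zero {f = f} signs ψ∈ ψf′≈0)) (zeroʳ 1#))) (+-identityˡ _)))) ψf′≈0))

    -- The forms are treated one at a time. A nudge off the zero set of one form keeps all nonzero
    -- signs, so the forms treated before stay nonzero.
    generic : ∀ Φ W → W ∋ f → ∃[ f′ ] (W ∋ f′ × SignPreserved Φ f f′ × Generic Φ W f′)
    generic {f} Φ W Wf = go Φ (λ x → x)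
      where
      go : ∀ Ψ → Ψ ⊆ Φ → ∃[ f′ ] (W ∋ f′ × SignPreserved Φ f f′ × Generic Ψ W f′)
      go [] _ = f , Wf , (λ _ → (λ x → x) , λ x → x) , λ ()
      go (ψ ∷ Ψ) sub with em {P = VanishesOn W ψ}
      ... | yes van = let (f₁ , Wf₁ , signs , gen) = go Ψ (sub ∘ there) in
        f₁ , Wf₁ , signs , λ { (here ≡.refl) _ → van ; (there p) → gen p }
      ... | no ¬van = let (f₁ , Wf₁ , signs , gen) = go Ψ (sub ∘ there)
                          (f₂ , Wf₂ , signs′ , off) = nudge-off W (sub (here ≡.refl)) ¬van Wf₁ in
        f₂ , Wf₂ , (λ φ∈ → proj₁ (signs′ φ∈) ∘ proj₁ (signs φ∈) , proj₂ (signs′ φ∈) ∘ proj₂ (signs φ∈)) ,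
        λ { (here ≡.refl) ψf₂≈0 → contradiction ψf₂≈0 off
          ; (there p) φf₂≈0 → gen p (sign-zero {f = f₁} signs′ (sub (there p)) φf₂≈0) }

  GenericOn : List A → Subspace → Fn → Set
  GenericOn I W f = ∀ {i j} → i ∈ I → j ∈ I → f i ≈ f j → ∀ {g} → W ∋ g → g i ≈ g j

  abstract
    -- Genericity for the differences of values: two points tie only if no functional in `W`
    -- separates them.
    genericOn : ∀ I W → W ∋ f → ∃[ f′ ] (W ∋ f′ × Refines I f f′ × GenericOn I W f′)
    genericOn I W Wf with generic (differences I) W Wf
    ... | f′ , Wf′ , signs , gen = f′ , Wf′ , signs⇒refines (λ x → x) signs ,
          λ iI jI p Wg → sym (x-y≈0⇒x≈y (gen (difference-∈ iI jI) (x≈y⇒x-y≈0 (sym p)) Wg))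

-- Covers, rank and the statement proved by induction

module Claims (em : ExcludedMiddle 0ℓ) (ℝ : Reals) (A : Set) where
  open OrderedField em ℝ
  open FiniteLists em
  open Values em ℝ A

  private variable
    f h f′ : Fn
    i j l a b p q : A
    I J : List A
    E : List (A × A)

  Respects : Fn → List (A × A) → Set
  Respects f C = ∀ {a b} → (a , b) ∈ C → f a ≈ f b

  -- For functionals on points, this says that their affine hull has dimension at least d.
  Rank : List A → Subspace → ℕ → Set
  Rank I W d = ∀ C → length C ℕ.< d → ∃[ f ] (W ∋ f × Respects f C × NonConstant I f)

  -- When W consists of all linear functionals on points with hull P and J = I, such an E
  -- contains a pair (i , j) for every vertex xᵢ - xⱼ of P - P.
  Covers : List A → List A → Subspace → List (A × A) → Set
  Covers I J W E = ∀ {f} → W ∋ f → NonConstant I f →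
    ∃[ i ] ∃[ j ] ((i , j) ∈ E × i ∈ J × j ∈ J × IsMax I f i × IsMin I f j)

  abstract
    -- The covering pair takes the extreme values over `I` and lies in `J`. This is what lets the
    -- rank pass from `I` to `J`.
    covers-nonConstant : ∀ W → Covers I J W E → W ∋ f → NonConstant I f → NonConstant J f
    covers-nonConstant W cov Wf nc@(p , q , pI , qI , p<q) with cov Wf nc
    ... | i , j , _ , iJ , jJ , max , min = j , i , jJ , iJ , ≤-<-trans (min pI) (<-≤-trans p<q (max qI))

  abstract
    covers-⊆ : ∀ W → J ⊆ I → Covers I J W E → Covers J J W E
    covers-⊆ W J⊆I cov Wf (p , q , pJ , qJ , p<q) with cov Wf (p , q , J⊆I pJ , J⊆I qJ , p<q)
    ... | i , j , e , iJ , jJ , max , min = i , j , e , iJ , jJ , max ∘ J⊆I , min ∘ J⊆I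

  abstract
    rank-covers : ∀ W {d} → Covers I J W E → Rank I W d → Rank J W d
    rank-covers W cov rank C len with rank C len
    ... | f , Wf , resp , nc = f , Wf , resp , covers-nonConstant W cov Wf nc

  abstract
    rank-restrict : ∀ W {d} a b → Rank I W (suc d) → Rank I (restrict W a b) d
    rank-restrict W a b rank C len with rank ((a , b) ∷ C) (s≤s len)
    ... | f , Wf , resp , nc = f , (Wf , resp (here ≡.refl)) , resp ∘ there , nc

  abstract
    -- With at most d + 1 points, at most d equations between the first point and the others would
    -- force constancy.
    rank-size : ∀ W {d} → Rank I W (suc d) → suc (suc d) ℕ.≤ length I
    rank-size {I = I} W {d} rank with suc (suc d) ℕₚ.≤? length I
    ... | yes p = p
    ... | no ¬p = contradiction (ℕₚ.≤-pred (ℕₚ.≰⇒> ¬p)) (tooSmall I rank)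
      where
      tooSmall : ∀ I → Rank I W (suc d) → ¬ (length I ℕ.≤ suc d)
      tooSmall [] rank _ with rank [] (s≤s z≤n)
      ... | _ , _ , _ , (_ , _ , () , _)
      tooSmall (x ∷ xs) rank (s≤s len) with rank (map (x ,_) xs) (s≤s (≡.subst (ℕ._≤ d) (≡.sym (Listₚ.length-map (x ,_) xs)) len))
      ... | f , _ , resp , (p , q , pI , qI , p<q) = <⇒≉ p<q (trans (sym (equal pI)) (equal qI))
        where
        equal : ∀ {y} → y ∈ x ∷ xs → f x ≈ f y
        equal (here ≡.refl) = refl
        equal (there y∈) = resp (∈-map⁺ (x ,_) y∈)

  -- The length condition is n ≤ 2d - 1. The factor is 6 and not 3 because `E` consists of ordered
  -- pairs.
  Claim : ℕ → Set₁
  Claim d = ∀ {I E} W → Unique I → Rank I W d → suc (length I) ℕ.≤ 2 ℕ.* d → Covers I I W E →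
            6 ℕ.* (d ℕ.∸ 1) ℕ.≤ length E

  Exposed : List A → Subspace → A → Set
  Exposed I W p = ∃[ e ] (W ∋ e × StrictMax I e p)

  -- As far as W can tell, the line pq is parallel to the line ab, or p and q coincide.
  Parallel : Subspace → A → A → A → A → Set
  Parallel W a b p q = ∀ {g} → W ∋ g → g a ≈ g b → g p ≈ g q

  abstract
    -- Subtracting from `g` the multiple of `h` that equalises the values at `a` and `b` leaves a
    -- member of `W` with equal values at `p` and `q`. So `c` is the ratio that `h` measures.
    parallel-ratio : ∀ W → W ∋ h → h b < h a → Parallel W a b p q →
                     ∃[ c ] (∀ {g} → W ∋ g → g p - g q ≈ c * (g a - g b))
    parallel-ratio {h = h} {b = b} {a = a} {p = p} {q = q} W Wh hb<ha par = (h p - h q) * r , ratio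
      where
      r : Carrier
      r = reciprocal (h a - h b)
      ratio : ∀ {g} → W ∋ g → g p - g q ≈ (h p - h q) * r * (g a - g b)
      ratio {g} Wg = x-y≈0⇒x≈y (trans
        (solve 6 (λ gp gq hp hq r t → gp :- gq :- (hp :- hq) :* r :* t :=
            con (+ 1) :* gp :+ (:- (t :* r)) :* hp :- (con (+ 1) :* gq :+ (:- (t :* r)) :* hq))
          refl (g p) (g q) (h p) (h q) r (g a - g b))
        (x≈y⇒x-y≈0 (par (W .combine 1# (- ((g a - g b) * r)) Wg Wh) (x-y≈0⇒x≈y (trans
          (solve 5 (λ ga gb ha hb r → con (+ 1) :* ga :+ (:- ((ga :- gb) :* r)) :* ha
                :- (con (+ 1) :* gb :+ (:- ((ga :- gb) :* r)) :* hb)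
              := (ga :- gb) :- (ga :- gb) :* ((ha :- hb) :* r))
            refl (g a) (g b) (h a) (h b) r)
          (x≈y⇒x-y≈0 (sym (trans (*-congˡ (*-reciprocal (x<y⇒0<y-x hb<ha))) (*-identityʳ _)))))))))

  -- Strictly antipodal pairs when every point is exposed

  module Strict {I : List A} {E : List (A × A)} (W : Subspace) (uI : Unique I)
    (covers : Covers I I W E) (exposed : ∀ {p} → p ∈ I → Exposed I W p) where

    -- The strictly antipodal pairs, with W in the role of the space of all functionals.
    record G (i j : A) : Set where
      constructor antipodal
      field
        {functional} : Fn
        in-W : W ∋ functional
        first-∈ : i ∈ I
        second-∈ : j ∈ I
        distinct : i ≢ j
        isMax : StrictMax I functional i
        isMin : StrictMin I functional j
    open G

    G-sym : G i j → G j i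
    G-sym (antipodal {f} Wf iI jI i≢j max min) = antipodal (opposite-∈ W Wf) jI iI (i≢j ∘ ≡.sym)
      (λ lI l≢j → opposite-< {f} (min lI l≢j)) (λ lI l≢i → opposite-< {f} (max lI l≢i))

    abstract
      -- Strict extremes are the only extremes of their functional, so this is the pair that `E`
      -- must supply for it.
      G-edge : G i j → (i , j) ∈ E
      G-edge {i} {j} (antipodal {f} Wf iI jI i≢j max min) with covers Wf (j , i , jI , iI , max jI (i≢j ∘ ≡.sym))
      ... | i′ , j′ , e , i′I , j′I , max′ , min′ with em {P = i′ ≡ i} | em {P = j′ ≡ j}
      ...   | no i′≢i | _ = contradiction (max′ iI) (max i′I i′≢i)
      ...   | yes ≡.refl | no j′≢j = contradiction (min′ jI) (min j′I j′≢j)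
      ...   | yes ≡.refl | yes ≡.refl = e

    abstract
      exposeMax : W ∋ f → i ∈ I → IsMax I f i → ∃[ f′ ] (W ∋ f′ × Refines I f f′ × StrictMax I f′ i)
      exposeMax Wf iI max with exposed iI
      ... | e , We , emax with lexicographic I W Wf We
      ... | f′ , Wf′ , lex = f′ , Wf′ , lex .refines , λ lI l≢i → lex .breaksTies lI iI (max lI) (emax lI l≢i)

    abstract
      exposeMin : W ∋ f → i ∈ I → IsMin I f i → ∃[ f′ ] (W ∋ f′ × Refines I f f′ × StrictMin I f′ i)
      exposeMin Wf iI min with exposed iI
      ... | e , We , emax with lexicographic I W Wf (opposite-∈ W We)
      ... | f′ , Wf′ , lex = f′ , Wf′ , lex .refines ,
            λ lI l≢i → lex .breaksTies iI lI (min lI) (opposite-< {e} (emax lI l≢i))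

    refines-strictMax : Refines I f f′ → i ∈ I → StrictMax I f i → StrictMax I f′ i
    refines-strictMax ref iI max lI l≢i = ref lI iI (max lI l≢i)

    refines-strictMin : Refines I f f′ → i ∈ I → StrictMin I f i → StrictMin I f′ i
    refines-strictMin ref iI min lI l≢i = ref iI lI (min lI l≢i)

    refines-min : Refines I f f′ → i ∈ I → IsMin I f′ i → IsMin I f i
    refines-min ref iI min lI = refines-≤ ref iI lI (min lI)

    refines-max : Refines I f f′ → i ∈ I → IsMax I f′ i → IsMax I f i
    refines-max ref iI max lI = refines-≤ ref lI iI (max lI)

    abstract
      minNeighbour : W ∋ f → i ∈ I → j ∈ I → i ≢ j → StrictMax I f i → IsMin I f j → G i j
      minNeighbour Wf iI jI i≢j max min with exposeMin Wf jI min
      ... | f′ , Wf′ , ref , smin = antipodal Wf′ iI jI i≢j (refines-strictMax ref iI max) smin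

    abstract
      maxNeighbour : W ∋ f → i ∈ I → j ∈ I → i ≢ j → IsMax I f i → StrictMin I f j → G i j
      maxNeighbour Wf iI jI i≢j max min with exposeMax Wf iI max
      ... | f′ , Wf′ , ref , smax = antipodal Wf′ iI jI i≢j smax (refines-strictMin ref jI min)

    abstract
      neighbour : i ∈ I → l ∈ I → i ≢ l → ∃[ j ] G i j
      neighbour {i} {l} iI lI i≢l with exposed iI
      ... | e , We , emax with minimum e iI
      ... | m , mI , min = m , minNeighbour We iI mI
            (λ { ≡.refl → emax lI (i≢l ∘ ≡.sym) (min lI) }) emax min

    -- A proper face of the hull through `a` and `b` all of whose points lie on the line `ab`.
    Edge : A → A → Set
    Edge a b = ∃[ f ] (W ∋ f × f a ≈ f b × NonConstant I f × IsMax I f a ×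
                       (∀ {l} → l ∈ I → f l ≈ f a → Parallel W a b l a))

    module NonEdge {a b} (aI : a ∈ I) (a≢b : a ≢ b) (¬edge : ¬ Edge a b) where
      S : List A
      S = a ∷ b ∷ []
      W′ : Subspace
      W′ = restrict W a b
      avoids : A × A → Set
      avoids (i , j) = i ∉ S × j ∉ S

      abstract
        -- By genericity, a point tied with `a` is tied with it for every functional of `W′`, so it
        -- lies on the line `ab`. A maximum at `a` would thus witness an edge.
        notMax : W′ ∋ h → NonConstant I h → GenericOn I W′ h → ¬ IsMax I h a
        notMax (Wh , ha≈hb) nc gen max = ¬edge (_ , Wh , ha≈hb , nc , max , λ lI p Wg q → gen lI aI p (Wg , q))

      notIn : W′ ∋ h → NonConstant I h → GenericOn I W′ h → IsMax I h i → i ∉ S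
      notIn W′h nc gen max (here ≡.refl) = notMax W′h nc gen max
      notIn W′h nc gen max (there (here ≡.refl)) =
        notMax W′h nc gen λ lI → ≤-respʳ-≈ (sym (proj₂ W′h)) (max lI)

      abstract
        coversRest : Covers I (I ∖ S) W′ (select avoids E)
        coversRest W′f nc with genericOn I W′ W′f
        ... | f′ , W′f′ , ref , gen with covers (proj₁ W′f′) (refines-nonConstant ref nc)
        ... | i , j , e , iI , jI , max , min = i , j , ∈-select⁺ avoids e (i∉S , j∉S) ,
              ∈-select⁺ (_∉ S) iI i∉S , ∈-select⁺ (_∉ S) jI j∉S , refines-max ref iI max , refines-min ref jI min
          where
          i∉S : i ∉ S
          i∉S = notIn W′f′ (refines-nonConstant ref nc) gen max
          j∉S : j ∉ S
          j∉S = notIn (opposite-∈ W′ W′f′) (opposite-nonConstant {f = f′} (refines-nonConstant ref nc))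
            (λ pI qI p≈q → gen pI qI (opposite-≈⁻ {f′} p≈q)) λ lI → opposite-≤ {f′} (min lI)

      abstract
        -- None of the six pairs in `D` survives the projection, and two points go with them, which
        -- pays for the loss of one rank.
        project : ∀ {d D} → b ∈ I → Claim (suc d) → Rank I W (suc (suc d)) → suc (length I) ℕ.≤ 2 ℕ.* suc (suc d) →
                  Unique D → D ⊆ E → length D ≡ 6 → (∀ {e} → e ∈ D → ¬ avoids e) → 6 ℕ.* suc d ℕ.≤ length E
        project {d} {D} bI claim rank len uD D⊆E |D|≡6 hit = ℕₚ.≤-trans
          (ℕₚ.≤-trans (ℕₚ.≤-reflexive (≡.trans (ℕₚ.*-suc 6 d) (ℕₚ.+-comm 6 _)))
            (ℕₚ.+-mono-≤ (claim W′ (select-unique (_∉ S) uI) rank′ len′ (covers-⊆ W′ sub coversRest)) (ℕₚ.≤-reflexive (≡.sym |D|≡6))))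
          (length-select+ avoids uD D⊆E hit)
          where
          sub : I ∖ S ⊆ I
          sub = proj₁ ∘ ∈-select⁻ (_∉ S) I
          rank′ : Rank (I ∖ S) W′ (suc d)
          rank′ = rank-covers W′ coversRest (rank-restrict W a b rank)
          len′ : suc (length (I ∖ S)) ℕ.≤ 2 ℕ.* suc d
          len′ = ℕₚ.+-cancelʳ-≤ 2 _ _ (ℕₚ.≤-trans (s≤s (length-∖ (pair≢ a≢b)
            (λ { (here ≡.refl) → aI ; (there (here ≡.refl)) → bI })))
            (≡.subst (suc (length I) ℕ.≤_) (≡.trans (ℕₚ.*-suc 2 (suc d)) (ℕₚ.+-comm 2 _)) len))

    -- Points with a single partner

    module Leaf {a b} (aGb : G a b) (only : ∀ {j} → G a j → j ∈ b ∷ []) where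
      private
        aI = first-∈ aGb
        bI = second-∈ aGb
        a≢b = distinct aGb

      only≡ : G a j → j ≡ b
      only≡ aGj with only aGj
      ... | here p = p

      abstract
        -- Every minimum of `f` can be made strict without losing the maximum at `a`, which makes it
        -- a partner of `a`, and that can only be `b`.
        leafMin : W ∋ f → StrictMax I f a → StrictMin I f b
        leafMin {f} Wf max {l} lI l≢b with ≤-or-> (f l) (f b) | minimum f aI
        ... | inj₂ b<l | _ = b<l
        ... | inj₁ l≤b | m , mI , min = contradiction (only≡ (minNeighbour Wf aI lI a≢l max lmin)) l≢b
          where
          minNotA : IsMin I f j → a ≢ j
          minNotA min ≡.refl = max bI (a≢b ∘ ≡.sym) (min bI)
          bmin : IsMin I f b
          bmin = ≡.subst (IsMin I f) (only≡ (minNeighbour Wf aI mI (minNotA min) max min)) min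
          lmin : IsMin I f l
          lmin xI = ≤-trans l≤b (bmin xI)
          a≢l : a ≢ l
          a≢l = minNotA lmin

      -- Once `a` is made the strict maximum, the minimum is at `b`; but `f` has the same value at
      -- both.
      notMax : W ∋ f → NonConstant I f → f a ≈ f b → ¬ IsMax I f a
      notMax Wf nc fa≈fb max with exposeMax Wf aI max
      ... | f′ , Wf′ , ref , max′ =
        constant-extreme max (refines-min ref bI (strict⇒min (leafMin Wf′ max′))) (≈⇒≤ fa≈fb) nc

      ¬edge : ¬ Edge a b
      ¬edge (f , Wf , fa≈fb , nc , max , _) = notMax Wf nc fa≈fb max

      -- Vanishes when the ratio at which y overtakes a equals the ratio at
      -- which z undercuts b, along the ray g + t f.
      crossing : Fn → A → A → LinearForm
      crossing f y z .app g = (g a - g y) * (f b - f z) - (g z - g b) * (f y - f a)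
      crossing f y z .linear = crossing-linear
        where
        abstract
          crossing-linear : ∀ s g t h →
            (comb s g t h a - comb s g t h y) * (f b - f z) - (comb s g t h z - comb s g t h b) * (f y - f a) ≈
            s * ((g a - g y) * (f b - f z) - (g z - g b) * (f y - f a)) +
            t * ((h a - h y) * (f b - f z) - (h z - h b) * (f y - f a))
          crossing-linear s g t h = bilinear s (g a) (g y) (g z) (g b) t (h a) (h y) (h z) (h b) (f b - f z) (f y - f a)
            where
            bilinear : ∀ s ga gy gz gb t ha hy hz hb u v →
              (s * ga + t * ha - (s * gy + t * hy)) * u - (s * gz + t * hz - (s * gb + t * hb)) * v ≈
              s * ((ga - gy) * u - (gz - gb) * v) + t * ((ha - hy) * u - (hz - hb) * v)
            bilinear = solve 12 (λ s ga gy gz gb t ha hy hz hb u v →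
              (s :* ga :+ t :* ha :- (s :* gy :+ t :* hy)) :* u :- (s :* gz :+ t :* hz :- (s :* gb :+ t :* hb)) :* v :=
              s :* ((ga :- gy) :* u :- (gz :- gb) :* v) :+ t :* ((ha :- hy) :* u :- (hz :- hb) :* v)) refl

      -- The ray from h in the direction f, stopped where a first ceases to be
      -- the strict maximum.
      module Ray {f h l₀} (Wf : W ∋ f) (Wh : W ∋ h) (fa≈fb : f a ≈ f b) (hmax : StrictMax I h a)
        (hgen : ∀ {y z} → y ∈ I → z ∈ I → app (crossing f y z) h ≈ 0# → VanishesOn W (crossing f y z))
        (below : ∀ {j} → G b j → f j ≤ f a) (l₀I : l₀ ∈ I) (l₀-above : f a < f l₀) where

        Above : A → Set
        Above l = f a < f l

        -- The parameter t at which `l` catches up with `a` along h + t f.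
        ratio : A → Carrier
        ratio l = (h a - h l) * reciprocal (f l - f a)

        first : ∃[ y ] (y ∈ select Above I × IsMin (select Above I) ratio y)
        first = minimum ratio (∈-select⁺ Above l₀I l₀-above)

        y : A
        y = proj₁ first

        yI : y ∈ I
        yI = proj₁ (∈-select⁻ Above I (proj₁ (proj₂ first)))

        y-above : f a < f y
        y-above = proj₂ (∈-select⁻ Above I (proj₁ (proj₂ first)))

        τ : Carrier
        τ = ratio y

        abstract
          ratio-* : Above l → (f l - f a) * ratio l ≈ h a - h l
          ratio-* {l} above = trans (solve 3 (λ u v w → v :* (u :* w) := u :* (v :* w)) refl (h a - h l) (f l - f a) (reciprocal (f l - f a)))
            (trans (*-congˡ (*-reciprocal (x<y⇒0<y-x above))) (*-identityʳ _))

          y≢a : y ≢ a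
          y≢a y≡a = <⇒≉ y-above (reflexive (≡.cong f (≡.sym y≡a)))

          0<τ : 0# < τ
          0<τ τ≤0 = x<y⇒0<y-x (hmax yI y≢a) (≤-respˡ-≈ (ratio-* y-above)
            (≤-respʳ-≈ (zeroʳ _) (*-monoʳ-≤ (<⇒≤ (x<y⇒0<y-x y-above)) τ≤0)))

        k : Fn
        k = comb 1# h τ f

        Wk : W ∋ k
        Wk = W .combine 1# τ Wh Wf

        abstract
          k-gap : ∀ p q → k p - k q ≈ (h p - h q) - (f q - f p) * τ
          k-gap p q = solve 5 (λ hp hq fp fq τ → con (+ 1) :* hp :+ τ :* fp :- (con (+ 1) :* hq :+ τ :* fq)
                := (hp :- hq) :- (fq :- fp) :* τ) refl (h p) (h q) (f p) (f q) τ

          kmax : IsMax I k a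
          kmax {l} lI = 0≤y-x⇒x≤y (≤-respʳ-≈ (sym (k-gap a l)) (gap≥0 (≤-or-> (f l) (f a))))
            where
            gap≥0 : f l ≤ f a ⊎ f a < f l → 0# ≤ (h a - h l) - (f l - f a) * τ
            gap≥0 (inj₁ l≤a) = ≤-respʳ-≈ (solve 3 (λ u v τ → u :+ (con (+ 0) :- v) :* τ := u :- v :* τ) refl (h a - h l) (f l - f a) τ)
              (≤-respˡ-≈ (+-identityˡ 0#) (+-mono-≤ (x≤y⇒0≤y-x (strict⇒max hmax lI))
                (*-nonNegative (x≤y⇒0≤y-x (0≤y-x⇒x≤y (≤-respʳ-≈
                  (solve 2 (λ fa fl → fa :- fl := con (+ 0) :- (fl :- fa)) refl (f a) (f l)) (x≤y⇒0≤y-x l≤a)))) (<⇒≤ 0<τ))))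
            gap≥0 (inj₂ a<l) = x≤y⇒0≤y-x (≤-respʳ-≈ (ratio-* a<l)
              (*-monoʳ-≤ (<⇒≤ (x<y⇒0<y-x a<l)) (proj₂ (proj₂ first) (∈-select⁺ Above lI a<l))))

          ky≈ka : k y ≈ k a
          ky≈ka = sym (x-y≈0⇒x≈y (trans (k-gap a y) (x≈y⇒x-y≈0 (sym (ratio-* y-above)))))

          -- A little more of `h` makes `a` the strict maximum again, so that `leafMin` puts the
          -- minimum at `b`; the order of `k` is only refined by this.
          kmin : IsMin I k b
          kmin with lexicographic I W Wk Wh
          ... | k′ , Wk′ , lex = refines-min (lex .refines) bI (strict⇒min (leafMin Wk′
                λ lI l≢a → lex .breaksTies lI aI (kmax lI) (hmax lI l≢a)))

          -- Otherwise `b` would be the strict minimum of `k`, while `y` shares its maximum with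
          -- `a`. Then `y` would be a partner of `b` above `a`, against `below`.
          undercut : ∃[ z ] (z ∈ I × z ≢ b × k z ≤ k b)
          undercut with em {P = ∃[ z ] (z ∈ I × z ≢ b × k z ≤ k b)}
          ... | yes u = u
          ... | no none = contradiction
                  (below (G-sym (maxNeighbour Wk yI bI y≢b (λ lI → ≤-respʳ-≈ (sym ky≈ka) (kmax lI))
                    λ lI l≢b l≤b → none (_ , lI , l≢b , l≤b))))
                  y-above
            where
            y≢b : y ≢ b
            y≢b y≡b = <⇒≉ y-above (trans fa≈fb (reflexive (≡.cong f (≡.sym y≡b))))

          -- The ties of `y` with `a` and of `z` with `b` occur at the same `τ`, so the crossing
          -- form vanishes at `h`. Since `h` is generic, it vanishes on all of `W`: the differences
          -- a - y and z - b are proportional.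
          conclusion : ∃[ z ] (z ∈ I × f z < f a × (∀ {g} → W ∋ g → g a ≈ g b → g y ≈ g a → g z ≈ g a))
          conclusion with undercut
          ... | z , zI , z≢b , z≤b = z , zI , <-respʳ-≈ (sym fa≈fb) z-below , parallel
            where
            balance : (f b - f z) * τ ≈ h z - h b
            balance = sym (x-y≈0⇒x≈y (trans (sym (k-gap z b)) (x≈y⇒x-y≈0 (antisym z≤b (kmin zI)))))
            z-below : f z < f b
            z-below b≤z = x<y⇒0<y-x (leafMin Wh hmax zI z≢b) (≤-respˡ-≈ (trans (*-comm _ _) balance)
              (≤-respʳ-≈ (zeroʳ τ) (*-monoʳ-≤ (<⇒≤ 0<τ) (≤-respʳ-≈ (x≈y⇒x-y≈0 (refl {f z}))
                (+-monoˡ-≤ (- f z) b≤z)))))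
            vanish : app (crossing f y z) h ≈ 0#
            vanish = trans (+-cong (*-congʳ (sym (ratio-* y-above))) (-‿cong (*-congʳ (sym balance))))
              (solve 3 (λ u v τ → u :* τ :* v :- v :* τ :* u := con (+ 0)) refl (f y - f a) (f b - f z) τ)
            parallel : ∀ {g} → W ∋ g → g a ≈ g b → g y ≈ g a → g z ≈ g a
            parallel {g} Wg ga≈gb gy≈ga = trans (x-y≈0⇒x≈y (*-zero-cancel (<⇒≉′ (x<y⇒0<y-x y-above))
              (trans (solve 4 (λ u v w t → u :* v := w :* t :- (w :* t :- v :* u)) refl (f y - f a) (g z - g b) (g a - g y) (f b - f z))
                (trans (+-cong (trans (*-congʳ (x≈y⇒x-y≈0 (sym gy≈ga))) (zeroˡ _)) (-‿cong (hgen yI zI vanish Wg)))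
                  (x≈y⇒x-y≈0 refl))))) (sym ga≈gb)

      abstract
        overtaking : W ∋ f → NonConstant I f → f a ≈ f b → (∀ {j} → G b j → f j ≤ f a) →
          ∃[ y ] ∃[ z ] (y ∈ I × z ∈ I × f a < f y × f z < f a × (∀ {g} → W ∋ g → g a ≈ g b → g y ≈ g a → g z ≈ g a))
        overtaking {f} Wf nc fa≈fb below =
          let (e , We , emax) = exposed aI
              -- The ray starts at a functional that exposes `a` and is generic for all crossing
              -- forms at once; `notMax` provides a point that eventually overtakes `a`.
              (h , Wh , signs , gen) = generic forms W We
              (l₀ , l₀I , above) = overtaken
              open Ray Wf Wh fa≈fb (refines-strictMax (signs⇒refines ∈-++⁺ˡ signs) aI emax)
                (λ yI zI p Wg → gen (∈-++⁺ʳ (differences I) (∈-map⁺ _ (∈-cartesianProduct⁺ yI zI))) p Wg) below l₀I above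
              (z , zI , z<a , par) = conclusion
          in y , z , yI , zI , y-above , z<a , par
          where
          forms : List LinearForm
          forms = differences I ++ map (λ (y , z) → crossing f y z) (cartesianProduct I I)
          overtaken : ∃[ l ] (l ∈ I × f a < f l)
          overtaken with em {P = ∃[ l ] (l ∈ I × f a < f l)}
          ... | yes p = p
          ... | no none = contradiction (λ {l} lI → [ (λ p → p) , (λ p → contradiction (l , lI , p) none) ]′ (≤-or-> (f l) (f a)))
                  (notMax Wf nc fa≈fb)

      -- Modulo the direction of `ab`, the points `y` and `z` lie on one line through the common
      -- image of `a` and `b`.
      ParallelPair : Fn → Set
      ParallelPair f = ∃[ y ] ∃[ z ] (y ∈ I × z ∈ I × y ≢ z × ¬ (f y ≈ f a) × ¬ (f z ≈ f a) ×
        (∀ {g} → W ∋ g → g a ≈ g b → g y ≈ g a → g z ≈ g a))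

      abstract
        -- Of `f` and its opposite, one is at `c` no larger than at `a`, hence at no partner of `b`
        -- larger than at `a`. A single choice of sign can do this for one partner besides `a`.
        parallelPair : ∀ {c} → (∀ {j} → G b j → j ∈ a ∷ c ∷ []) → W ∋ f → NonConstant I f → f a ≈ f b → ParallelPair f
        parallelPair {f} {c} bOnly Wf nc fa≈fb = [ up , down ]′ (total (f c) (f a))
          where
          bound : ∀ (h : Fn) {j} → h c ≤ h a → j ∈ a ∷ c ∷ [] → h j ≤ h a
          bound h c≤a (here ≡.refl) = ≤-refl
          bound h c≤a (there (here ≡.refl)) = c≤a
          differ : ∀ (h : Fn) {y z} → h a < h y → h z < h a → y ≢ z
          differ h a<y z<a ≡.refl = <-trans z<a a<y ≤-refl
          up : f c ≤ f a → ParallelPair f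
          up c≤a = let (y , z , yI , zI , a<y , z<a , par) = overtaking Wf nc fa≈fb (bound f c≤a ∘ bOnly) in
            y , z , yI , zI , differ f a<y z<a , <⇒≉′ a<y , <⇒≉ z<a , par
          down : f a ≤ f c → ParallelPair f
          down a≤c = let (y , z , yI , zI , a<y , z<a , par) =
                           overtaking {opposite f} (opposite-∈ W Wf) (opposite-nonConstant {f = f} nc) (opposite-≈ {f} fa≈fb)
                             (bound (opposite f) (opposite-≤ {f} a≤c) ∘ bOnly) in
            y , z , yI , zI , differ (opposite f) a<y z<a ,
            (λ p → <⇒≉′ a<y (opposite-≈ {f} p)) , (λ p → <⇒≉ z<a (opposite-≈ {f} p)) , par

      module Crowded {c d} (bOnly : ∀ {j} → G b j → j ∈ a ∷ c ∷ []) (rank : Rank I W d) where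

        -- The k pairs lie on k distinct lines parallel to the line ab.
        record Pairs (k : ℕ) : Set where
          field
            equations : List (A × A)
            points : List A
            equations-length : length equations ≡ suc k
            ab∈equations : (a , b) ∈ equations
            points-unique : Unique points
            points-⊆ : points ⊆ I
            points-length : length points ≡ 2 ℕ.* k
            determined : ∀ {f m} → W ∋ f → Respects f equations → m ∈ points → f m ≈ f a
            a∉points : a ∉ points
            b∉points : b ∉ points

        -- By `determined`, `f` has at all earlier points the value it has at `a`; at `y` and `z` it
        -- has another one, so these are new.
        extend : ∀ {k f} (P : Pairs k) → W ∋ f → Respects f (Pairs.equations P) → ParallelPair f → Pairs (suc k)
        extend {k} {f} P Wf resp (y , z , yI , zI , y≢z , fy≉ , fz≉ , par) = record
          { equations = (y , a) ∷ equations
          ; points = y ∷ z ∷ points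
          ; equations-length = ≡.cong suc equations-length
          ; ab∈equations = there ab∈equations
          ; points-unique = (y≢z ∷ All.tabulate (fresh fy≉)) ∷ All.tabulate (fresh fz≉) ∷ points-unique
          ; points-⊆ = λ { (here ≡.refl) → yI ; (there (here ≡.refl)) → zI ; (there (there m∈)) → points-⊆ m∈ }
          ; points-length = ≡.trans (≡.cong (2 ℕ.+_) points-length) (≡.sym (ℕₚ.*-suc 2 k))
          ; determined = λ
            { Wg r (here ≡.refl) → r (here ≡.refl)
            ; Wg r (there (here ≡.refl)) → par Wg (r (there ab∈equations)) (r (here ≡.refl))
            ; Wg r (there (there m∈)) → determined Wg (r ∘ there) m∈ }
          ; a∉points = outside a∉points refl
          ; b∉points = outside b∉points (sym (resp ab∈equations))
          }
          where
          open Pairs P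
          fresh : ∀ {x m} → ¬ (f x ≈ f a) → m ∈ points → x ≢ m
          fresh fx≉ m∈ ≡.refl = fx≉ (determined Wf resp m∈)
          outside : ∀ {x} → x ∉ points → f x ≈ f a → x ∉ y ∷ z ∷ points
          outside _ fx≈ (here ≡.refl) = fy≉ fx≈
          outside _ fx≈ (there (here ≡.refl)) = fz≉ fx≈
          outside x∉ _ (there (there x∈)) = x∉ x∈

        pairs : ∀ k → suc k ℕ.≤ d → Pairs k
        pairs zero _ = record
          { equations = (a , b) ∷ [] ; points = [] ; equations-length = ≡.refl ; ab∈equations = here ≡.refl
          ; points-unique = [] ; points-⊆ = λ () ; points-length = ≡.refl ; determined = λ _ _ ()
          ; a∉points = λ () ; b∉points = λ () }
        pairs (suc k) k<d =
          let P = pairs k (ℕₚ.<⇒≤ k<d)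
              (f , Wf , resp , nc) = rank (Pairs.equations P) (≡.subst (ℕ._< d) (≡.sym (Pairs.equations-length P)) k<d)
          in extend P Wf resp (parallelPair bOnly Wf nc (resp (Pairs.ab∈equations P)))

        -- The rank allows d - 1 extensions, which give 2(d - 1) points besides `a` and `b`.
        crowded : 1 ℕ.≤ d → 2 ℕ.* d ℕ.≤ length I
        crowded (s≤s {n = k} z≤n) = ≡.subst (ℕ._≤ length I)
          (≡.trans (≡.cong (2 ℕ.+_) points-length) (≡.sym (ℕₚ.*-suc 2 k)))
          (length-⊆ ((a≢b ∷ All.tabulate (avoid a∉points)) ∷ All.tabulate (avoid b∉points) ∷ points-unique)
            (λ { (here ≡.refl) → aI ; (there (here ≡.refl)) → bI ; (there (there m∈)) → points-⊆ m∈ }))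
          where
          open Pairs (pairs k ℕₚ.≤-refl)
          avoid : ∀ {x m} → x ∉ points → m ∈ points → x ≢ m
          avoid x∉ m∈ ≡.refl = x∉ m∈

      abstract
        -- If `b` has at most two partners, `crowded` contradicts the number of points. Three
        -- partners provide six ordered pairs at `b`, all lost in the projection along the non-edge
        -- `ab`.
        leafBound : ∀ {d} → Claim (suc d) → Rank I W (suc (suc d)) → suc (length I) ℕ.≤ 2 ℕ.* suc (suc d) →
                    6 ℕ.* suc d ℕ.≤ length E
        leafBound claim rank len with escape (G b) (a ∷ [])
        ... | inj₁ bOnly = contradiction (crowded (s≤s z≤n)) (ℕₚ.<⇒≱ len)
              where open Crowded {c = a} (∈-++⁺ˡ ∘ bOnly) rank
        ... | inj₂ (p , bGp , p∉) with escape (G b) (a ∷ p ∷ [])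
        ... | inj₁ bOnly = contradiction (crowded (s≤s z≤n)) (ℕₚ.<⇒≱ len)
              where open Crowded bOnly rank
        ... | inj₂ (q , bGq , q∉) = project bI claim rank len
                (star-unique (a≢b ∘ ≡.sym) (distinct bGp) (distinct bGq) (p∉ ∘ here ∘ ≡.sym) (q∉ ∘ here ∘ ≡.sym) (q∉ ∘ there ∘ here ∘ ≡.sym))
                (star-elim {P = _∈ E} (G-edge (G-sym aGb)) (G-edge aGb) (G-edge bGp) (G-edge (G-sym bGp)) (G-edge bGq) (G-edge (G-sym bGq)))
                ≡.refl
                (star-elim {P = λ e → ¬ avoids e} hitˡ hitʳ hitˡ hitʳ hitˡ hitʳ)
              where
              open NonEdge aI a≢b ¬edge
              hitˡ : ∀ {x} → ¬ avoids (b , x)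
              hitˡ (b∉ , _) = b∉ (there (here ≡.refl))
              hitʳ : ∀ {x} → ¬ avoids (x , b)
              hitʳ (_ , b∉) = b∉ (there (here ≡.refl))

    abstract
      nonEdgeBound : ∀ {d a b} → Claim (suc d) → Rank I W (suc (suc d)) → suc (length I) ℕ.≤ 2 ℕ.* suc (suc d) →
        (∀ {i} → i ∈ I → ∃[ p ] ∃[ q ] (G i p × G i q × p ≢ q)) →
        a ∈ I → b ∈ I → a ≢ b → ¬ Edge a b → 6 ℕ.* suc d ℕ.≤ length E
      nonEdgeBound {d} {a} {b} claim rank len two aI bI a≢b ¬edge =
        let (p , p′ , aGp , aGp′ , p≢p′ , p≢b) = avoiding b (two aI)
            (q , q′ , bGq , bGq′ , q≢q′ , q≢a) = avoiding a (two bI)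
            a≢p = distinct aGp
            b≢q = distinct bGq
        -- Here `p` differs from `b` and `q` from `a`, but `p′` may be `b` and `q′` may be `a`. The
        -- reverses of (a, p′) and (b, q′) are left out since they could repeat (b, q′) and (a, p′).
        in project {D = (a , p) ∷ (a , p′) ∷ (p , a) ∷ (b , q) ∷ (b , q′) ∷ (q , b) ∷ []} bI claim rank len
          ((≢-second p≢p′ ∷ ≢-first a≢p ∷ ≢-first a≢b ∷ ≢-first a≢b ∷ ≢-first (q≢a ∘ ≡.sym) ∷ []) ∷
           (≢-first a≢p ∷ ≢-first a≢b ∷ ≢-first a≢b ∷ ≢-first (q≢a ∘ ≡.sym) ∷ []) ∷
           (≢-first p≢b ∷ ≢-first p≢b ∷ ≢-second a≢b ∷ []) ∷
           (≢-second q≢q′ ∷ ≢-first b≢q ∷ []) ∷ (≢-first b≢q ∷ []) ∷ [] ∷ [])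
          (λ { (here ≡.refl) → G-edge aGp ; (there (here ≡.refl)) → G-edge aGp′
             ; (there (there (here ≡.refl))) → G-edge (G-sym aGp)
             ; (there (there (there (here ≡.refl)))) → G-edge bGq
             ; (there (there (there (there (here ≡.refl))))) → G-edge bGq′
             ; (there (there (there (there (there (here ≡.refl)))))) → G-edge (G-sym bGq) })
          ≡.refl
          (λ { (here ≡.refl) (a∉ , _) → a∉ (here ≡.refl) ; (there (here ≡.refl)) (a∉ , _) → a∉ (here ≡.refl)
             ; (there (there (here ≡.refl))) (_ , a∉) → a∉ (here ≡.refl)
             ; (there (there (there (here ≡.refl)))) (b∉ , _) → b∉ (there (here ≡.refl))
             ; (there (there (there (there (here ≡.refl))))) (b∉ , _) → b∉ (there (here ≡.refl))
             ; (there (there (there (there (there (here ≡.refl)))))) (_ , b∉) → b∉ (there (here ≡.refl)) })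
        where
        open NonEdge aI a≢b ¬edge
        avoiding : ∀ {i} x → ∃[ p ] ∃[ q ] (G i p × G i q × p ≢ q) → ∃[ p ] ∃[ q ] (G i p × G i q × p ≢ q × p ≢ x)
        avoiding x (p , q , iGp , iGq , p≢q) with em {P = p ≡ x}
        ... | yes ≡.refl = q , p , iGq , iGp , p≢q ∘ ≡.sym , p≢q ∘ ≡.sym
        ... | no p≢x = p , q , iGp , iGq , p≢q , p≢x

-- Configurations in which every pair is an edge

module TwoNeighbourly (em : ExcludedMiddle 0ℓ) (ℝ : Reals) (A : Set) where
  open OrderedField em ℝ
  open FiniteLists em
  open Values em ℝ A
  open Claims em ℝ A

  private variable
    f : Fn
    i j l a b p q : A

  module Edges {I : List A} {E : List (A × A)} (W : Subspace) (uI : Unique I)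
    (covers : Covers I I W E) (exposed : ∀ {p} → p ∈ I → Exposed I W p) where
    open Strict W uI covers exposed

    abstract
      -- Write l - a = c(a - b). For c ≥ 0 the point `l` defeats the exposure of `a`, for c ≤ -1
      -- that of `b`; otherwise `l` lies between them and cannot be exposed itself.
      no-three-collinear : a ∈ I → b ∈ I → a ≢ b → l ∈ I → l ≢ a → l ≢ b → ¬ Parallel W a b l a
      no-three-collinear {a} {b} {l} aI bI a≢b lI l≢a l≢b par =
        let (e , We , emax) = exposed aI
            (c , ratio) = parallel-ratio W We (emax bI (a≢b ∘ ≡.sym)) par
        in [ beyond-a c ratio , [ beyond-b c ratio , between c ratio ]′ ∘ swap′ c ]′ (total 0# c)
        where
        Ratio : Carrier → Set
        Ratio c = ∀ {g} → W ∋ g → g l - g a ≈ c * (g a - g b)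
        swap′ : ∀ c → c ≤ 0# → c ≤ - 1# ⊎ (- 1# ≤ c × c ≤ 0#)
        swap′ c c≤0 = [ inj₁ , (λ p → inj₂ (p , c≤0)) ]′ (total c (- 1#))
        beyond-a : ∀ c → Ratio c → ¬ (0# ≤ c)
        beyond-a c ratio 0≤c = let (e , We , emax) = exposed aI in
          emax lI l≢a (0≤y-x⇒x≤y (≤-respʳ-≈ (sym (ratio We))
            (*-nonNegative 0≤c (x≤y⇒0≤y-x (<⇒≤ (emax bI (a≢b ∘ ≡.sym)))))))
        beyond-b : ∀ c → Ratio c → ¬ (c ≤ - 1#)
        beyond-b c ratio c≤-1 = let (e , We , emax) = exposed bI in
          emax lI l≢b (0≤y-x⇒x≤y (≤-respʳ-≈
            (trans (solve 3 (λ ea eb c → (:- con (+ 1) :- c) :* (eb :- ea) := c :* (ea :- eb) :+ (ea :- eb)) refl (e a) (e b) c)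
              (trans (+-congʳ (sym (ratio We)))
                (solve 3 (λ el ea eb → el :- ea :+ (ea :- eb) := el :- eb) refl (e l) (e a) (e b))))
            (*-nonNegative (x≤y⇒0≤y-x c≤-1) (x≤y⇒0≤y-x (<⇒≤ (emax aI a≢b))))))
        between : ∀ c → Ratio c → ¬ (- 1# ≤ c × c ≤ 0#)
        between c ratio (-1≤c , c≤0) = let (e , We , emax) = exposed lI in
          [ (λ ea≤eb → emax bI (l≢b ∘ ≡.sym) (0≤y-x⇒x≤y (≤-respʳ-≈
              (trans (solve 3 (λ ea eb c → (c :- :- con (+ 1)) :* (eb :- ea) := eb :- ea :- c :* (ea :- eb)) refl (e a) (e b) c)
                (trans (+-congˡ (-‿cong (sym (ratio We))))
                  (solve 3 (λ el ea eb → eb :- ea :- (el :- ea) := eb :- el) refl (e l) (e a) (e b))))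
              (*-nonNegative (x≤y⇒0≤y-x -1≤c) (x≤y⇒0≤y-x ea≤eb)))))
          , (λ eb≤ea → emax aI (l≢a ∘ ≡.sym) (0≤y-x⇒x≤y (≤-respʳ-≈
              (trans (solve 2 (λ c u → (con (+ 0) :- c) :* u := :- (c :* u)) refl c (e a - e b))
                (trans (-‿cong (sym (ratio We)))
                  (solve 2 (λ el ea → :- (el :- ea) := ea :- el) refl (e l) (e a))))
              (*-nonNegative (x≤y⇒0≤y-x c≤0) (x≤y⇒0≤y-x eb≤ea)))))
          ]′ (total (e a) (e b))

    record StrictEdge (a b : A) : Set where
      field
        {functional} : Fn
        in-W : W ∋ functional
        level : functional a ≈ functional b
        top : ∀ {l} → l ∈ I → l ≢ a → l ≢ b → functional l < functional a

    edge⇒strict : a ∈ I → b ∈ I → a ≢ b → Edge a b → StrictEdge a b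
    edge⇒strict {a} {b} aI bI a≢b (f , Wf , fa≈fb , nc , max , ties) = record
      { in-W = Wf ; level = fa≈fb ; top = λ lI l≢a l≢b →
          [ (λ l<a → l<a) , (λ l≈a → contradiction (λ {g} → ties lI l≈a {g}) (no-three-collinear aI bI a≢b lI l≢a l≢b)) ]′
            (≤-cases (max lI)) }

    module AllEdges (edges : ∀ {a b} → a ∈ I → b ∈ I → a ≢ b → Edge a b) (3≤|I| : 3 ℕ.≤ length I) where

      strictEdge : a ∈ I → b ∈ I → a ≢ b → StrictEdge a b
      strictEdge aI bI a≢b = edge⇒strict aI bI a≢b (edges aI bI a≢b)

      abstract
        -- A pair of parallel segments would be two sides of a trapezium, whose diagonals
        -- cross and so cannot both be edges.
        no-parallels : a ∈ I → b ∈ I → p ∈ I → q ∈ I → a ≢ b → p ≢ q → p ≢ a → p ≢ b → q ≢ a → q ≢ b → ¬ Parallel W a b p q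
        no-parallels {a} {b} {p} {q} aI bI pI qI a≢b p≢q p≢a p≢b q≢a q≢b par =
          let (e , We , emax) = exposed aI
              (c , ratio) = parallel-ratio W We (emax bI (a≢b ∘ ≡.sym)) par
          in [ same c ratio , opposed c ratio ]′ (total 0# c)
          where
          Ratio : Carrier → Set
          Ratio c = ∀ {g} → W ∋ g → g p - g q ≈ c * (g a - g b)
          same : ∀ c → Ratio c → ¬ (0# ≤ c)
          same c ratio 0≤c =
            let open StrictEdge (strictEdge pI bI p≢b) renaming (functional to ψ) in
            x<y⇒0<y-x (top qI (p≢q ∘ ≡.sym) q≢b) (≤-respˡ-≈ (sym (ratio in-W))
              (≤-respʳ-≈ (solve 1 (λ c → c :* con (+ 0) := con (+ 0)) refl c) (*-monoʳ-≤ 0≤c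
                (≤-respʳ-≈ (-‿inverseʳ (ψ b)) (+-monoˡ-≤ (- ψ b) (≤-respʳ-≈ level (<⇒≤ (top aI (p≢a ∘ ≡.sym) a≢b))))))))
          opposed : ∀ c → Ratio c → ¬ (c ≤ 0#)
          opposed c ratio c≤0 =
            let open StrictEdge (strictEdge pI aI p≢a) renaming (functional to ψ) in
            x<y⇒0<y-x (top qI (p≢q ∘ ≡.sym) q≢a) (≤-respˡ-≈ (sym (ratio in-W))
              (≤-respʳ-≈ (zeroʳ c) (*-monoʳ-≤-nonPos c≤0
                (x≤y⇒0≤y-x (≤-respʳ-≈ level (<⇒≤ (top bI (p≢b ∘ ≡.sym) (a≢b ∘ ≡.sym))))))))

      third : ∀ a b → ∃[ l ] (l ∈ I × l ≢ a × l ≢ b)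
      third a b = pick (I ∖ S) (λ x∈ → ∈-select⁻ (_∉ S) I x∈)
          (ℕₚ.+-cancelʳ-≤ 2 1 _ (ℕₚ.≤-trans 3≤|I| (length-∖-lower S uI)))
        where
        S : List A
        S = a ∷ b ∷ []
        pick : ∀ xs → (∀ {x} → x ∈ xs → x ∈ I × x ∉ S) → 1 ℕ.≤ length xs → ∃[ l ] (l ∈ I × l ≢ a × l ≢ b)
        pick (x ∷ _) f _ = let (xI , x∉) = f (here ≡.refl) in x , xI , x∉ ∘ here , x∉ ∘ there ∘ here

      abstract
        -- Made generic among the functionals that agree on `a` and `b`, the edge functional has a
        -- unique minimum, since a tie there would be a segment parallel to `ab`. Its maximum can be
        -- made strict at `a` or at `b`, so both are partners of that minimum. The last component
        -- lets the choice of the functional steer `z`.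
        commonNeighbour : a ∈ I → b ∈ I → a ≢ b → (e : StrictEdge a b) →
          ∃[ z ] (G a z × G b z × IsMin I (StrictEdge.functional e) z)
        commonNeighbour {a} {b} aI bI a≢b edge =
          let (f , Wf′ , ref , gen) = genericOn I (restrict W a b) (in-W , level)
              Wf = proj₁ Wf′
              fa≈fb = proj₂ Wf′
              (l₀ , l₀I , l₀≢a , l₀≢b) = third a b
              (z , zI , min) = minimum f aI
              z<a = ≤-<-trans (min l₀I) (ref l₀I aI (top l₀I l₀≢a l₀≢b))
              min′ = strictMin gen fa≈fb zI min z<a
              a≢z = λ a≡z → <⇒≉ z<a (reflexive (≡.cong f (≡.sym a≡z)))
              b≢z = λ b≡z → <⇒≉ z<a (trans (reflexive (≡.cong f (≡.sym b≡z))) (sym fa≈fb))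
              amax = λ {l} → max {f} {l} ref fa≈fb
          in z , maxNeighbour Wf aI zI a≢z amax min′ ,
             maxNeighbour Wf bI zI b≢z (λ lI → ≤-respʳ-≈ fa≈fb (amax lI)) min′ ,
             refines-min ref zI min
          where
          open StrictEdge edge
          max : ∀ {f l} → Refines I functional f → f a ≈ f b → l ∈ I → f l ≤ f a
          max {f} {l} ref fa≈fb lI with em {P = l ≡ a} | em {P = l ≡ b}
          ... | yes ≡.refl | _ = ≤-refl
          ... | no _ | yes ≡.refl = ≈⇒≤ (sym fa≈fb)
          ... | no l≢a | no l≢b = <⇒≤ (ref lI aI (top lI l≢a l≢b))
          strictMin : ∀ {f z} → GenericOn I (restrict W a b) f → f a ≈ f b → z ∈ I → IsMin I f z → f z < f a → StrictMin I f z
          strictMin {f} {z} gen fa≈fb zI min z<a {l} lI l≢z l≤z =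
            no-parallels aI bI lI zI a≢b l≢z
              (λ { ≡.refl → z<a l≤z }) (λ { ≡.refl → z<a (≤-respˡ-≈ (sym fa≈fb) l≤z) })
              (λ { ≡.refl → z<a ≤-refl }) (λ { ≡.refl → z<a (≈⇒≤ fa≈fb) })
              (λ Wg p → gen lI zI (antisym l≤z (min lI)) (Wg , p))

      graph : Graph I E
      graph = record { Adj = G ; adj-sym = G-sym ; adj-irrefl = G.distinct ; adj-∈ = G.first-∈ ; adj-edge = G-edge }

      common : Graph.CommonNeighbours graph
      common uI vI u≢v = let (z , uGz , vGz , _) = commonNeighbour uI vI u≢v (strictEdge uI vI u≢v) in z , uGz , vGz

      module Merge {a b y z} (aGb : G a b) (aGy : G a y) (bGy : G b y) (aGz : G a z) (bGz : G b z) (y≢z : y ≢ z) where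
        private
          a≢b = G.distinct aGb
          a≢y = G.distinct aGy
          a≢z = G.distinct aGz
          b≢y = G.distinct bGy
          b≢z = G.distinct bGz

        D E₁ E′ : List (A × A)
        J : List A
        W′ : Subspace

        σ : A → A
        σ x with em {P = x ≡ b}
        ... | yes _ = a
        ... | no _ = x

        D = star b a y z
        E₁ = E ∖ D
        E′ = map (λ (i , j) → σ i , σ j) E₁
        J = I ∖ (b ∷ [])
        W′ = restrict W a b

        σ-∈ : i ∈ I → σ i ∈ J
        σ-∈ {i} iI with em {P = i ≡ b}
        ... | yes _ = ∈-select⁺ (_∉ b ∷ []) (G.first-∈ aGb) λ { (here a≡b) → a≢b a≡b }
        ... | no i≢b = ∈-select⁺ (_∉ b ∷ []) iI λ { (here i≡b) → i≢b i≡b }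

        σ-≈ : f a ≈ f b → ∀ i → f (σ i) ≈ f i
        σ-≈ fa≈fb i with em {P = i ≡ b}
        ... | yes ≡.refl = fa≈fb
        ... | no _ = refl

        D-contains-b : ∀ {e} → e ∈ D → proj₁ e ≡ b ⊎ proj₂ e ≡ b
        D-contains-b = star-elim {P = λ e → proj₁ e ≡ b ⊎ proj₂ e ≡ b}
          (inj₁ ≡.refl) (inj₂ ≡.refl) (inj₁ ≡.refl) (inj₂ ≡.refl) (inj₁ ≡.refl) (inj₂ ≡.refl)

        kept : i ≢ b → j ≢ b → (i , j) ∈ E → (i , j) ∈ E₁
        kept i≢b j≢b e∈ = ∈-select⁺ (_∉ D) e∈ ([ i≢b , j≢b ]′ ∘ D-contains-b)

        Replacement : Fn → A × A → Set
        Replacement f (i , j) = ∃[ i′ ] ∃[ j′ ] ((i′ , j′) ∈ E₁ × i′ ∈ I × j′ ∈ I × f i′ ≈ f i × f j′ ≈ f j)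

        replaceable : f a ≈ f b → NonConstant I f → ∀ {e} → e ∈ D →
          IsMax I f (proj₁ e) → IsMin I f (proj₂ e) → Replacement f e
        replaceable {f} fa≈fb nc = star-elim {P = λ e → IsMax I f (proj₁ e) → IsMin I f (proj₂ e) → Replacement f e}
          (λ max min → contradiction nc (constant-extreme max min (≈⇒≤ (sym fa≈fb))))
          (λ max min → contradiction nc (constant-extreme max min (≈⇒≤ fa≈fb)))
          (λ _ _ → from aGy b≢y) (λ _ _ → to aGy b≢y) (λ _ _ → from aGz b≢z) (λ _ _ → to aGz b≢z)
          where
          from : ∀ {x} → G a x → b ≢ x → Replacement f (b , x)
          from aGx b≢x = _ , _ , kept a≢b (b≢x ∘ ≡.sym) (G-edge aGx) , G.first-∈ aGx , G.second-∈ aGx , fa≈fb , refl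
          to : ∀ {x} → G a x → b ≢ x → Replacement f (x , b)
          to aGx b≢x = _ , _ , kept (b≢x ∘ ≡.sym) a≢b (G-edge (G-sym aGx)) , G.second-∈ aGx , G.first-∈ aGx , refl , fa≈fb

        replacement : f a ≈ f b → NonConstant I f → (i , j) ∈ E → i ∈ I → j ∈ I →
          IsMax I f i → IsMin I f j → Replacement f (i , j)
        replacement {i = i} {j = j} fa≈fb nc e∈ iI jI max min with em {P = (i , j) ∈ D}
        ... | yes e∈D = replaceable fa≈fb nc e∈D max min
        ... | no e∉D = i , j , ∈-select⁺ (_∉ D) e∈ e∉D , iI , jI , refl , refl

        abstract
          coversMerged : Covers I J W′ E′
          coversMerged {f} (Wf , fa≈fb) nc =
            let (i , j , e∈ , iI , jI , max , min) = covers Wf nc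
                (i′ , j′ , e∈E₁ , i′I , j′I , fi′≈ , fj′≈) = replacement fa≈fb nc e∈ iI jI max min
            in σ i′ , σ j′ , ∈-map⁺ (λ (i , j) → σ i , σ j) e∈E₁ , σ-∈ i′I , σ-∈ j′I ,
               (λ lI → ≤-respʳ-≈ (sym (trans (σ-≈ {f} fa≈fb i′) fi′≈)) (max lI)) ,
               (λ lI → ≤-respˡ-≈ (sym (trans (σ-≈ {f} fa≈fb j′) fj′≈)) (min lI))

          -- Only one point disappears while the bound on their number falls by two; the extra `suc`
          -- in the hypothesis makes up for it.
          mergeBound : ∀ {d} → Claim (suc d) → Rank I W (suc (suc d)) → suc (suc (length I)) ℕ.≤ 2 ℕ.* suc (suc d) →
                       6 ℕ.* suc d ℕ.≤ length E
          mergeBound {d} claim rank len = ℕₚ.≤-trans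
            (ℕₚ.≤-trans (ℕₚ.≤-reflexive (≡.trans (ℕₚ.*-suc 6 d) (ℕₚ.+-comm 6 _)))
              (ℕₚ.+-monoˡ-≤ 6 (≡.subst (6 ℕ.* d ℕ.≤_) (Listₚ.length-map _ E₁)
                (claim W′ (select-unique (_∉ b ∷ []) uI) (rank-covers W′ coversMerged (rank-restrict W a b rank)) len′
                  (covers-⊆ W′ (proj₁ ∘ ∈-select⁻ (_∉ b ∷ []) I) coversMerged)))))
            (length-∖ {xs = E} (star-unique (a≢b ∘ ≡.sym) b≢y b≢z a≢y a≢z y≢z)
              (star-elim {P = _∈ E} (G-edge (G-sym aGb)) (G-edge aGb) (G-edge bGy) (G-edge (G-sym bGy)) (G-edge bGz) (G-edge (G-sym bGz))))
            where
            len′ : suc (length J) ℕ.≤ 2 ℕ.* suc d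
            len′ = ℕₚ.≤-trans (≡.subst (ℕ._≤ length I) (ℕₚ.+-comm _ 1)
                (length-∖ {ys = b ∷ []} ([] ∷ []) λ { (here ≡.refl) → G.second-∈ aGb }))
              (ℕₚ.+-cancelˡ-≤ 2 _ _ (≡.subst (suc (suc (length I)) ℕ.≤_) (ℕₚ.*-suc 2 (suc d)) len))

      module NonFace {a b y} (aGb : G a b) (aGy : G a y) (bGy : G b y)
        (notMax : ∀ {f} → W ∋ f → f a ≈ f b → f a ≈ f y → NonConstant I f → ¬ IsMax I f a) where
        private
          a≢b = G.distinct aGb
          a≢y = G.distinct aGy
          b≢y = G.distinct bGy

        S : List A
        S = a ∷ b ∷ y ∷ []

        W″ : Subspace
        W″ = restrict (restrict W a b) a y

        avoids : A × A → Set
        avoids (i , j) = i ∉ S × j ∉ S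

        leaving : A × A → Set
        leaving (s , w) = G s w × s ∈ S × w ∉ S

        S⊆I : S ⊆ I
        S⊆I (here ≡.refl) = G.first-∈ aGb
        S⊆I (there (here ≡.refl)) = G.second-∈ aGb
        S⊆I (there (there (here ≡.refl))) = G.second-∈ aGy

        uS : Unique S
        uS = (a≢b ∷ a≢y ∷ []) ∷ (b≢y ∷ []) ∷ [] ∷ []

        notIn : W″ ∋ f → NonConstant I f → IsMax I f i → i ∉ S
        notIn ((Wf , p) , q) nc max (here ≡.refl) = notMax Wf p q nc max
        notIn ((Wf , p) , q) nc max (there (here ≡.refl)) = notMax Wf p q nc λ lI → ≤-respʳ-≈ (sym p) (max lI)
        notIn ((Wf , p) , q) nc max (there (there (here ≡.refl))) = notMax Wf p q nc λ lI → ≤-respʳ-≈ (sym q) (max lI)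

        abstract
          coversRest : Covers I (I ∖ S) W″ (select avoids E)
          coversRest {f} W″f nc =
            let (i , j , e∈ , iI , jI , max , min) = covers (proj₁ (proj₁ W″f)) nc
                i∉S = notIn W″f nc max
                j∉S = notIn (opposite-∈ W″ W″f) (opposite-nonConstant {f = f} nc) (λ lI → opposite-≤ {f} (min lI))
            in i , j , ∈-select⁺ avoids e∈ (i∉S , j∉S) , ∈-select⁺ (_∉ S) iI i∉S , ∈-select⁺ (_∉ S) jI j∉S , max , min

        record Leaving : Set where
          field
            edges′ : List (A × A)
            edges-unique : Unique edges′
            edges-length : 3 ℕ.≤ length edges′
            edges-leave : ∀ {e} → e ∈ edges′ → leaving e

        -- Each outside point has a common partner with `v`, and that partner lies in `S`. The
        -- resulting pairs differ in their second entry.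
        saturated : ∀ {v} → v ∈ S → (∀ {w} → G v w → w ∈ S) → 3 ℕ.≤ length (I ∖ S) → Leaving
        saturated {v} vS nbrs 3≤ =
          let (es , ues , len , leave , _) = owned {P = leaving} proj₂ 1 (select-unique (_∉ S) uI) spoke in record
            { edges′ = es ; edges-unique = ues ; edges-leave = leave
            ; edges-length = ≡.subst (3 ℕ.≤_) (≡.sym (≡.trans len (ℕₚ.*-identityˡ _))) 3≤ }
          where
          spoke : ∀ {w} → w ∈ I ∖ S → ∃[ es ] (Unique es × length es ≡ 1 × (∀ {e} → e ∈ es → leaving e) × (∀ {e} → e ∈ es → proj₂ e ≡ w))
          spoke {w} w∈ =
            let (wI , w∉S) = ∈-select⁻ (_∉ S) I w∈
                (s , vGs , wGs) = common (S⊆I vS) wI (λ v≡w → w∉S (≡.subst (_∈ S) v≡w vS))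
            in (s , w) ∷ [] , [] ∷ [] , ≡.refl ,
               (λ { (here ≡.refl) → G-sym wGs , nbrs vGs , w∉S }) , λ { (here ≡.refl) → ≡.refl }

        leavingEdges : 3 ℕ.≤ length (I ∖ S) → Leaving
        leavingEdges 3≤ = exitFrom (here ≡.refl) λ exitA → exitFrom (there (here ≡.refl)) λ exitB →
                          exitFrom (there (there (here ≡.refl))) (spread exitA exitB)
          where
          Exit : A → Set
          Exit v = ∃[ w ] (G v w × w ∉ S)
          exitFrom : ∀ {v} → v ∈ S → (Exit v → Leaving) → Leaving
          exitFrom {v} vS next with escape (G v) S
          ... | inj₁ nbrs = saturated vS nbrs 3≤
          ... | inj₂ exit = next exit
          spread : Exit a → Exit b → Exit y → Leaving
          spread (u , aGu , u∉) (v , bGv , v∉) (w , yGw , w∉) = record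
            { edges′ = (a , u) ∷ (b , v) ∷ (y , w) ∷ []
            ; edges-unique = (≢-first a≢b ∷ ≢-first a≢y ∷ []) ∷ (≢-first b≢y ∷ []) ∷ [] ∷ []
            ; edges-length = ℕₚ.≤-refl
            ; edges-leave = λ
              { (here ≡.refl) → aGu , here ≡.refl , u∉
              ; (there (here ≡.refl)) → bGv , there (here ≡.refl) , v∉
              ; (there (there (here ≡.refl))) → yGw , there (there (here ≡.refl)) , w∉ } }

        module Counting (L : Leaving) where
          open Leaving L

          -- Six pairs within the triangle and at least three leaving ones in both orientations:
          -- twelve pairs for two ranks.
          D : List (A × A)
          D = triangle a b y ++ edges′ ++ map swap edges′

          within-S : ∀ {e} → e ∈ triangle a b y → proj₁ e ∈ S × proj₂ e ∈ S
          within-S = triangle-elim {P = λ e → proj₁ e ∈ S × proj₂ e ∈ S} (a∈ , b∈) (b∈ , a∈) (a∈ , y∈) (y∈ , a∈) (b∈ , y∈) (y∈ , b∈)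
            where
            a∈ : a ∈ S
            a∈ = here ≡.refl
            b∈ : b ∈ S
            b∈ = there (here ≡.refl)
            y∈ : y ∈ S
            y∈ = there (there (here ≡.refl))

          entering : ∀ {e} → e ∈ map swap edges′ → leaving (swap e)
          entering e∈ with ∈-map⁻ swap e∈
          ... | _ , e∈′ , ≡.refl = edges-leave e∈′

          outside : ∀ {e} → e ∈ edges′ ++ map swap edges′ → ¬ (proj₁ e ∈ S × proj₂ e ∈ S)
          outside e∈ (p∈ , q∈) = [ (λ e∈′ → proj₂ (proj₂ (edges-leave e∈′)) q∈) , (λ e∈′ → proj₂ (proj₂ (entering e∈′)) p∈) ]′
            (∈-++⁻ edges′ e∈)

          D-unique : Unique D
          D-unique = Uniqueₚ.++⁺ (triangle-unique a≢b a≢y b≢y)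
            (Uniqueₚ.++⁺ edges-unique (Uniqueₚ.map⁺ swap-injective edges-unique)
              λ (e∈ , e∈′) → proj₂ (proj₂ (entering e∈′)) (proj₁ (proj₂ (edges-leave e∈))))
            λ (e∈ , e∈′) → outside e∈′ (within-S e∈)
            where
            swap-injective : ∀ {e e′ : A × A} → swap e ≡ swap e′ → e ≡ e′
            swap-injective ≡.refl = ≡.refl

          D⊆E : D ⊆ E
          D⊆E = [ triangle-elim {P = _∈ E} (G-edge aGb) (G-edge (G-sym aGb)) (G-edge aGy) (G-edge (G-sym aGy)) (G-edge bGy) (G-edge (G-sym bGy))
            , [ G-edge ∘ proj₁ ∘ edges-leave , G-edge ∘ G-sym ∘ proj₁ ∘ entering ]′ ∘ ∈-++⁻ edges′ ]′ ∘ ∈-++⁻ (triangle a b y)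

          hit : ∀ {e} → e ∈ D → ¬ avoids e
          hit e∈ (p∉ , q∉) = [ (λ e∈′ → p∉ (proj₁ (within-S e∈′)))
            , [ (λ e∈′ → p∉ (proj₁ (proj₂ (edges-leave e∈′)))) , (λ e∈′ → q∉ (proj₁ (proj₂ (entering e∈′)))) ]′ ∘ ∈-++⁻ edges′ ]′
            (∈-++⁻ (triangle a b y) e∈)

          12≤D : 12 ℕ.≤ length D
          12≤D = ℕₚ.+-monoʳ-≤ 6 (≡.subst (6 ℕ.≤_)
            (≡.sym (≡.trans (Listₚ.length-++ edges′) (≡.cong (length edges′ ℕ.+_) (Listₚ.length-map swap edges′))))
            (ℕₚ.+-mono-≤ edges-length edges-length))

        abstract
          nonFaceBound : ∀ {d} → Claim d → Rank I W (suc (suc d)) → suc (suc (length I)) ℕ.≤ 2 ℕ.* suc (suc d) →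
                         6 ℕ.* suc d ℕ.≤ length E
          nonFaceBound {d} claim rank len = go d claim rank″ (≡.subst (suc (suc (length I)) ℕ.≤_) eq len) (rank-size W rank)
            where
            eq : 2 ℕ.* suc (suc d) ≡ 4 ℕ.+ 2 ℕ.* d
            eq = ℕₚ.*-distribˡ-+ 2 2 d
            rank″ : Rank (I ∖ S) W″ d
            rank″ = rank-covers W″ coversRest (rank-restrict (restrict W a b) a y (rank-restrict W a b rank))
            size : length (I ∖ S) ℕ.+ 3 ℕ.≤ length I
            size = length-∖ uS S⊆I
            go : ∀ d → Claim d → Rank (I ∖ S) W″ d → suc (suc (length I)) ℕ.≤ 4 ℕ.+ 2 ℕ.* d → suc (suc (suc d)) ℕ.≤ length I →
                 6 ℕ.* suc d ℕ.≤ length E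
            -- Rank two needs three points, but only two are allowed here.
            go zero _ _ (s≤s (s≤s |I|≤2)) 3≤ = contradiction (ℕₚ.≤-trans 3≤ |I|≤2) λ { (s≤s (s≤s ())) }
            go (suc d) claim rank (s≤s (s≤s |I|≤)) _ = ℕₚ.≤-trans
              (ℕₚ.≤-trans (ℕₚ.≤-reflexive (≡.trans (ℕₚ.*-distribˡ-+ 6 2 d) (ℕₚ.+-comm 12 _)))
                (ℕₚ.+-mono-≤ (claim W″ (select-unique (_∉ S) uI) rank small (covers-⊆ W″ (proj₁ ∘ ∈-select⁻ (_∉ S) I) coversRest)) 12≤D))
              (length-select+ avoids D-unique D⊆E hit)
              where
              m : ℕ
              m = length (I ∖ S)
              small : suc m ℕ.≤ 2 ℕ.* suc d
              small = ℕₚ.+-cancelʳ-≤ 2 _ _ (≡.subst₂ ℕ._≤_ (ℕₚ.+-suc m 2) (ℕₚ.+-comm 2 _) (ℕₚ.≤-trans size |I|≤))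
              -- There are at least d + 2 points outside `S` by the rank of `W″` and at most 2d + 1
              -- by `small`. So d ≥ 1, and the three outside points that `leavingEdges` requires
              -- exist.
              1≤d : 1 ℕ.≤ d
              1≤d = ℕₚ.+-cancelˡ-≤ (suc (suc d)) 1 d (≡.subst₂ ℕ._≤_ (ℕₚ.+-comm 1 _)
                      (≡.trans (ℕₚ.*-suc 2 d) (≡.cong (λ k → suc (suc (d ℕ.+ k))) (ℕₚ.+-identityʳ d)))
                      (ℕₚ.≤-trans (s≤s (rank-size W″ rank)) small))
              open Counting (leavingEdges (ℕₚ.≤-trans (s≤s (s≤s 1≤d)) (rank-size W″ rank)))

      abstract
        smallBound : ∀ {d} → Claim d → Claim (suc d) → Rank I W (suc (suc d)) → suc (suc (length I)) ℕ.≤ 2 ℕ.* suc (suc d) →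
                     a ∈ I → 6 ℕ.* suc d ℕ.≤ length E
        smallBound {a} {d} claim claim′ rank len aI =
          let (l , lI , l≢a , _) = third a a
              (b , aGb , _) = common aI lI (l≢a ∘ ≡.sym)
              bI = G.second-∈ aGb
              (y , aGy , bGy) = common aI bI (G.distinct aGb)
          in byFace aI bI aGb aGy bGy
          where
          byFace : ∀ {a b y} → a ∈ I → b ∈ I → G a b → G a y → G b y → 6 ℕ.* suc d ℕ.≤ length E
          byFace {a} {b} {y} aI bI aGb aGy bGy with em {P = ∃[ f ] (W ∋ f × f a ≈ f b × f a ≈ f y × NonConstant I f × IsMax I f a)}
          ... | no none = NonFace.nonFaceBound aGb aGy bGy (λ Wf p q nc max → none (_ , Wf , p , q , nc , max)) claim rank len
          ... | yes (f , Wf , fa≈fb , fa≈fy , nc , max) =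
                -- Ordering by the face functional `f` first and the edge functional second again
                -- singles out the edge `ab`, and a minimum of the result minimises `f`. As `y`
                -- maximises `f`, the common partner `z` is different from `y`.
                let (f′ , Wf′ , lex) = lexicographic I W Wf (StrictEdge.in-W edge)
                    (z , aGz , bGz , min) = commonNeighbour aI bI (G.distinct aGb) (record
                      { in-W = Wf′ ; level = lex .keepsTies fa≈fb (StrictEdge.level edge)
                      ; top = λ lI l≢a l≢b → lex .breaksTies lI aI (max lI) (StrictEdge.top edge lI l≢a l≢b) })
                in Merge.mergeBound aGb aGy bGy aGz bGz
                     (λ { ≡.refl → constant-extreme max (refines-min (lex .refines) (G.second-∈ aGz) min) (≈⇒≤ fa≈fy) nc })
                     claim′ rank len
            where
            edge : StrictEdge a b
            edge = strictEdge aI bI (G.distinct aGb)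

        allEdgesBound : ∀ {d} → Claim d → Claim (suc d) → Rank I W (suc (suc d)) → suc (length I) ℕ.≤ 2 ℕ.* suc (suc d) →
                        a ∈ I → 6 ℕ.* suc d ℕ.≤ length E
        allEdgesBound {a} {d} claim claim′ rank len aI = [ small , tight ]′ (ℕₚ.m≤n⇒m<n∨m≡n len)
          where
          small : suc (suc (length I)) ℕ.≤ 2 ℕ.* suc (suc d) → 6 ℕ.* suc d ℕ.≤ length E
          small len′ = smallBound claim claim′ rank len′ aI
          tight : suc (length I) ≡ 2 ℕ.* suc (suc d) → 6 ℕ.* suc d ℕ.≤ length E
          -- Here n + 1 = 2(d + 2), so 3(n - 1) = 6(d + 1); the `2` subtracted from k = n + 1
          -- accounts for n - 1.
          tight eq = ≡.subst (ℕ._≤ length E)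
            (≡.trans (≡.cong (λ k → 3 ℕ.* (k ℕ.∸ 2)) (≡.trans eq (ℕₚ.*-suc 2 (suc d)))) (≡.sym (ℕₚ.*-assoc 3 2 (suc d))))
            (Graph.friendship graph uI common)

-- The induction on the rank

module LowerBound (em : ExcludedMiddle 0ℓ) (ℝ : Reals) (A : Set) where
  open OrderedField em ℝ
  open FiniteLists em
  open Values em ℝ A
  open Claims em ℝ A
  open TwoNeighbourly em ℝ A

  private variable
    p : A
    I : List A
    E : List (A × A)

  module _ {I : List A} {E : List (A × A)} (W : Subspace) (uI : Unique I)
    (covers : Covers I I W E) (exposed : ∀ {p} → p ∈ I → Exposed I W p)
    {d} (claim : Claim d) (claim′ : Claim (suc d)) (rank : Rank I W (suc (suc d)))
    (len : suc (length I) ℕ.≤ 2 ℕ.* suc (suc d)) where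
    open Strict W uI covers exposed

    private
      3≤|I| : 3 ℕ.≤ length I
      3≤|I| = ℕₚ.≤-trans (s≤s (s≤s (s≤s z≤n))) (rank-size W rank)

      TwoNeighbours IsLeaf : A → Set
      TwoNeighbours i = ∃[ p ] ∃[ q ] (G i p × G i q × p ≢ q)
      IsLeaf i = ∃[ b ] (G i b × (∀ {j} → G i j → j ∈ b ∷ []))

      degree : ∀ {i} → i ∈ I → TwoNeighbours i ⊎ IsLeaf i
      degree {i} iI with other
        where
        other : ∃[ l ] (l ∈ I × i ≢ l)
        other = pick (I ∖ (i ∷ [])) (∈-select⁻ (_∉ i ∷ []) I)
            (ℕₚ.+-cancelʳ-≤ 1 2 _ (ℕₚ.≤-trans 3≤|I| (length-∖-lower (i ∷ []) uI)))
          where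
          pick : ∀ xs → (∀ {x} → x ∈ xs → x ∈ I × x ∉ i ∷ []) → 2 ℕ.≤ length xs → ∃[ l ] (l ∈ I × i ≢ l)
          pick (x ∷ _) f _ = let (xI , x∉) = f (here ≡.refl) in x , xI , λ i≡x → x∉ (here (≡.sym i≡x))
      ... | l , lI , i≢l with neighbour iI lI i≢l
      ... | b , iGb with escape (G i) (b ∷ [])
      ... | inj₁ only = inj₂ (b , iGb , only)
      ... | inj₂ (q , iGq , q∉) = inj₁ (b , q , iGb , iGq , λ b≡q → q∉ (here (≡.sym b≡q)))

      nonempty : ∃[ a ] a ∈ I
      nonempty = first I 3≤|I|
        where
        first : ∀ xs → 3 ℕ.≤ length xs → ∃[ a ] a ∈ xs
        first (x ∷ _) _ = x , here ≡.refl

      byEdges : (∀ {i} → i ∈ I → TwoNeighbours i) → 6 ℕ.* suc d ℕ.≤ length E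
      byEdges two with em {P = ∃[ a ] ∃[ b ] (a ∈ I × b ∈ I × a ≢ b × ¬ Edge a b)}
      ... | yes (a , b , aI , bI , a≢b , ¬edge) = nonEdgeBound claim′ rank len two aI bI a≢b ¬edge
      ... | no none = AllEdges.allEdgesBound edges 3≤|I| claim claim′ rank len (proj₂ nonempty)
        where
        open Edges W uI covers exposed
        edges : ∀ {a b} → a ∈ I → b ∈ I → a ≢ b → Edge a b
        edges {a} {b} aI bI a≢b with em {P = Edge a b}
        ... | yes edge = edge
        ... | no ¬edge = contradiction (a , b , aI , bI , a≢b , ¬edge) none

    abstract
      strictBound : 6 ℕ.* suc d ℕ.≤ length E
      strictBound = [ byEdges , (λ (a , aI , b , aGb , only) → Leaf.leafBound aGb only claim′ rank len) ]′
        (all-or-some I degree)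

  Merged : List A → Subspace → A → Set
  Merged I W p = ∃[ q ] (q ∈ I ∖ (p ∷ []) × (∀ {g} → W ∋ g → g p ≈ g q))

  abstract
    -- If p repeats another point q, then q takes its place in E.
    discard : ∀ W → Covers I I W E → p ∈ I → ¬ Exposed I W p →
      ∃[ E′ ] (length E′ ≡ length E × Covers I (I ∖ (p ∷ [])) W E′)
    discard {I} {E} {p} W covers pI ¬exposed with em {P = Merged I W p}
    ... | yes (q , qJ , same) = map (λ (i , j) → σ i , σ j) E , Listₚ.length-map _ E ,
          λ {f} Wf nc → let (i , j , e∈ , iI , jI , max , min) = covers Wf nc in
            σ i , σ j , ∈-map⁺ (λ (i , j) → σ i , σ j) e∈ , σ-∈ iI , σ-∈ jI ,
            (λ lI → ≤-respʳ-≈ (sym (σ-≈ Wf i)) (max lI)) , (λ lI → ≤-respˡ-≈ (sym (σ-≈ Wf j)) (min lI))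
      where
      σ : A → A
      σ x with em {P = x ≡ p}
      ... | yes _ = q
      ... | no _ = x
      σ-∈ : ∀ {i} → i ∈ I → σ i ∈ I ∖ (p ∷ [])
      σ-∈ {i} iI with em {P = i ≡ p}
      ... | yes _ = qJ
      ... | no i≢p = ∈-select⁺ (_∉ p ∷ []) iI λ { (here i≡p) → i≢p i≡p }
      σ-≈ : ∀ {f} → W ∋ f → ∀ i → f (σ i) ≈ f i
      σ-≈ Wf i with em {P = i ≡ p}
      ... | yes ≡.refl = sym (same Wf)
      ... | no _ = refl
    -- Now every other point is separated from `p` by some functional, so an extreme of a generic
    -- functional at `p` would be strict and expose `p`. The covering pairs of generic refinements
    -- thus avoid `p`, and `E` can stay as it is.
    ... | no alone = E , ≡.refl , λ {f} Wf nc →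
            let (f′ , Wf′ , ref , gen) = genericOn I W Wf
                (i , j , e∈ , iI , jI , max , min) = covers Wf′ (refines-nonConstant ref nc)
            in i , j , e∈ , keep iI Wf′ gen max ,
               keep jI (opposite-∈ W Wf′) (λ pI qI p≈q → gen pI qI (opposite-≈⁻ {f′} p≈q)) (λ lI → opposite-≤ {f′} (min lI)) ,
               (λ lI → refines-≤ ref lI iI (max lI)) , (λ lI → refines-≤ ref jI lI (min lI))
      where
      keep : ∀ {f i} → i ∈ I → W ∋ f → GenericOn I W f → IsMax I f i → i ∈ I ∖ (p ∷ [])
      keep {f} iI Wf gen max = ∈-select⁺ (_∉ p ∷ []) iI λ { (here ≡.refl) → ¬exposed (f , Wf , strict f Wf gen max) }
        where
        strict : ∀ f → W ∋ f → GenericOn I W f → IsMax I f p → StrictMax I f p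
        strict f Wf gen max {l} lI l≢p p≤l = alone (l , ∈-select⁺ (_∉ p ∷ []) lI (λ { (here l≡p) → l≢p l≡p }) ,
          λ Wg → gen pI lI (antisym p≤l (max lI)) Wg)

  -- Discarding a point that is not exposed changes neither the rank bound nor the length of `E`,
  -- and the bound on the number of points only gets easier. In `go`, `n` bounds the length of `I`,
  -- so this ends with all points exposed.
  claimStep : ∀ {d} → Claim d → Claim (suc d) → Claim (suc (suc d))
  claimStep {d} claim claim′ {I} W uI rank len covers = go (length I) W uI rank len covers ℕₚ.≤-refl
    where
    go : ∀ n {I E} W → Unique I → Rank I W (suc (suc d)) → suc (length I) ℕ.≤ 2 ℕ.* suc (suc d) → Covers I I W E →
         length I ℕ.≤ n → 6 ℕ.* suc d ℕ.≤ length E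
    go n {I} {E} W uI rank len covers |I|≤n with all-or-some I decide
      where
      decide : ∀ {p} → p ∈ I → Exposed I W p ⊎ ¬ Exposed I W p
      decide {p} _ with em {P = Exposed I W p}
      ... | yes e = inj₁ e
      ... | no ¬e = inj₂ ¬e
    ... | inj₁ exposed = strictBound W uI covers exposed claim claim′ rank len
    ... | inj₂ (p , pI , ¬exposed) = descend n |I|≤n
      where
      J : List A
      J = I ∖ (p ∷ [])
      shorter : suc (length J) ℕ.≤ length I
      shorter = ≡.subst (ℕ._≤ length I) (ℕₚ.+-comm _ 1) (length-∖ {ys = p ∷ []} ([] ∷ []) λ { (here ≡.refl) → pI })
      descend : ∀ n → length I ℕ.≤ n → 6 ℕ.* suc d ℕ.≤ length E
      descend zero |I|≤0 = contradiction (ℕₚ.≤-trans shorter |I|≤0) λ ()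
      descend (suc n) |I|≤n =
        let (E′ , |E′| , covers′) = discard W covers pI ¬exposed in
        ≡.subst (6 ℕ.* suc d ℕ.≤_) |E′|
          (go n W (select-unique (_∉ p ∷ []) uI) (rank-covers W covers′ rank)
            (ℕₚ.≤-trans (ℕₚ.≤-trans shorter (ℕₚ.n≤1+n _)) len)
            (covers-⊆ W (proj₁ ∘ ∈-select⁻ (_∉ p ∷ []) I) covers′)
            (ℕₚ.≤-pred (ℕₚ.≤-trans shorter |I|≤n)))

  -- Two consecutive ranks are carried because `NonFace` descends by two. For ranks 0 and 1 the
  -- bound is 0.
  claims : ∀ d → Claim d × Claim (suc d)
  claims zero = (λ _ _ _ _ _ → z≤n) , λ _ _ _ _ _ → z≤n
  claims (suc d) = let (claim , claim′) = claims d in claim′ , claimStep claim claim′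

-- Finite sums and the Kronecker delta

module FiniteSums (em : ExcludedMiddle 0ℓ) (ℝ : Reals) where
  open OrderedField em ℝ
  open SemiringSum semiring using (sum; sum-cong-≋; sum-replicate-zero; ∑-distrib-+; ∑-comm; *-distribˡ-sum; *-distribʳ-sum) public

  private variable
    n : ℕ

  sum-mono : {s t : Vector Carrier n} → (∀ i → s i ≤ t i) → sum s ≤ sum t
  sum-mono {zero} _ = ≤-refl
  sum-mono {suc n} s≤t = +-mono-≤ (s≤t zero) (sum-mono (s≤t ∘ suc))

  sum-zero : {t : Vector Carrier n} → (∀ i → t i ≈ 0#) → sum t ≈ 0#
  sum-zero {n} t≈0 = trans (sum-cong-≋ t≈0) (sum-replicate-zero n)

  sum-nonNegative : {t : Vector Carrier n} → (∀ i → 0# ≤ t i) → 0# ≤ sum t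
  sum-nonNegative {n} 0≤t = ≤-respˡ-≈ (sum-replicate-zero n) (sum-mono 0≤t)

  +-zero : ∀ {x y} → 0# ≤ x → 0# ≤ y → x + y ≈ 0# → x ≈ 0# × y ≈ 0#
  +-zero {x} {y} 0≤x 0≤y x+y≈0 =
    antisym (≤-respʳ-≈ x+y≈0 (≤-respˡ-≈ (+-identityʳ x) (+-monoʳ-≤ x 0≤y))) 0≤x ,
    antisym (≤-respʳ-≈ x+y≈0 (≤-respˡ-≈ (+-identityˡ y) (+-monoˡ-≤ y 0≤x))) 0≤y

  sum-zero⁻ : {t : Vector Carrier n} → (∀ i → 0# ≤ t i) → sum t ≈ 0# → ∀ i → t i ≈ 0#
  sum-zero⁻ 0≤t Σ≈0 zero = proj₁ (+-zero (0≤t zero) (sum-nonNegative (0≤t ∘ suc)) Σ≈0)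
  sum-zero⁻ 0≤t Σ≈0 (suc i) = sum-zero⁻ (0≤t ∘ suc) (proj₂ (+-zero (0≤t zero) (sum-nonNegative (0≤t ∘ suc)) Σ≈0)) i

  -- `δ i` serves both as a basis vector and as the weights that select a single point.
  δ : Fin n → Fin n → Carrier
  δ zero zero = 1#
  δ zero (suc _) = 0#
  δ (suc _) zero = 0#
  δ (suc i) (suc j) = δ i j

  δ-refl : (i : Fin n) → δ i i ≈ 1#
  δ-refl zero = refl
  δ-refl (suc i) = δ-refl i

  δ-≢ : {i j : Fin n} → i ≢ j → δ i j ≈ 0#
  δ-≢ {i = zero} {zero} i≢j = contradiction ≡.refl i≢j
  δ-≢ {i = zero} {suc j} _ = refl
  δ-≢ {i = suc i} {zero} _ = refl
  δ-≢ {i = suc i} {suc j} i≢j = δ-≢ (i≢j ∘ ≡.cong suc)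

  δ-sym : (i j : Fin n) → δ i j ≈ δ j i
  δ-sym zero zero = refl
  δ-sym zero (suc j) = refl
  δ-sym (suc i) zero = refl
  δ-sym (suc i) (suc j) = δ-sym i j

  δ-nonNegative : (i j : Fin n) → 0# ≤ δ i j
  δ-nonNegative zero zero = <⇒≤ 0<1
  δ-nonNegative zero (suc j) = ≤-refl
  δ-nonNegative (suc i) zero = ≤-refl
  δ-nonNegative (suc i) (suc j) = δ-nonNegative i j

  sum-δ : (i : Fin n) (t : Vector Carrier n) → sum (λ j → δ i j * t j) ≈ t i
  sum-δ zero t = trans (+-cong (*-identityˡ _) (sum-zero (λ j → zeroˡ (t (suc j))))) (+-identityʳ _)
  sum-δ (suc i) t = trans (+-cong (zeroˡ _) (sum-δ i (t ∘ suc))) (+-identityˡ _)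

  sum-δ-1 : (i : Fin n) → sum (δ i) ≈ 1#
  sum-δ-1 i = trans (sum-cong-≋ {x = δ i} {λ j → δ i j * 1#} λ j → sym (*-identityʳ _)) (sum-δ i (λ _ → 1#))

  sum-single : (i : Fin n) {t : Vector Carrier n} → (∀ {j} → j ≢ i → t j ≈ 0#) → sum t ≈ t i
  sum-single i {t} off = trans (sum-cong-≋ term) (sum-δ i t)
    where
    term : ∀ j → t j ≈ δ i j * t j
    term j with i Finₚ.≟ j
    ... | yes ≡.refl = trans (sym (*-identityˡ _)) (*-congʳ (sym (δ-refl i)))
    ... | no i≢j = trans (off (i≢j ∘ ≡.sym)) (sym (trans (*-congʳ (δ-≢ i≢j)) (zeroˡ _)))

  sum-neg : (t : Vector Carrier n) → sum (λ j → - t j) ≈ - sum t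
  sum-neg {n} t = trans (sum-cong-≋ (λ j → solve 1 (λ x → :- x := (:- con (+ 1)) :* x) refl (t j)))
    (trans (sym (*-distribˡ-sum (- 1#) t)) (solve 1 (λ x → (:- con (+ 1)) :* x := :- x) refl (sum t)))

-- From point configurations to spaces of functionals

module Configurations (em : ExcludedMiddle 0ℓ) (ℝ : Reals) where
  open OrderedField em ℝ
  open FiniteSums em ℝ
  open FiniteLists em
  open Geometry ℝ
  open Geometry.Counting ℝ em
  open Hyperplane
  open VectorEquality setoid using (_≋_; ≋-sym; ≋-trans; ≋-refl)

  private variable
    d n : ℕ

  abstract
    ⟨⟩-cong : {a b y z : Point d} → a ≋ b → y ≋ z → ⟨ a , y ⟩ ≈ ⟨ b , z ⟩
    ⟨⟩-cong a≋b y≋z = sum-cong-≋ λ c → *-cong (a≋b c) (y≋z c)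

    ⟨⟩-congˡ : (a : Point d) {y z : Point d} → y ≋ z → ⟨ a , y ⟩ ≈ ⟨ a , z ⟩
    ⟨⟩-congˡ a = ⟨⟩-cong {a = a} ≋-refl

    ⟨⟩-linear : ∀ s (a : Point d) t b y → ⟨ (λ c → s * a c + t * b c) , y ⟩ ≈ s * ⟨ a , y ⟩ + t * ⟨ b , y ⟩
    ⟨⟩-linear s a t b y = trans
      (sum-cong-≋ λ c → solve 5 (λ s a t b y → (s :* a :+ t :* b) :* y := s :* (a :* y) :+ t :* (b :* y)) refl s (a c) t (b c) (y c))
      (trans (∑-distrib-+ (λ c → s * (a c * y c)) (λ c → t * (b c * y c)))
        (sym (+-cong (*-distribˡ-sum s (λ c → a c * y c)) (*-distribˡ-sum t (λ c → b c * y c)))))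

    ⟨⟩-scale : ∀ t (a y : Point d) → ⟨ (λ c → t * a c) , y ⟩ ≈ t * ⟨ a , y ⟩
    ⟨⟩-scale t a y = trans (sum-cong-≋ λ c → *-assoc t (a c) (y c)) (sym (*-distribˡ-sum t (λ c → a c * y c)))

    ⟨⟩-minus : ∀ (a y z : Point d) → ⟨ a , (λ c → y c - z c) ⟩ ≈ ⟨ a , y ⟩ - ⟨ a , z ⟩
    ⟨⟩-minus a y z = trans
      (sum-cong-≋ λ c → solve 3 (λ a y z → a :* (y :- z) := a :* y :+ :- (a :* z)) refl (a c) (y c) (z c))
      (trans (∑-distrib-+ (λ c → a c * y c) (λ c → - (a c * z c))) (+-congˡ (sum-neg (λ c → a c * z c))))

    ⟨⟩-𝟎 : (a : Point d) → ⟨ a , 𝟎 ⟩ ≈ 0#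
    ⟨⟩-𝟎 a = sum-zero λ c → zeroʳ (a c)

    𝟎-⟨⟩ : {a : Point d} → a ≋ 𝟎 → ∀ y → ⟨ a , y ⟩ ≈ 0#
    𝟎-⟨⟩ a≋𝟎 y = sum-zero λ c → trans (*-congʳ (a≋𝟎 c)) (zeroˡ (y c))

    ⟨⟩-δ : (a : Point d) (c : Fin d) → ⟨ a , δ c ⟩ ≈ a c
    ⟨⟩-δ a c = trans (sum-cong-≋ λ c′ → *-comm (a c′) (δ c c′)) (sum-δ c a)

    δ-⟨⟩ : (c : Fin d) (y : Point d) → ⟨ δ c , y ⟩ ≈ y c
    δ-⟨⟩ c y = sum-δ c y

    ⟨⟩-combination : ∀ (a : Point d) w (x : Vector (Point d) n) → ⟨ a , combination w x ⟩ ≈ sum (λ i → w i * ⟨ a , x i ⟩)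
    ⟨⟩-combination a w x = trans
      (sum-cong-≋ λ c → trans (*-distribˡ-sum (a c) (λ i → w i * x i c))
        (sum-cong-≋ λ i → solve 3 (λ a w x → a :* (w :* x) := w :* (a :* x)) refl (a c) (w i) (x i c)))
      (trans (∑-comm (λ c i → w i * (a c * x i c)))
        (sum-cong-≋ λ i → sym (*-distribˡ-sum (w i) (λ c → a c * x i c))))

    -- Gaussian elimination. If all first coordinates vanish, the first basis vector works.
    -- Otherwise a pivot `p` clears the first coordinate of the others, and a solution in one
    -- dimension less gets the first coordinate that makes it orthogonal to `p`.
    orthogonal : ∀ d (vs : List (Point d)) → length vs ℕ.< d → ∃[ a ] (¬ (a ≋ 𝟎) × (∀ {v} → v ∈ vs → ⟨ a , v ⟩ ≈ 0#))
    orthogonal (suc d) vs (s≤s len) with em {P = ∃[ p ] (p ∈ vs × ¬ (p zero ≈ 0#))}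
    ... | no none = δ zero , (λ a≋𝟎 → 0≉1 (sym (a≋𝟎 zero))) , λ {v} v∈ → trans (δ-⟨⟩ zero v) (flat v v∈)
      where
      flat : ∀ v → v ∈ vs → v zero ≈ 0#
      flat v v∈ with em {P = v zero ≈ 0#}
      ... | yes p = p
      ... | no p = contradiction (v , v∈ , p) none
    ... | yes (p , p∈ , p₀≉0) with ∈-∃++ p∈
    ... | us , ws , ≡.refl = extend (orthogonal d (map eliminate (us ++ ws))
            (≡.subst (ℕ._≤ d) (≡.trans (Listₚ.length-++ us) (≡.trans (ℕₚ.+-suc _ _) (≡.cong suc
              (≡.trans (≡.sym (Listₚ.length-++ us)) (≡.sym (Listₚ.length-map eliminate (us ++ ws))))))) len))
      where
      r : Carrier
      r = proj₁ (inverse (p zero) p₀≉0)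
      p₀r≈1 : p zero * r ≈ 1#
      p₀r≈1 = proj₂ (inverse (p zero) p₀≉0)
      eliminate : Point (suc d) → Point d
      eliminate v c = v (suc c) - v zero * r * p (suc c)
      extend : ∃[ a ] (¬ (a ≋ 𝟎) × (∀ {v} → v ∈ map eliminate (us ++ ws) → ⟨ a , v ⟩ ≈ 0#)) →
               ∃[ a ] (¬ (a ≋ 𝟎) × (∀ {v} → v ∈ us ++ p ∷ ws → ⟨ a , v ⟩ ≈ 0#))
      extend (a , a≉𝟎 , orth) = a⁺ , (λ a⁺≋𝟎 → a≉𝟎 (a⁺≋𝟎 ∘ suc)) , orth⁺
        where
        P : Carrier
        P = ⟨ a , p ∘ suc ⟩
        a⁺ : Point (suc d)
        a⁺ zero = - (P * r)
        a⁺ (suc c) = a c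
        pivot : ⟨ a⁺ , p ⟩ ≈ 0#
        pivot = trans (solve 3 (λ P r p₀ → (:- (P :* r)) :* p₀ :+ P := P :- P :* (p₀ :* r)) refl P r (p zero))
          (x≈y⇒x-y≈0 (sym (trans (*-congˡ p₀r≈1) (*-identityʳ P))))
        eliminated : ∀ v → ⟨ a , eliminate v ⟩ ≈ ⟨ a⁺ , v ⟩
        eliminated v = trans (⟨⟩-minus a (v ∘ suc) (λ c → v zero * r * p (suc c)))
          (trans (+-congˡ (-‿cong (trans (sum-cong-≋ λ c → solve 3 (λ a s p → a :* (s :* p) := s :* (a :* p)) refl (a c) (v zero * r) (p (suc c)))
              (sym (*-distribˡ-sum (v zero * r) (λ c → a c * p (suc c)))))))
            (solve 4 (λ V v₀ r P → V :- v₀ :* r :* P := (:- (P :* r)) :* v₀ :+ V) refl ⟨ a , v ∘ suc ⟩ (v zero) r P))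
        orth⁺ : ∀ {v} → v ∈ us ++ p ∷ ws → ⟨ a⁺ , v ⟩ ≈ 0#
        orth⁺ {v} v∈ with ∈-++⁻ us v∈
        ... | inj₁ v∈us = trans (sym (eliminated v)) (orth (∈-map⁺ eliminate (∈-++⁺ˡ v∈us)))
        ... | inj₂ (here ≡.refl) = pivot
        ... | inj₂ (there v∈ws) = trans (sym (eliminated v)) (orth (∈-map⁺ eliminate (∈-++⁺ʳ us v∈ws)))

  point-in-conv : (x : Vector (Point d) n) → ∀ i {y} → y ≋ x i → conv x y
  point-in-conv x i y≋xi = δ i , δ-nonNegative i , sum-δ-1 i ,
    λ c → trans (y≋xi c) (sym (sum-δ i (λ j → x j c)))

  module Family {d n} (x : Vector (Point d) n) where
    open Values em ℝ (Fin n)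
    open Claims em ℝ (Fin n)

    I : List (Fin n)
    I = allFin n

    evaluate : Point d → Fn
    evaluate a i = ⟨ a , x i ⟩

    evaluations : Subspace
    evaluations ._∋_ f = ∃[ a ] (∀ i → f i ≈ evaluate a i)
    evaluations .combine s t (a , f≈) (b , g≈) = (λ c → s * a c + t * b c) ,
      λ i → trans (+-cong (*-congˡ (f≈ i)) (*-congˡ (g≈ i))) (sym (⟨⟩-linear s a t b (x i)))

    evaluate-∈ : ∀ a → evaluations ∋ evaluate a
    evaluate-∈ a = a , λ _ → refl

    abstract
      conv-≤ : ∀ a {M y} → (∀ i → evaluate a i ≤ M) → conv x y → ⟨ a , y ⟩ ≤ M
      conv-≤ a {M} bound (w , 0≤w , Σw≈1 , y≋) = ≤-respˡ-≈ (sym (trans (⟨⟩-congˡ a y≋) (⟨⟩-combination a w x)))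
        (≤-respʳ-≈ (trans (sym (*-distribʳ-sum M w)) (trans (*-congʳ Σw≈1) (*-identityˡ M)))
          (sum-mono λ i → *-monoʳ-≤ (0≤w i) (bound i)))

      -- The nonnegative terms sum to M - ⟨a, y⟩ = 0, so each is zero: only points at level `M`
      -- carry weight.
      conv-tight : ∀ a {M y} → (∀ i → evaluate a i ≤ M) → ((w , _) : conv x y) → ⟨ a , y ⟩ ≈ M →
                   ∀ i → w i * (M - evaluate a i) ≈ 0#
      conv-tight a {M} bound (w , 0≤w , Σw≈1 , y≋) ay≈M = sum-zero⁻
        (λ i → *-nonNegative (0≤w i) (x≤y⇒0≤y-x (bound i)))
        (trans (sum-cong-≋ λ i → solve 3 (λ w M e → w :* (M :- e) := w :* M :+ :- (w :* e)) refl (w i) M (evaluate a i))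
          (trans (∑-distrib-+ (λ i → w i * M) (λ i → - (w i * evaluate a i)))
            (trans (+-cong (trans (sym (*-distribʳ-sum M w)) (trans (*-congʳ Σw≈1) (*-identityˡ M)))
                           (trans (sum-neg (λ i → w i * evaluate a i))
                             (-‿cong (trans (sym (trans (⟨⟩-congˡ a y≋) (⟨⟩-combination a w x))) ay≈M))))
              (-‿inverseʳ M))))

    hyperplane : (a : Point d) → ¬ (a ≋ 𝟎) → Carrier → Hyperplane d
    hyperplane a a≉𝟎 b = record { normal = a ; offset = b ; normal≉𝟎 = a≉𝟎 }

    module _ (a : Point d) (a≉𝟎 : ¬ (a ≋ 𝟎)) (i : Fin n) where
      private
        H : Hyperplane d
        H = hyperplane a a≉𝟎 (evaluate a i)

      supports-max : (∀ j → evaluate a j ≤ evaluate a i) → Supporting H (conv x)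
      supports-max max = (x i , point-in-conv x i ≋-refl , refl) , inj₁ (conv-≤ a max)

      supports-min : (∀ j → evaluate a i ≤ evaluate a j) → Supporting H (conv x)
      supports-min min = (x i , point-in-conv x i ≋-refl , refl) , inj₂ λ {y} y∈ →
        neg-cancel-≤ (≤-respˡ-≈ (neg y) (≤-respʳ-≈ (neg (x i)) (conv-≤ (λ c → - 1# * a c)
          (λ j → ≤-respˡ-≈ (sym (⟨⟩-scale (- 1#) a (x j))) (≤-respʳ-≈ (sym (⟨⟩-scale (- 1#) a (x i)))
            (*-monoʳ-≤-nonPos (≤-respʳ-≈ (solve 0 (:- con (+ 0) := con (+ 0)) refl) (neg-mono-≤ (<⇒≤ 0<1))) (min j)))) y∈)))
        where
        neg : ∀ y → ⟨ (λ c → - 1# * a c) , y ⟩ ≈ - ⟨ a , y ⟩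
        neg y = trans (⟨⟩-scale (- 1#) a y) (solve 1 (λ u → (:- con (+ 1)) :* u := :- u) refl ⟨ a , y ⟩)

      only-point : (∀ j → j ≢ i → ¬ (evaluate a j ≈ evaluate a i)) → ∀ {y} → pts x y × ⟨ a , y ⟩ ≈ evaluate a i → y ≋ x i
      only-point distinct ((j , y≋xj) , ay≈) with j Finₚ.≟ i
      ... | yes ≡.refl = y≋xj
      ... | no j≢i = contradiction (trans (sym (⟨⟩-congˡ a y≋xj)) ay≈) (distinct j j≢i)

    abstract
      nonzero : ∀ a {i j} → evaluate a i < evaluate a j → ¬ (a ≋ 𝟎)
      nonzero a {i} {j} i<j a≋𝟎 = <⇒≉ i<j (trans (𝟎-⟨⟩ a≋𝟎 (x i)) (sym (𝟎-⟨⟩ a≋𝟎 (x j))))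

    strictlyAntipodal : ∀ {f i j} → evaluations ∋ f → i ≢ j → StrictMax I f i → StrictMin I f j → StrictlyAntipodal x i j
    strictlyAntipodal {f} {i} {j} (a , f≈) i≢j smax smin =
      (λ xi≋xj → <⇒≉ j<i (⟨⟩-congˡ a (≋-sym xi≋xj))) ,
      hyperplane a a≉𝟎 (evaluate a i) , hyperplane a a≉𝟎 (evaluate a j) ,
      (λ H′≐H″ → <⇒≉′ j<i (proj₁ H′≐H″ {x i} refl)) ,
      (1# , λ c → sym (*-identityˡ (a c))) ,
      supports-max a a≉𝟎 i (λ l → ≤-respˡ-≈ (f≈ l) (≤-respʳ-≈ (f≈ i) (strict⇒max smax (∈-allFin l)))) ,
      supports-min a a≉𝟎 j (λ l → ≤-respˡ-≈ (f≈ j) (≤-respʳ-≈ (f≈ l) (strict⇒min smin (∈-allFin l)))) ,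
      (only-point a a≉𝟎 i (λ l l≢i → <⇒≉ (transfer (smax (∈-allFin l) l≢i))) , λ y≋ → (i , y≋) , ⟨⟩-congˡ a y≋) ,
      (only-point a a≉𝟎 j (λ l l≢j → <⇒≉′ (transfer (smin (∈-allFin l) l≢j))) , λ y≋ → (j , y≋) , ⟨⟩-congˡ a y≋)
      where
      transfer : ∀ {p q} → f p < f q → evaluate a p < evaluate a q
      transfer {p} {q} = <-respˡ-≈ (f≈ p) ∘ <-respʳ-≈ (f≈ q)
      j<i : evaluate a j < evaluate a i
      j<i = transfer (smax (∈-allFin j) (i≢j ∘ ≡.sym))
      a≉𝟎 : ¬ (a ≋ 𝟎)
      a≉𝟎 = nonzero a j<i

    Exposing : Fin n → Set
    Exposing i = ∃[ a ] (¬ (a ≋ 𝟎) × (∀ {l} → l ≢ i → evaluate a l < evaluate a i))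

    abstract
      exposing⇒vertex : ∀ {i} → Exposing i → ∀ {y} → y ≋ x i → vert (conv x) y
      exposing⇒vertex {i} (a , a≉𝟎 , top) {y} y≋xi =
        hyperplane a a≉𝟎 (evaluate a i) , supports-max a a≉𝟎 i max ,
        (λ (z∈conv , az≈) → ≋-trans (unique z∈conv az≈) (≋-sym y≋xi)) ,
        λ z≋y → point-in-conv x i (≋-trans z≋y y≋xi) , ⟨⟩-congˡ a (≋-trans z≋y y≋xi)
        where
        max : ∀ j → evaluate a j ≤ evaluate a i
        max j with j Finₚ.≟ i
        ... | yes ≡.refl = ≤-refl
        ... | no j≢i = <⇒≤ (top j≢i)
        unique : ∀ {z} → conv x z → ⟨ a , z ⟩ ≈ evaluate a i → z ≋ x i
        unique z∈@(w , _ , Σw≈1 , z≋) az≈ c = trans (z≋ c) (trans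
          (sum-single i {λ j → w j * x j c} (λ j≢i → trans (*-congʳ (weightless j≢i)) (zeroˡ _)))
          (trans (*-congʳ (trans (sym (sum-single i weightless)) Σw≈1)) (*-identityˡ _)))
          where
          weightless : ∀ {j} → j ≢ i → w j ≈ 0#
          weightless {j} j≢i = *-zero-cancel (<⇒≉′ (x<y⇒0<y-x (top j≢i))) (trans (*-comm _ _) (conv-tight a max z∈ az≈ j))

      -- A point `x i` on the supporting hyperplane must be `v`, since the face is a single point.
      -- If there were none, all weights of `v` would vanish by `conv-tight`, although their sum is
      -- 1.
      vertex⇒point : ∀ {v} → vert (conv x) v → pts x v
      vertex⇒point {v} (H , supp , on⇒v , v⇒on) with v⇒on ≋-refl
      ... | v∈ , av≈ with em {P = ∃[ i ] (evaluate (normal H) i ≈ offset H)}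
      ...   | yes (i , ai≈) = i , ≋-sym (on⇒v (point-in-conv x i ≋-refl , ai≈))
      ...   | no off = contradiction (proj₂ supp) [ (λ below → below-absurd (normal H) (offset H) (λ i → below (point-in-conv x i ≋-refl)) (λ i p → off (i , p)) v∈ av≈) ,
                (λ above → below-absurd (λ c → - 1# * normal H c) (- offset H)
                  (λ i → ≤-respˡ-≈ (sym (neg (x i))) (neg-mono-≤ (above (point-in-conv x i ≋-refl))))
                  (λ i p → off (i , neg-cancel (trans (sym (neg (x i))) p)))
                  v∈ (trans (neg v) (-‿cong av≈))) ]′
        where
        neg : ∀ y → ⟨ (λ c → - 1# * normal H c) , y ⟩ ≈ - ⟨ normal H , y ⟩
        neg y = trans (⟨⟩-scale (- 1#) (normal H) y) (solve 1 (λ u → (:- con (+ 1)) :* u := :- u) refl ⟨ normal H , y ⟩)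
        neg-cancel : ∀ {u v} → - u ≈ - v → u ≈ v
        neg-cancel p = antisym (neg-cancel-≤ (≈⇒≤ (sym p))) (neg-cancel-≤ (≈⇒≤ p))
        below-absurd : ∀ a M → (∀ i → evaluate a i ≤ M) → (∀ i → ¬ (evaluate a i ≈ M)) → conv x v → ¬ (⟨ a , v ⟩ ≈ M)
        below-absurd a M bound off v∈@(w , _ , Σw≈1 , _) av≈ = 0≉1 (trans (sym (sum-zero λ i →
          *-zero-cancel (λ p → off i (sym (x-y≈0⇒x≈y p))) (trans (*-comm _ _) (conv-tight a bound v∈ av≈ i)))) Σw≈1)

      exposing⇒strictlyConvex : (∀ i → Exposing i) → StrictlyConvexPosition x
      exposing⇒strictlyConvex exposing = (λ (i , y≋xi) → exposing⇒vertex (exposing i) y≋xi) , vertex⇒point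

      exposing⇒distinct : (∀ i → Exposing i) → ∀ {i j} → x i ≋ x j → i ≡ j
      exposing⇒distinct exposing {i} {j} xi≋xj with i Finₚ.≟ j
      ... | yes i≡j = i≡j
      ... | no i≢j = let (a , _ , top) = exposing j in contradiction (⟨⟩-congˡ a xi≋xj) (<⇒≉ (top i≢j))

    module Distinct (distinct : ∀ {i j} → x i ≋ x j → i ≡ j) where

      supporting⇒strict : ∀ H {P : Point d → Set} i → Supporting H (conv x) →
        (∀ {y} → pts x y × ⟨ normal H , y ⟩ ≈ offset H → P y) → (∀ {y} → P y → y ≋ x i) → ⟨ normal H , x i ⟩ ≈ offset H →
        StrictMax I (evaluate (normal H)) i ⊎ StrictMin I (evaluate (normal H)) i
      supporting⇒strict H i (_ , side) on⇒P P⇒xi ai≈ = [ (λ below → inj₁ λ {l} _ l≢i →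
          [ (λ l<b → <-respʳ-≈ (sym ai≈) l<b) , (λ l≈b → contradiction l≈b (off l≢i)) ]′ (≤-cases (below (point-in-conv x l ≋-refl))))
        , (λ above → inj₂ λ {l} _ l≢i →
          [ (λ b<l → <-respˡ-≈ (sym ai≈) b<l) , (λ b≈l → contradiction (sym b≈l) (off l≢i)) ]′ (≤-cases (above (point-in-conv x l ≋-refl))))
        ]′ side
        where
        off : ∀ {l} → l ≢ i → ¬ (evaluate (normal H) l ≈ offset H)
        off {l} l≢i p = l≢i (distinct (P⇒xi (on⇒P ((l , ≋-refl) , p))))

      abstract
        vertex⇒exposed : ∀ {i} → vert (conv x) (x i) → Exposed I evaluations i
        vertex⇒exposed {i} (H , supp , on⇒v , v⇒on) = expose
          (supporting⇒strict H {_≋ x i} i supp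
            (λ { ((l , y≋xl) , p) → on⇒v (point-in-conv x l y≋xl , p) }) (λ p → p) (proj₂ (v⇒on ≋-refl)))
          where
          f : Fin n → Carrier
          f = evaluate (normal H)
          expose : StrictMax I f i ⊎ StrictMin I f i → Exposed I evaluations i
          expose (inj₁ smax) = f , evaluate-∈ (normal H) , smax
          expose (inj₂ smin) = opposite f , opposite-∈ evaluations (evaluate-∈ (normal H)) , opposite-strictMin f smin

        -- On the points the second functional is `t` times the first, so both hyperplanes give
        -- strict extremes of one functional. Two strict maxima or two strict minima at different
        -- points are impossible, and passing to the opposite puts the maximum at `i`.
        antipodal⇒functional : ∀ {i j} → StrictlyAntipodal x i j →
          ∃[ f ] (evaluations ∋ f × StrictMax I f i × StrictMin I f j)
        antipodal⇒functional {i} {j} (xi≉xj , H′ , H″ , _ , (t , parallel) , supp′ , supp″ , (on⇒i , i⇒on) , (on⇒j , j⇒on)) =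
          conclude (supporting⇒strict H′ {_≋ x i} i supp′ on⇒i (λ p → p) (proj₂ (i⇒on ≋-refl))) at-j
          where
          f g : Fin n → Carrier
          f = evaluate (normal H′)
          g = evaluate (normal H″)
          i≢j : i ≢ j
          i≢j ≡.refl = xi≉xj ≋-refl
          g≈tf : ∀ l → g l ≈ t * f l
          g≈tf l = trans (⟨⟩-cong {y = x l} parallel ≋-refl) (⟨⟩-scale t (normal H′) (x l))
          conclude : StrictMax I f i ⊎ StrictMin I f i → StrictMax I f j ⊎ StrictMin I f j →
            ∃[ f ] (evaluations ∋ f × StrictMax I f i × StrictMin I f j)
          conclude (inj₁ imax) (inj₁ jmax) = contradiction (<⇒≤ (imax (∈-allFin j) (i≢j ∘ ≡.sym))) (jmax (∈-allFin i) i≢j)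
          conclude (inj₁ imax) (inj₂ jmin) = f , evaluate-∈ (normal H′) , imax , jmin
          conclude (inj₂ imin) (inj₁ jmax) = opposite f , opposite-∈ evaluations (evaluate-∈ (normal H′)) ,
            opposite-strictMin f imin , opposite-strictMax f jmax
          conclude (inj₂ imin) (inj₂ jmin) = contradiction (<⇒≤ (imin (∈-allFin j) (i≢j ∘ ≡.sym))) (jmin (∈-allFin i) i≢j)
          up : ∀ {p q} → 0# ≤ t → g p < g q → f p < f q
          up {p} {q} 0≤t p<q q≤p = p<q (≤-respˡ-≈ (sym (g≈tf q)) (≤-respʳ-≈ (sym (g≈tf p)) (*-monoʳ-≤ 0≤t q≤p)))
          down : ∀ {p q} → t ≤ 0# → g p < g q → f q < f p
          down {p} {q} t≤0 p<q p≤q = p<q (≤-respˡ-≈ (sym (g≈tf q)) (≤-respʳ-≈ (sym (g≈tf p)) (*-monoʳ-≤-nonPos t≤0 p≤q)))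
          at-j : StrictMax I f j ⊎ StrictMin I f j
          at-j = orient (total 0# t) (supporting⇒strict H″ {_≋ x j} j supp″ on⇒j (λ p → p) (proj₂ (j⇒on ≋-refl)))
            where
            orient : 0# ≤ t ⊎ t ≤ 0# → StrictMax I g j ⊎ StrictMin I g j → StrictMax I f j ⊎ StrictMin I f j
            orient (inj₁ 0≤t) (inj₁ m) = inj₁ λ lI l≢j → up 0≤t (m lI l≢j)
            orient (inj₁ 0≤t) (inj₂ m) = inj₂ λ lI l≢j → up 0≤t (m lI l≢j)
            orient (inj₂ t≤0) (inj₁ m) = inj₂ λ lI l≢j → down t≤0 (m lI l≢j)
            orient (inj₂ t≤0) (inj₂ m) = inj₁ λ lI l≢j → down t≤0 (m lI l≢j)

    abstract
      -- A normal orthogonal to the differences of the pairs in `C` respects `C`. If it were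
      -- constant on the points, it would be constant on their affine hull, which is the whole
      -- space, and hence zero.
      spanning⇒rank : (∀ y → aff x y) → Rank I evaluations d
      spanning⇒rank spans C len with orthogonal d (map (λ (i , j) c → x i c - x j c) C)
                                      (≡.subst (ℕ._< d) (≡.sym (Listₚ.length-map _ C)) len)
      ... | a , a≉𝟎 , orth = evaluate a , evaluate-∈ a , respects , nonConstant
        where
        respects : Respects (evaluate a) C
        respects {i} {j} ij∈ = x-y≈0⇒x≈y (trans (sym (⟨⟩-minus a (x i) (x j))) (orth (∈-map⁺ (λ (i , j) c → x i c - x j c) ij∈)))
        equal : ¬ NonConstant I (evaluate a) → ∀ i j → evaluate a i ≈ evaluate a j
        equal const i j with em {P = evaluate a i ≈ evaluate a j}
        ... | yes p = p
        ... | no p = contradiction ([ (λ i<j → i , j , ∈-allFin i , ∈-allFin j , i<j) , (λ j<i → j , i , ∈-allFin j , ∈-allFin i , j<i) ]′ (≉-cases p)) const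
        value : ¬ NonConstant I (evaluate a) → ∀ i y → ⟨ a , y ⟩ ≈ evaluate a i
        value const i y = let (w , Σw≈1 , y≋) = spans y in
          trans (⟨⟩-congˡ a y≋) (trans (⟨⟩-combination a w x)
            (trans (sum-cong-≋ λ l → *-congˡ (equal const l i)) (trans (sym (*-distribʳ-sum (evaluate a i) w))
              (trans (*-congʳ Σw≈1) (*-identityˡ _)))))
        inhabited : ∀ {m} (w : Vector Carrier m) → sum w ≈ 1# → Fin m
        inhabited {zero} w Σw≈1 = contradiction Σw≈1 0≉1
        inhabited {suc m} _ _ = zero
        nonConstant : NonConstant I (evaluate a)
        nonConstant with em {P = NonConstant I (evaluate a)}
        ... | yes nc = nc
        ... | no const = contradiction vanish a≉𝟎
          where
          i₀ : Fin n
          i₀ = let (w , Σw≈1 , _) = spans 𝟎 in inhabited w Σw≈1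
          vanish : a ≋ 𝟎
          vanish c = trans (sym (⟨⟩-δ a c)) (trans (value const i₀ (δ c)) (trans (sym (value const i₀ 𝟎)) (⟨⟩-𝟎 a)))

      -- A maximum `i` of `f` is made strict, and then a minimum `j` of the perturbed functional.
      -- Both perturbations refine the order of `f`, so `j` minimises `f` too.
      exposed⇒covers : (∀ i → Exposed I evaluations i) → ∀ {E} →
        (∀ {f i j} → evaluations ∋ f → i ≢ j → StrictMax I f i → StrictMin I f j → (i , j) ∈ E) → Covers I I evaluations E
      exposed⇒covers exposed {E} edge {f} Wf nc@(p , _ , pI , _ , _) =
        let (i , iI , imax) = maximum f pI
            (e , We , emax) = exposed i
            (f₁ , Wf₁ , lex₁) = lexicographic I evaluations Wf We
            (j , jI , jmin) = minimum f₁ pI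
            (e′ , We′ , emax′) = exposed j
            (f₂ , Wf₂ , lex₂) = lexicographic I evaluations Wf₁ (opposite-∈ evaluations We′)
            jmin₀ = λ {l} (lI : l ∈ I) → refines-≤ (lex₁ .refines) jI lI (jmin lI)
        in i , j , edge Wf₂ (λ i≡j → constant-extreme imax jmin₀ (≈⇒≤ (reflexive (≡.cong f i≡j))) nc)
             (λ lI l≢i → lex₂ .refines lI iI (lex₁ .breaksTies lI iI (imax lI) (emax lI l≢i)))
             (λ lI l≢j → lex₂ .breaksTies jI lI (jmin lI) (opposite-< {e′} (emax′ lI l≢j))) ,
           iI , jI , imax , jmin₀

      lowerBound : 𝒞ˢ d n x → suc n ℕ.≤ 2 ℕ.* d → 3 ℕ.* (d ℕ.∸ 1) ℕ.≤ sa x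
      lowerBound (distinct , spans , position) n<2d = ℕₚ.*-cancelˡ-≤ 2
        (≡.subst₂ ℕ._≤_ (ℕₚ.*-assoc 2 3 (d ℕ.∸ 1)) |E|
          (proj₁ (LowerBound.claims em ℝ (Fin n) d) evaluations (Uniqueₚ.allFin⁺ n) (spanning⇒rank spans)
            (≡.subst (λ m → suc m ℕ.≤ 2 ℕ.* d) (≡.sym (Listₚ.length-tabulate {n = n} (λ i → i))) n<2d)
            (exposed⇒covers (λ i → vertex⇒exposed (proj₁ position (i , ≋-refl))) edge)))
        where
        open Distinct distinct
        L E : List (Fin n × Fin n)
        L = filter (λ p → em {P = UnorderedStrictlyAntipodal x p}) (cartesianProduct (allFin n) (allFin n))
        -- Both orientations, so that `length E` is twice `sa x` and 6 = 2 · 3 cancels.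
        E = L ++ map swap L
        |E| : length E ≡ 2 ℕ.* sa x
        |E| = ≡.trans (Listₚ.length-++ L) (≡.cong (length L ℕ.+_) (≡.trans (Listₚ.length-map swap L) (≡.sym (ℕₚ.+-identityʳ _))))
        listed : ∀ {i j} → i Fin.< j → StrictlyAntipodal x i j → (i , j) ∈ L
        listed {i} {j} i<j sa-ij = ∈-filter⁺ (λ p → em {P = UnorderedStrictlyAntipodal x p})
          (∈-cartesianProduct⁺ (∈-allFin i) (∈-allFin j)) (i<j , sa-ij)
        edge : ∀ {f i j} → evaluations ∋ f → i ≢ j → StrictMax I f i → StrictMin I f j → (i , j) ∈ E
        edge {f} {i} {j} Wf i≢j imax jmin with ℕₚ.<-cmp (Fin.toℕ i) (Fin.toℕ j)
        ... | tri< i<j _ _ = ∈-++⁺ˡ (listed i<j (strictlyAntipodal Wf i≢j imax jmin))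
        ... | tri≈ _ i≡j _ = contradiction (Finₚ.toℕ-injective i≡j) i≢j
        ... | tri> _ _ j<i = ∈-++⁺ʳ L (∈-map⁺ swap (listed j<i (strictlyAntipodal (opposite-∈ evaluations Wf) (i≢j ∘ ≡.sym)
                (λ lI l≢j → opposite-< {f} (jmin lI l≢j)) (λ lI l≢i → opposite-< {f} (imax lI l≢i)))))

-- Examples: cross-polytopes with some vertices left out

module PartialCrossPolytope (em : ExcludedMiddle 0ℓ) (ℝ : Reals) where
  open OrderedField em ℝ
  open FiniteSums em ℝ
  open FiniteLists em
  open Geometry ℝ
  open Geometry.Counting ℝ em
  open Configurations em ℝ
  open VectorEquality setoid using (_≋_; ≋-refl)

  sum-split : ∀ m {n} (t : Vector Carrier (m ℕ.+ n)) → sum t ≈ sum (λ p → t (p ↑ˡ n)) + sum (λ q → t (m ↑ʳ q))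
  sum-split zero t = sym (+-identityˡ _)
  sum-split (suc m) t = trans (+-congˡ (sum-split m (t ∘ suc))) (sym (+-assoc _ _ _))

  data SplitView (m n : ℕ) : Fin (m ℕ.+ n) → Set where
    left : (p : Fin m) → SplitView m n (p ↑ˡ n)
    right : (q : Fin n) → SplitView m n (m ↑ʳ q)

  splitView : ∀ m n i → SplitView m n i
  splitView zero n i = right i
  splitView (suc m) n zero = left zero
  splitView (suc m) n (suc i) with splitView m n i
  ... | left p = left (suc p)
  ... | right q = right q

  ↑ˡ≢↑ʳ : ∀ {m n} {p : Fin m} {q : Fin n} → p ↑ˡ n ≢ m ↑ʳ q
  ↑ˡ≢↑ʳ {suc m} {p = suc p} eq = ↑ˡ≢↑ʳ {m} (Finₚ.suc-injective eq)

  module Points (d k : ℕ) (k≤d : k ℕ.≤ d) where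

    mirrored : Fin k → Fin d
    mirrored q = inject≤ q k≤d

    x : Vector (Point d) (d ℕ.+ k)
    x i = [ δ , (λ q c → - δ (mirrored q) c) ]′ (splitAt d i)

    open Family x

    x-left : ∀ p → x (p ↑ˡ k) ≡ δ p
    x-left p = ≡.cong [ δ , (λ q c → - δ (mirrored q) c) ]′ (Finₚ.splitAt-↑ˡ d p k)

    x-right : ∀ q → x (d ↑ʳ q) ≡ λ c → - δ (mirrored q) c
    x-right q = ≡.cong [ δ , (λ q c → - δ (mirrored q) c) ]′ (Finₚ.splitAt-↑ʳ d k q)

    abstract
      evaluate-left : ∀ a p → evaluate a (p ↑ˡ k) ≈ a p
      evaluate-left a p = trans (reflexive (≡.cong ⟨ a ,_⟩ (x-left p))) (⟨⟩-δ a p)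

      evaluate-right : ∀ a q → evaluate a (d ↑ʳ q) ≈ - a (mirrored q)
      evaluate-right a q = trans (reflexive (≡.cong ⟨ a ,_⟩ (x-right q)))
        (trans (sum-cong-≋ λ c → solve 2 (λ a e → a :* :- e := :- (a :* e)) refl (a c) (δ (mirrored q) c))
          (trans (sum-neg (λ c → a c * δ (mirrored q) c)) (-‿cong (⟨⟩-δ a (mirrored q)))))

      -δ≤0 : ∀ {n} (i j : Fin n) → - δ i j ≤ 0#
      -δ≤0 i j = ≤-respʳ-≈ (solve 0 (:- con (+ 0) := con (+ 0)) refl) (neg-mono-≤ (δ-nonNegative i j))

      1≉0 : ∀ {y} → y ≈ 1# → ¬ (y ≈ 0#)
      1≉0 y≈1 y≈0 = 0≉1 (trans (sym y≈0) y≈1)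

      neg-neg-1 : - - 1# ≈ 1#
      neg-neg-1 = solve 0 (:- :- con (+ 1) := con (+ 1)) refl

      -- Each point is its own exposing normal: its product with itself is 1, with any other point 0
      -- or -1.
      exposing : ∀ i → Exposing i
      exposing i with splitView d k i
      ... | left p = δ p , (λ δp≋𝟎 → 1≉0 (δ-refl p) (δp≋𝟎 p)) , λ {l} l≢i →
              <-respʳ-≈ (sym (trans (evaluate-left (δ p) p) (δ-refl p))) (≤-<-trans (nonPositive l l≢i) 0<1)
        where
        nonPositive : ∀ l → l ≢ p ↑ˡ k → evaluate (δ p) l ≤ 0#
        nonPositive l l≢ with splitView d k l
        ... | left p′ = ≈⇒≤ (trans (evaluate-left (δ p) p′) (δ-≢ λ p≡p′ → l≢ (≡.cong (_↑ˡ k) (≡.sym p≡p′))))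
        ... | right q = ≤-respˡ-≈ (sym (evaluate-right (δ p) q)) (-δ≤0 p (mirrored q))
      ... | right q = a , (λ a≋𝟎 → 1≉0 (trans (-‿cong (a≋𝟎q a≋𝟎)) neg-neg-1) (trans (sym (evaluate-right a q)) (𝟎-⟨⟩ a≋𝟎 (x (d ↑ʳ q))))) , λ {l} l≢i →
              <-respʳ-≈ (sym (trans (evaluate-right a q) (trans (-‿cong (-‿cong (δ-refl (mirrored q)))) neg-neg-1))) (≤-<-trans (nonPositive l l≢i) 0<1)
        where
        a : Point d
        a c = - δ (mirrored q) c
        a≋𝟎q : a ≋ 𝟎 → a (mirrored q) ≈ - 1#
        a≋𝟎q _ = -‿cong (δ-refl (mirrored q))
        nonPositive : ∀ l → l ≢ d ↑ʳ q → evaluate a l ≤ 0#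
        nonPositive l l≢ with splitView d k l
        ... | left p = ≤-respˡ-≈ (sym (evaluate-left a p)) (-δ≤0 (mirrored q) p)
        ... | right q′ = ≈⇒≤ (trans (evaluate-right a q′) (trans (-‿cong (-‿cong (δ-≢ λ eq →
                l≢ (≡.cong (d ↑ʳ_) (≡.sym (Finₚ.inject≤-injective k≤d k≤d q q′ eq)))))) (solve 0 (:- :- con (+ 0) := con (+ 0)) refl)))

  -- The multiples of the first basis vector and its negative in equal parts
  -- adjust the total weight without moving the point.
  module Spanning (d k : ℕ) (k≤d : suc k ℕ.≤ suc d) where
    open Points (suc d) (suc k) k≤d

    abstract
      half : ∃[ h ] (h + h ≈ 1#)
      half = let (h , 2h≈1) = inverse (1# + 1#) (<⇒≉′ (0<+ˡ 0<1 (<⇒≤ 0<1))) in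
        h , trans (solve 1 (λ h → h :+ h := (con (+ 1) :+ con (+ 1)) :* h) refl h) 2h≈1

      spanning : ∀ y → aff x y
      spanning y = w , total-weight , λ c → sym (coordinate c)
        where
        h t Y : Carrier
        h = proj₁ half
        Y = sum y
        t = (1# - Y) * h
        wˡ : Fin (suc d) → Carrier
        wˡ p = y p + t * δ zero p
        wʳ : Fin (suc k) → Carrier
        wʳ q = t * δ zero q
        w : Vector Carrier (suc d ℕ.+ suc k)
        w i = [ wˡ , wʳ ]′ (splitAt (suc d) i)
        w-left : ∀ p → w (p ↑ˡ suc k) ≡ wˡ p
        w-left p = ≡.cong [ wˡ , wʳ ]′ (Finₚ.splitAt-↑ˡ (suc d) p (suc k))
        w-right : ∀ q → w (suc d ↑ʳ q) ≡ wʳ q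
        w-right q = ≡.cong [ wˡ , wʳ ]′ (Finₚ.splitAt-↑ʳ (suc d) (suc k) q)
        Σtδ : ∀ n → sum (λ (p : Fin (suc n)) → t * δ zero p) ≈ t
        Σtδ n = trans (sym (*-distribˡ-sum t (δ {suc n} zero))) (trans (*-congˡ (sum-δ-1 {suc n} zero)) (*-identityʳ t))
        total-weight : sum w ≈ 1#
        total-weight = trans (sum-split (suc d) w) (trans (+-cong
          (trans (sum-cong-≋ λ p → reflexive (w-left p)) (trans (∑-distrib-+ y (λ p → t * δ zero p)) (+-congˡ (Σtδ d))))
          (trans (sum-cong-≋ λ q → reflexive (w-right q)) (Σtδ k)))
          (trans (solve 2 (λ Y h → Y :+ (con (+ 1) :- Y) :* h :+ (con (+ 1) :- Y) :* h := Y :+ (con (+ 1) :- Y) :* (h :+ h)) refl Y h)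
            (trans (+-congˡ (trans (*-congˡ (proj₂ half)) (*-identityʳ _))) (solve 1 (λ Y → Y :+ (con (+ 1) :- Y) := con (+ 1)) refl Y))))
        at-left : ∀ c p → w (p ↑ˡ suc k) * x (p ↑ˡ suc k) c ≈ δ c p * wˡ p
        at-left c p = trans (*-cong (reflexive (w-left p)) (trans (reflexive (≡.cong (λ v → v c) (x-left p))) (δ-sym p c))) (*-comm _ _)
        at-right : ∀ c q → w (suc d ↑ʳ q) * x (suc d ↑ʳ q) c ≈ δ zero q * (t * - δ (mirrored q) c)
        at-right c q = trans (*-cong (reflexive (w-right q)) (reflexive (≡.cong (λ v → v c) (x-right q))))
          (solve 3 (λ t a b → t :* a :* b := a :* (t :* b)) refl t (δ zero q) (- δ (mirrored q) c))
        coordinate : ∀ c → combination w x c ≈ y c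
        coordinate c = trans (sum-split (suc d) (λ i → w i * x i c)) (trans (+-cong
          (trans (sum-cong-≋ (at-left c)) (sum-δ c wˡ))
          (trans (sum-cong-≋ (at-right c)) (sum-δ zero (λ q → t * - δ (mirrored q) c))))
          (solve 3 (λ y t e → y :+ t :* e :+ t :* :- e := y) refl (y c) t (δ zero c)))

    x∈𝒞ˢ : 𝒞ˢ (suc d) (suc d ℕ.+ suc k) x
    x∈𝒞ˢ = Family.exposing⇒distinct x exposing , spanning , Family.exposing⇒strictlyConvex x exposing

  -- For k = d - 1 the points form a pyramid over a cross-polytope, in which
  -- only opposite vertices of the base and pairs with the apex are antipodal.
  module Pyramid (r : ℕ) where
    private
      d k : ℕ
      d = suc (suc r)
      k = suc r
      k≤d : k ℕ.≤ d
      k≤d = ℕₚ.n≤1+n k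
    open Points d k k≤d
    open Family x
    open Values em ℝ (Fin (d ℕ.+ k))

    apex : Fin d
    apex = fromℕ k

    data ApexView : Fin d → Set where
      isApex : ApexView apex
      isBase : (q : Fin k) → ApexView (mirrored q)

    apexView : ∀ p → ApexView p
    apexView p with k ℕₚ.≟ Fin.toℕ p
    ... | yes eq = ≡.subst ApexView (Finₚ.toℕ-injective (≡.trans (Finₚ.toℕ-fromℕ k) eq)) isApex
    ... | no neq = ≡.subst ApexView (Finₚ.toℕ-injective (≡.trans (Finₚ.toℕ-inject≤ _ k≤d) (Finₚ.toℕ-lower₁ p neq)))
                     (isBase (lower₁ p neq))

    module _ {f i j} (Wf : evaluations ∋ f) (imax : StrictMax I f i) (jmin : StrictMin I f j) where
      private
        a : Point d
        a = proj₁ Wf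
        f-left : ∀ p → f (p ↑ˡ k) ≈ a p
        f-left p = trans (proj₂ Wf (p ↑ˡ k)) (evaluate-left a p)
        f-right : ∀ q → f (d ↑ʳ q) ≈ - a (mirrored q)
        f-right q = trans (proj₂ Wf (d ↑ʳ q)) (evaluate-right a q)
        below : ∀ l {u v} → l ≢ i → f l ≈ u → f i ≈ v → u < v
        below l l≢i p q = <-respˡ-≈ p (<-respʳ-≈ q (imax (∈-allFin l) l≢i))
        above : ∀ l {u v} → l ≢ j → f l ≈ u → f j ≈ v → v < u
        above l l≢j p q = <-respˡ-≈ q (<-respʳ-≈ p (jmin (∈-allFin l) l≢j))
        flip : ∀ {u v} → - u < v → - v < u
        flip {u} -u<v = <-respʳ-≈ (solve 1 (λ u → :- :- u := u) refl u) (neg-mono-< -u<v)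

      -- The base is symmetric about the origin. If base points v and w ≠ -v were strict maximum and
      -- strict minimum of f, then comparison with -w and -v would give -f(w) < f(v) < -f(w). The
      -- two variants below rest on the same symmetry.
      not-left-left : ∀ {q q′} → i ≡ mirrored q ↑ˡ k → ¬ (j ≡ mirrored q′ ↑ˡ k)
      not-left-left {q} {q′} ≡.refl ≡.refl = <-trans
        (flip (below (d ↑ʳ q′) (↑ˡ≢↑ʳ ∘ ≡.sym) (f-right q′) (f-left (mirrored q))))
        (above (d ↑ʳ q) (↑ˡ≢↑ʳ ∘ ≡.sym) (f-right q) (f-left (mirrored q′))) ≤-refl

      not-left-right : ∀ {q q′} → q ≢ q′ → i ≡ mirrored q ↑ˡ k → ¬ (j ≡ d ↑ʳ q′)
      not-left-right {q} {q′} q≢q′ ≡.refl ≡.refl = <-trans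
        (neg-mono-< (below (mirrored q′ ↑ˡ k)
          (λ eq → q≢q′ (≡.sym (Finₚ.inject≤-injective k≤d k≤d q′ q (Finₚ.↑ˡ-injective k _ _ eq))))
          (f-left (mirrored q′)) (f-left (mirrored q))))
        (above (d ↑ʳ q) (λ eq → q≢q′ (Finₚ.↑ʳ-injective d _ _ eq)) (f-right q) (f-right q′)) ≤-refl

      not-right-right : ∀ {q q′} → i ≡ d ↑ʳ q → ¬ (j ≡ d ↑ʳ q′)
      not-right-right {q} {q′} ≡.refl ≡.refl = <-trans
        (flip (above (mirrored q ↑ˡ k) ↑ˡ≢↑ʳ (f-left (mirrored q)) (f-right q′)))
        (below (mirrored q′ ↑ˡ k) ↑ˡ≢↑ʳ (f-left (mirrored q′)) (f-right q)) ≤-refl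

    Pair : Set
    Pair = Fin (d ℕ.+ k) × Fin (d ℕ.+ k)

    opposite-pair basis-apex mirror-apex : Fin k → Pair
    opposite-pair q = mirrored q ↑ˡ k , d ↑ʳ q
    basis-apex q = mirrored q ↑ˡ k , apex ↑ˡ k
    mirror-apex q = apex ↑ˡ k , d ↑ʳ q

    candidates : List Pair
    candidates = map opposite-pair (allFin k) ++ map basis-apex (allFin k) ++ map mirror-apex (allFin k) ++ []

    length-candidates : length candidates ≡ 3 ℕ.* k
    length-candidates = ≡.trans (Listₚ.length-++ (map opposite-pair (allFin k)))
      (≡.cong₂ ℕ._+_ (|map| opposite-pair) (≡.trans (Listₚ.length-++ (map basis-apex (allFin k)))
        (≡.cong₂ ℕ._+_ (|map| basis-apex) (≡.trans (Listₚ.length-++ (map mirror-apex (allFin k)))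
          (≡.cong (ℕ._+ 0) (|map| mirror-apex))))))
      where
      |map| : ∀ (g : Fin k → Pair) → length (map g (allFin k)) ≡ k
      |map| g = ≡.trans (Listₚ.length-map g (allFin k)) (Listₚ.length-tabulate {n = k} (λ i → i))

    candidate₁ : ∀ q → opposite-pair q ∈ candidates
    candidate₁ q = ∈-++⁺ˡ (∈-map⁺ opposite-pair (∈-allFin q))

    candidate₂ : ∀ q → basis-apex q ∈ candidates
    candidate₂ q = ∈-++⁺ʳ (map opposite-pair (allFin k)) (∈-++⁺ˡ (∈-map⁺ basis-apex (∈-allFin q)))

    candidate₃ : ∀ q → mirror-apex q ∈ candidates
    candidate₃ q = ∈-++⁺ʳ (map opposite-pair (allFin k)) (∈-++⁺ʳ (map basis-apex (allFin k))
      (∈-++⁺ˡ (∈-map⁺ mirror-apex (∈-allFin q))))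

    -- The condition i < j rules out a negative basis vector before a positive one, and the apex,
    -- which is the last positive one, before another. The symmetry of the base rules out the
    -- remaining pairs.
    classify : ∀ {f i j} → evaluations ∋ f → StrictMax I f i → StrictMin I f j → i Fin.< j → (i , j) ∈ candidates
    classify {f} {i} {j} Wf imax jmin i<j with splitView d k i | splitView d k j
    ... | right q | right q′ = contradiction ≡.refl (not-right-right Wf imax jmin ≡.refl)
    ... | right q | left p = contradiction
            (ℕₚ.<-trans (≡.subst₂ ℕ._<_ (Finₚ.toℕ-↑ʳ d q) (Finₚ.toℕ-↑ˡ p k) i<j) (Finₚ.toℕ<n p))
            (ℕₚ.≤⇒≯ (ℕₚ.m≤m+n d (Fin.toℕ q)))
    ... | left p | right q = withMirror (apexView p) imax
      where
      withMirror : ∀ {p} → ApexView p → StrictMax I f (p ↑ˡ k) → (p ↑ˡ k , d ↑ʳ q) ∈ candidates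
      withMirror isApex _ = candidate₃ q
      withMirror (isBase q′) imax with q′ Finₚ.≟ q
      ... | yes ≡.refl = candidate₁ q
      ... | no q′≢q = contradiction ≡.refl (not-left-right Wf imax jmin q′≢q ≡.refl)
    ... | left p | left p′ = withBasis (apexView p) (apexView p′) imax jmin
            (≡.subst₂ ℕ._<_ (Finₚ.toℕ-↑ˡ p k) (Finₚ.toℕ-↑ˡ p′ k) i<j)
      where
      withBasis : ∀ {p p′} → ApexView p → ApexView p′ → StrictMax I f (p ↑ˡ k) → StrictMin I f (p′ ↑ˡ k) →
                  Fin.toℕ p ℕ.< Fin.toℕ p′ → (p ↑ˡ k , p′ ↑ˡ k) ∈ candidates
      withBasis {p′ = p′} isApex _ _ _ p<p′ = contradiction
        (≡.subst (ℕ._< Fin.toℕ p′) (Finₚ.toℕ-fromℕ k) p<p′) (ℕₚ.≤⇒≯ (ℕₚ.≤-pred (Finₚ.toℕ<n p′)))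
      withBasis (isBase q) isApex _ _ _ = candidate₂ q
      withBasis (isBase q) (isBase q′) imax jmin _ = contradiction ≡.refl (not-left-left Wf imax jmin ≡.refl)

    sa≤ : sa x ℕ.≤ 3 ℕ.* k
    sa≤ = ≡.subst (sa x ℕ.≤_) length-candidates (length-⊆
      (Uniqueₚ.filter⁺ (λ p → em {P = UnorderedStrictlyAntipodal x p})
        (Uniqueₚ.cartesianProduct⁺ (Uniqueₚ.allFin⁺ (d ℕ.+ k)) (Uniqueₚ.allFin⁺ (d ℕ.+ k))))
      listed)
      where
      listed : ∀ {e} → e ∈ filter (λ p → em {P = UnorderedStrictlyAntipodal x p}) (cartesianProduct (allFin (d ℕ.+ k)) (allFin (d ℕ.+ k))) →
               e ∈ candidates
      listed e∈ =
        let (_ , i<j , antipodal) = ∈-filter⁻ (λ p → em {P = UnorderedStrictlyAntipodal x p})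
              {xs = cartesianProduct (allFin (d ℕ.+ k)) (allFin (d ℕ.+ k))} e∈
            (f , Wf , imax , jmin) = Distinct.antipodal⇒functional (exposing⇒distinct exposing) antipodal
        in classify Wf imax jmin i<j

  least : (P : ℕ → Set) → ∀ n → P n → ∃[ m ] (P m × (∀ {j} → P j → m ℕ.≤ j))
  least P n Pn = go n ℕₚ.≤-refl Pn
    where
    go : ∀ fuel {n} → n ℕ.≤ fuel → P n → ∃[ m ] (P m × (∀ {j} → P j → m ℕ.≤ j))
    go fuel {n} n≤ Pn with em {P = ∃[ j ] (j ℕ.< n × P j)}
    ... | no none = n , Pn , λ {j} Pj → ℕₚ.≮⇒≥ λ j<n → none (j , j<n , Pj)
    go zero z≤n Pn | yes (_ , () , _)
    go (suc fuel) n≤ Pn | yes (j , j<n , Pj) = go fuel (ℕₚ.≤-pred (ℕₚ.≤-trans j<n n≤)) Pj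

open import Data.Nat.Base using (_≤_; _+_; _*_; _∸_)

theorem2p15 : (em : ExcludedMiddle 0ℓ) (ℝ : Reals) →
  let open Geometry ℝ
      open Counting em
  in (d : ℕ) → 2 ≤ d →
     ((k : ℕ) → 1 ≤ k → k ≤ d ∸ 1 →
        ∃[ m ] (IsMinSa d (d + k) m × 3 * (d ∸ 1) ≤ m))
     × IsMinSa d (2 * d ∸ 1) (3 * (d ∸ 1))
theorem2p15 em ℝ (suc (suc r)) (s≤s (s≤s z≤n)) = bounds , ≡.subst (λ n → IsMinSa d n (3 ℕ.* suc r)) size
    ((pyramid , pyramid∈ , ℕₚ.≤-antisym (Pyramid.sa≤ r) (lower ℕₚ.≤-refl pyramid pyramid∈)) , lower ℕₚ.≤-refl)
  where
  open Geometry ℝ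
  open Counting em
  open PartialCrossPolytope em ℝ
  open Configurations em ℝ
  d : ℕ
  d = suc (suc r)
  size : d ℕ.+ suc r ≡ 2 ℕ.* d ℕ.∸ 1
  size = ≡.cong suc (≡.trans (≡.sym (ℕₚ.+-suc r (suc r))) (≡.cong (λ n → r ℕ.+ suc (suc n)) (≡.sym (ℕₚ.+-identityʳ r))))
  lower : ∀ {k} → k ℕ.≤ suc r → ∀ x → 𝒞ˢ d (d ℕ.+ k) x → 3 ℕ.* suc r ℕ.≤ sa x
  lower {k} k≤ x x∈ = Family.lowerBound x x∈ (≡.subst₂ ℕ._≤_ (ℕₚ.+-suc d k) (≡.cong (d ℕ.+_) (≡.sym (ℕₚ.+-identityʳ d)))
    (ℕₚ.+-monoʳ-≤ d (s≤s k≤)))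
  pyramid : Vector (Point d) (d ℕ.+ suc r)
  pyramid = Points.x d (suc r) (ℕₚ.n≤1+n (suc r))
  pyramid∈ : 𝒞ˢ d (d ℕ.+ suc r) pyramid
  pyramid∈ = Spanning.x∈𝒞ˢ (suc r) r (ℕₚ.n≤1+n (suc r))
  bounds : (k : ℕ) → 1 ℕ.≤ k → k ℕ.≤ suc r → ∃[ m ] (IsMinSa d (d ℕ.+ k) m × 3 ℕ.* suc r ℕ.≤ m)
  bounds (suc k) _ k≤ =
    -- The truncated cross-polytope shows that the family is nonempty, so that `sa` has a least
    -- value on it.
    let x = Points.x d (suc k) (ℕₚ.m≤n⇒m≤1+n k≤)
        (m , attained@(y , y∈ , say≡m) , minimal) = least (λ m → ∃[ x ] (𝒞ˢ d (d ℕ.+ suc k) x × sa x ≡ m)) (sa x)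
          (x , Spanning.x∈𝒞ˢ (suc r) k (ℕₚ.m≤n⇒m≤1+n k≤) , ≡.refl)
    in m , (attained , λ x x∈ → minimal (x , x∈ , ≡.refl)) , ≡.subst (3 ℕ.* suc r ℕ.≤_) say≡m (lower k≤ y y∈)
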